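{- Let $k \geq 6$ and $r \geq 3$ be integers, and let $H$ be the graph consisting of $k$ pairwise vertex-disjoint cycles, each of order $r$. Every graph $G$ with average degree at least $\tfrac{4}{3}kr$ contains $H$ as a minor.
   Context: Graphs are finite and simple. The average degree of a graph $G$ is $d(G) = 2|E(G)|/|V(G)|$. A graph $H$ is a minor of $G$ if a graph isomorphic to $H$ can be obtained from $G$ by a sequence of vertex deletions, edge deletions and edge contractions. -}

module Defs where

open import Data.Nat using (ℕ; zero; suc; _+_; _*_; _≡ᵇ_; _%_; _<?_)
open import Data.Fin using (Fin; toℕ; punchIn; remQuot; _≟_)
open import Data.Bool using (Bool; true; false; _∧_; _∨_; not; T)
open import Data.Bool.Properties using (∨-comm)
open import Data.Product using (_×_; _,_; proj₁; proj₂)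
open import Data.List using (List; length; filter; allFin; concatMap; map)
open import Data.Empty using (⊥-elim)
open import Relation.Nullary using (¬_; does; yes; no)
open import Relation.Binary.PropositionalEquality using (_≡_; refl; sym; cong; cong₂)
open import Function.Bundles using (_↔_; Inverse)

record Graph : Set where
  field
    n     : ℕ
    adj   : Fin n → Fin n → Bool
    adj-sym   : ∀ x y → adj x y ≡ adj y x
    adj-irref : ∀ x → adj x x ≡ false
open Graph public

eqᶠ : ∀ {m} → Fin m → Fin m → Bool
eqᶠ x y = does (x ≟ y)

eqᶠ-sym : ∀ {m} (a b : Fin m) → eqᶠ a b ≡ eqᶠ b a
eqᶠ-sym a b with a ≟ b | b ≟ a
... | yes _ | yes _ = refl
... | no _  | no _  = refl
... | yes p | no q  = ⊥-elim (q (sym p))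
... | no q  | yes p = ⊥-elim (q (sym p))

eqᶠ-refl : ∀ {m} (a : Fin m) → eqᶠ a a ≡ true
eqᶠ-refl a with a ≟ a
... | yes _ = refl
... | no q  = ⊥-elim (q refl)

mkGraph : (m : ℕ) → (Fin m → Fin m → Bool) → Graph
mkGraph m a = record
  { n = m
  ; adj = λ x y → not (eqᶠ x y) ∧ (a x y ∨ a y x)
  ; adj-sym = λ x y → cong₂ (λ p q → not p ∧ q) (eqᶠ-sym x y) (∨-comm (a x y) (a y x))
  ; adj-irref = λ x → cong (λ p → not p ∧ (a x x ∨ a x x)) (eqᶠ-refl x) }

allPairs : (m : ℕ) → List (Fin m × Fin m)
allPairs m = concatMap (λ x → map (λ y → (x , y)) (allFin m)) (allFin m)

edgeCount : Graph → ℕ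
edgeCount G = length (filter (λ p → toℕ (proj₁ p) <? toℕ (proj₂ p))
                       (filter (λ p → Data.Bool._≟_ (adj G (proj₁ p) (proj₂ p)) true)
                         (allPairs (n G))))
  where import Data.Bool

record _≅_ (H G : Graph) : Set where
  field
    bij  : Fin (n H) ↔ Fin (n G)
    pres : ∀ x y → adj G (Inverse.to bij x) (Inverse.to bij y) ≡ adj H x y

-- The three minor operations.  G is a graph on Fin (suc m) in the
-- vertex-deleting operations; vertices of the result are Fin m, the
-- vertex x of the result corresponding to the vertex punchIn v x of G.

deleteVertex : (m : ℕ) (adjG : Fin (suc m) → Fin (suc m) → Bool) → Fin (suc m) → Graph
deleteVertex m adjG v = mkGraph m (λ x y → adjG (punchIn v x) (punchIn v y))

deleteEdge : (G : Graph) → Fin (n G) → Fin (n G) → Graph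
deleteEdge G u v = mkGraph (n G) (λ x y →
  adj G x y ∧ not ((eqᶠ x u ∧ eqᶠ y v) ∨ (eqᶠ x v ∧ eqᶠ y u)))

-- Contract the edge {u , v} (u ≠ v adjacent): v is removed and merged
-- into u; the merged vertex is adjacent to all neighbours of u or of v.
-- Loops and parallel edges are discarded (the result is simple).
contractEdge : (m : ℕ) (adjG : Fin (suc m) → Fin (suc m) → Bool) → Fin (suc m) → Fin (suc m) → Graph
contractEdge m adjG u v = mkGraph m (λ x y →
  let x' = punchIn v x ; y' = punchIn v y in
  adjG x' y' ∨ (eqᶠ x' u ∧ adjG v y') ∨ (eqᶠ y' u ∧ adjG x' v))

data Step : Graph → Graph → Set where
  del-vertex : ∀ m adjG s i (v : Fin (suc m)) →
    Step (record { n = suc m ; adj = adjG ; adj-sym = s ; adj-irref = i })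
         (deleteVertex m adjG v)
  del-edge : ∀ G (u v : Fin (n G)) → T (adj G u v) → Step G (deleteEdge G u v)
  contract : ∀ m adjG s i (u v : Fin (suc m)) → T (adjG u v) →
    Step (record { n = suc m ; adj = adjG ; adj-sym = s ; adj-irref = i })
         (contractEdge m adjG u v)

data _≼_ (H : Graph) : Graph → Set where
  done : ∀ {G} → H ≅ G → H ≼ G
  step : ∀ {G G'} → Step G G' → H ≼ G' → H ≼ G

-- k pairwise vertex-disjoint cycles, each of order r (r ≥ 3):
-- vertex set Fin (k * r), vertex ↦ (cycle index , position in Fin r);
-- two vertices are adjacent iff they lie in the same cycle and their
-- positions a, b satisfy b ≡ a + 1 (mod r) or a ≡ b + 1 (mod r).

disjointCycles : (k r : ℕ) → Graph
disjointCycles k zero = mkGraph (k * zero) (λ _ _ → false)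
disjointCycles k (suc r') = mkGraph (k * r) (λ x y →
  let (i , a) = remQuot {k} r x ; (j , b) = remQuot {k} r y in
  eqᶠ i j ∧ ((toℕ b ≡ᵇ (suc (toℕ a) % r)) ∨ (toℕ a ≡ᵇ (suc (toℕ b) % r))))
  where r = suc r'

{-# OPTIONS --safe #-}
-- Write Q(W) for twice the number of edges inside a vertex set W.  By induction
-- on k, every nonempty W with 3 Q(W) ≥ (4rk - r - 3)|W| contains k disjoint
-- cycles of length at least r; contracting these gives the minor.
--
-- For k = 1 this is the Erdős–Gallai theorem.  Take a longest path whose first
-- vertex x has maximum degree among the first vertices of its rotations, and let
-- S consist of the predecessors on the path of the neighbours of x.  If there is
-- no long cycle, then every vertex of S has degree at most |S| and all its
-- neighbours among the first r - 1 vertices of the path, so deleting S removes at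
-- most (r - 1)|S| / 2 edges.
--
-- For k = k₁ + k₂, W is split into two sets that are dense enough for k₁ and k₂.
-- Start with a fraction p of every vertex on the first side.  For fractional
-- vertices u, v, shift weight between them so that the difference of the two
-- surpluses stays fixed; this difference is linear in the fractions, so each
-- surplus changes by the same quadratic function, which is linear if u, v are not
-- adjacent and costs at most (Δu² + Δv²)/2 otherwise.  Nonadjacent pairs are
-- rounded for free until the fractional vertices form a clique.  A clique on kr
-- vertices contains the cycles; a smaller one is rounded at bounded cost until one
-- fractional vertex is left, and an inequality of the form
-- q²/x + (1 - q)²/(1 - x) ≥ 1 shows that it can be put on one of the two sides.
module Submission where

open import Defs

-- The factor 4/3 comes from the case r = 3. If a threshold c r k - d is to agree at k = 1 with
-- three times the Erdős-Gallai bound r - 1, then d = (c - 3) r + 3. Splitting k evenly with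
-- fraction 1/2 gives each side a surplus of about d |W| / 4, whereas with q = 1/2 the last vertex
-- may ask for a quarter of the largest possible weight, which is about 6 |W| / 4. So d ≥ 6, and for
-- r = 3 this says c ≥ 4. Triangles are therefore the tight case. For odd k the product k₁ k₂ is
-- slightly below k² / 4 and the terms in |W| no longer balance; for r ≥ 4 the larger d makes up for
-- it, for r = 3 the fraction and q must follow the shares of the two thresholds, and then these
-- terms cancel exactly. Shifting weight needs every vertex weight to be positive. This holds after
-- passing to a dense subset from which no vertex of low degree can be deleted. An excess that is
-- only slightly negative is enough in the end: it is an integer, and for triangles a multiple of 6.

module DisjointCycles where

  open import Data.Nat as ℕ using (ℕ; zero; suc)
  import Data.Nat.Properties as ℕ
  open import Data.Nat.DivMod using (m<n⇒m%n≡m; n%n≡0)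
  open import Data.Nat.Induction using (<-rec)
  open import Data.Integer using (ℤ; +_; 0ℤ; 1ℤ; _+_; _*_; _-_; -_; _⊓_; _≤_; _<_; _≤?_; _<?_; +≤+; +<+; nonNegative; positive; ≢-nonZero)
  open import Data.Integer.Properties hiding (_≟_; _≤?_; _<?_) renaming (i≤j⇒0≤j-i to 0≤-; suc[i]≤j⇒i<j to 1+≤⇒<; i<j⇒suc[i]≤j to <⇒1+≤)
  import Data.Integer.Properties as ℤ
  open import Data.Integer.Tactic.RingSolver using (solve-∀)
  open import Data.Fin using (Fin; zero; suc; _≟_; toℕ; fromℕ<; combine; remQuot; punchIn; punchOut)
  import Data.Fin.Properties as Fin
  open import Data.Bool using (Bool; true; false; not; _∧_; _∨_) renaming (T to True)
  import Data.Bool.Properties as Bool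
  open import Data.Maybe using (Maybe; just; nothing)
  open import Data.Maybe.Properties using (just-injective; ≡-dec)
  open import Data.Sum as Sum using (_⊎_; inj₁; inj₂; [_,_]′)
  open import Data.Product using (_×_; _,_; proj₁; proj₂; ∃)
  open import Data.Empty using (⊥; ⊥-elim)
  open import Data.List using (List; []; _∷_; _++_; length; filter; take; drop; map; concatMap; lookup; tabulate; allFin; cartesianProduct)
  open import Data.List.Properties using (filter-notAll; ++-assoc; length-++; length-take; length-drop; take++drop≡id)
  open import Data.List.Membership.Propositional using (_∈_; _∉_; lose; find)
  open import Data.List.Membership.Propositional.Properties using (∈-filter⁺; ∈-allFin; ∈-∃++; ∈-++⁺ˡ; ∈-++⁺ʳ; ∈-++⁻; ∈-lookup; ∈-cartesianProduct⁺)
  import Data.List.Membership.DecPropositional as DecMembership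
  open import Data.List.Relation.Unary.Any using (Any; here; there; any?; index)
  open import Data.List.Relation.Unary.Any.Properties using (lookup-index)
  open import Data.List.Relation.Unary.All using (All; []; _∷_)
  import Data.List.Relation.Unary.All as All
  open import Data.List.Relation.Unary.All.Properties using (¬Any⇒All¬; filter⁺; all-filter) renaming (++⁺ to All-++⁺; ++⁻ˡ to All-++⁻ˡ; ++⁻ʳ to All-++⁻ʳ; take⁺ to All-take⁺; drop⁺ to All-drop⁺)
  open import Data.List.Relation.Unary.AllPairs using (AllPairs; []; _∷_)
  import Data.List.Relation.Unary.AllPairs as AllPairs
  open import Data.List.Relation.Unary.AllPairs.Properties using () renaming (take⁺ to AllPairs-take⁺; drop⁺ to AllPairs-drop⁺)
  open import Data.List.Relation.Unary.Linked using (Linked; []; [-]; _∷_)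
  open import Data.List.Relation.Unary.Linked.Properties using (AllPairs⇒Linked)
  open import Data.List.Relation.Unary.Unique.Propositional using (Unique)
  import Data.List.Relation.Unary.Unique.Propositional.Properties as Unique
  open import Data.List.Relation.Binary.Permutation.Propositional using (_↭_; ↭-refl; ↭-trans; ↭⇒↭ₛ)
  open import Data.List.Relation.Binary.Permutation.Propositional.Properties using (shift; All-resp-↭)
  import Data.List.Relation.Binary.Permutation.Setoid.Properties as Permₛ
  open import Relation.Nullary using (¬_; Dec; yes; no; does)
  open import Relation.Nullary.Decidable using (¬?; _⊎-dec_; _×-dec_; decidable-stable)
  open import Relation.Binary.PropositionalEquality using (_≡_; _≢_; refl; sym; trans; cong; cong₂; subst; subst₂; setoid; module ≡-Reasoning)
  open import Relation.Binary.Construct.Closure.ReflexiveTransitive using (Star; ε; _◅_)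
  open import Function.Bundles using (mk↔ₛ′)
  open import Algebra.Properties.Semiring.Sum +-*-semiring using (sum; sum-cong-≗; ∑-distrib-+; ∑-comm; *-distribˡ-sum; *-distribʳ-sum)

  -- Integer inequalities

  infixl 6 _⊕_
  infixl 7 _⊗_

  _⊕_ : ∀ {i j} → 0ℤ ≤ i → 0ℤ ≤ j → 0ℤ ≤ i + j
  _⊕_ = +-mono-≤

  _⊗_ : ∀ {i j} → 0ℤ ≤ i → 0ℤ ≤ j → 0ℤ ≤ i * j
  _⊗_ {i} {j} 0≤i 0≤j =
    subst (_≤ i * j) (*-zeroʳ i) (*-monoˡ-≤-nonNeg i {{nonNegative 0≤i}} 0≤j)

  0≤+ : ∀ m → 0ℤ ≤ + m
  0≤+ m = +≤+ ℕ.z≤n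

  0≤sq : ∀ i → 0ℤ ≤ i * i
  0≤sq i with ≤-total 0ℤ i
  ... | inj₁ 0≤i = 0≤i ⊗ 0≤i
  ... | inj₂ i≤0 = subst (0ℤ ≤_) (neg-sq i) (0≤-i ⊗ 0≤-i)
    where
    0≤-i = neg-mono-≤ i≤0
    neg-sq : ∀ i → (- i) * (- i) ≡ i * i
    neg-sq = solve-∀

  -- Polynomial inequalities are certified by an explicit difference `d` that is visibly
  -- nonnegative; the remaining equation goes to the ring solver.
  by-diff : ∀ {i j} d → 0ℤ ≤ d → j ≡ i + d → i ≤ j
  by-diff {i} d 0≤d refl = subst (_≤ i + d) (+-identityʳ i) (+-monoʳ-≤ i 0≤d)

  <1+⇒≤ : ∀ {i j} → i < 1ℤ + j → i ≤ j
  <1+⇒≤ {i} {j} i<1+j = by-diff ((1ℤ + j) - (1ℤ + i)) (0≤- (<⇒1+≤ i<1+j)) (simp i j)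
    where
    simp : ∀ i j → j ≡ i + ((1ℤ + j) - (1ℤ + i))
    simp = solve-∀

  cancel-pos : ∀ {i j} k → 0ℤ < k → k * i ≤ k * j → i ≤ j
  cancel-pos {i} {j} k 0<k = *-cancelˡ-≤-pos i j k {{positive 0<k}}

  0<* : ∀ {i j} → 0ℤ < i → 0ℤ < j → 0ℤ < i * j
  0<* {i} {j} 0<i 0<j =
    subst (_< i * j) (*-zeroʳ i) (*-monoˡ-<-pos i {{positive 0<i}} 0<j)


  pos-cancel : ∀ {k i} → 0ℤ ≤ k → 0ℤ < k * i → 0ℤ < i
  pos-cancel {k} {i} 0≤k 0<ki with i ≤? 0ℤ
  ... | no i≰0  = ≰⇒> i≰0
  ... | yes i≤0 = ⊥-elim (<⇒≱ 0<ki
          (subst (k * i ≤_) (*-zeroʳ k) (*-monoˡ-≤-nonNeg k {{nonNegative 0≤k}} i≤0)))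

  0<+ : ∀ {i j} → 0ℤ < i → 0ℤ ≤ j → 0ℤ < i + j
  0<+ = +-mono-<-≤

  i<j⇒0<j-i : ∀ {i j} → i < j → 0ℤ < j - i
  i<j⇒0<j-i {i} {j} i<j = subst (0ℤ <_) (simp i j) (0<+ (1+≤⇒< ≤-refl) (0≤- (<⇒1+≤ i<j)))
    where
    simp : ∀ i j → 1ℤ + (j - (1ℤ + i)) ≡ j - i
    simp = solve-∀

  -- Sums and bilinear forms

  sum-mono : ∀ {n} {f g : Fin n → ℤ} → (∀ i → f i ≤ g i) → sum f ≤ sum g
  sum-mono {zero}  f≤g = ≤-refl
  sum-mono {suc n} f≤g = +-mono-≤ (f≤g zero) (sum-mono (λ i → f≤g (suc i)))

  sum-0 : ∀ n → sum {n} (λ _ → 0ℤ) ≡ 0ℤ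
  sum-0 zero    = refl
  sum-0 (suc n) = trans (+-identityˡ _) (sum-0 n)

  0≤sum : ∀ {n} {f : Fin n → ℤ} → (∀ i → 0ℤ ≤ f i) → 0ℤ ≤ sum f
  0≤sum {n} {f} 0≤f = subst (_≤ sum f) (sum-0 n) (sum-mono 0≤f)

  sum-linear : ∀ {n} s t (f g : Fin n → ℤ) →
    sum (λ i → s * f i + t * g i) ≡ s * sum f + t * sum g
  sum-linear s t f g = trans (∑-distrib-+ (λ i → s * f i) (λ i → t * g i))
    (cong₂ _+_ (sym (*-distribˡ-sum s f)) (sym (*-distribˡ-sum t g)))

  ⟦_⟧ : Bool → ℤ
  ⟦ true ⟧  = 1ℤ
  ⟦ false ⟧ = 0ℤ

  0≤⟦_⟧ : ∀ b → 0ℤ ≤ ⟦ b ⟧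
  0≤⟦ true ⟧  = 0≤+ 1
  0≤⟦ false ⟧ = 0≤+ 0

  ⟦_⟧≤1 : ∀ b → ⟦ b ⟧ ≤ 1ℤ
  ⟦ true ⟧≤1  = ≤-refl
  ⟦ false ⟧≤1 = 0≤+ 1

  δ : ∀ {n} → Fin n → Fin n → ℤ
  δ u i = ⟦ does (u ≟ i) ⟧

  δ-diag : ∀ {n} (u : Fin n) → δ u u ≡ 1ℤ
  δ-diag u with u ≟ u
  ... | yes _ = refl
  ... | no ≢  = ⊥-elim (≢ refl)

  δ-off : ∀ {n} {u i : Fin n} → u ≢ i → δ u i ≡ 0ℤ
  δ-off {u = u} {i} u≢i with u ≟ i
  ... | yes ≡ = ⊥-elim (u≢i ≡)
  ... | no _  = refl

  δ-suc : ∀ {n} (u i : Fin n) → δ (suc u) (suc i) ≡ δ u i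
  δ-suc u i with u ≟ i
  ... | yes _ = refl
  ... | no _  = refl

  sum-δ : ∀ {n} (u : Fin n) (f : Fin n → ℤ) → sum (λ i → δ u i * f i) ≡ f u
  sum-δ {suc n} zero f = trans
    (cong₂ _+_ (*-identityˡ (f zero)) (trans (sum-cong-≗ {n} (λ i → *-zeroˡ (f (suc i)))) (sum-0 n)))
    (+-identityʳ (f zero))
  sum-δ {suc n} (suc u) f = trans
    (cong₂ _+_ (*-zeroˡ (f zero))
      (trans (sum-cong-≗ {n} (λ i → cong (_* f (suc i)) (δ-suc u i))) (sum-δ u (λ i → f (suc i)))))
    (+-identityˡ (f (suc u)))

  sum-split : ∀ {n} (u : Fin n) (f : Fin n → ℤ) →
    sum f ≡ f u + sum (λ i → (1ℤ - δ u i) * f i)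
  sum-split {n} u f = begin
    sum f
      ≡⟨ sum-cong-≗ {n} (λ i → split (δ u i) (f i)) ⟩
    sum (λ i → δ u i * f i + (1ℤ - δ u i) * f i)
      ≡⟨ ∑-distrib-+ (λ i → δ u i * f i) (λ i → (1ℤ - δ u i) * f i) ⟩
    sum (λ i → δ u i * f i) + sum (λ i → (1ℤ - δ u i) * f i)
      ≡⟨ cong (_+ sum (λ i → (1ℤ - δ u i) * f i)) (sum-δ u f) ⟩
    f u + sum (λ i → (1ℤ - δ u i) * f i) ∎
    where
    open ≡-Reasoning
    split : ∀ d x → x ≡ d * x + (1ℤ - d) * x
    split = solve-∀

  Matrix : ℕ → Set
  Matrix n = Fin n → Fin n → ℤ

  -- `K` is arbitrary because three forms occur: the adjacency form and the two forms used for
  -- rounding.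
  module Form {n} (K : Matrix n) where

    _∙_ : (Fin n → ℤ) → Fin n → ℤ
    (X ∙ i) = sum (λ j → K i j * X j)

    B : (Fin n → ℤ) → (Fin n → ℤ) → ℤ
    B X Y = sum (λ i → X i * (Y ∙ i))

    ∙-linear : ∀ s t X Y i → (λ j → s * X j + t * Y j) ∙ i ≡ s * (X ∙ i) + t * (Y ∙ i)
    ∙-linear s t X Y i = trans (sum-cong-≗ {n} (λ j → expand (K i j) s t (X j) (Y j)))
      (sum-linear s t (λ j → K i j * X j) (λ j → K i j * Y j))
      where
      expand : ∀ k s t x y → k * (s * x + t * y) ≡ s * (k * x) + t * (k * y)
      expand = solve-∀

    ∙-δ : ∀ v i → δ v ∙ i ≡ K i v
    ∙-δ v i = trans (sum-cong-≗ {n} (λ j → *-comm (K i j) (δ v j))) (sum-δ v (K i))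

    B-linearˡ : ∀ s t X Y Z → B (λ i → s * X i + t * Y i) Z ≡ s * B X Z + t * B Y Z
    B-linearˡ s t X Y Z = trans (sum-cong-≗ {n} (λ i → expand s t (X i) (Y i) (Z ∙ i)))
      (sum-linear s t (λ i → X i * (Z ∙ i)) (λ i → Y i * (Z ∙ i)))
      where
      expand : ∀ s t x y z → (s * x + t * y) * z ≡ s * (x * z) + t * (y * z)
      expand = solve-∀

    B-linearʳ : ∀ s t X Y Z → B Z (λ i → s * X i + t * Y i) ≡ s * B Z X + t * B Z Y
    B-linearʳ s t X Y Z = trans
      (sum-cong-≗ {n} (λ i → trans (cong (Z i *_) (∙-linear s t X Y i)) (expand s t (X ∙ i) (Y ∙ i) (Z i))))
      (sum-linear s t (λ i → Z i * (X ∙ i)) (λ i → Z i * (Y ∙ i)))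
      where
      expand : ∀ s t x y z → z * (s * x + t * y) ≡ s * (z * x) + t * (z * y)
      expand = solve-∀

    B-cong : ∀ {X X′ Y Y′} → (∀ i → X i ≡ X′ i) → (∀ i → Y i ≡ Y′ i) → B X Y ≡ B X′ Y′
    B-cong X≡ Y≡ = sum-cong-≗ {n} (λ i → cong₂ _*_ (X≡ i) (sum-cong-≗ {n} (λ j → cong (K i j *_) (Y≡ j))))

    B-δˡ : ∀ u Y → B (δ u) Y ≡ Y ∙ u
    B-δˡ u Y = sum-δ u (λ i → Y ∙ i)

    module _ (K-sym : ∀ i j → K i j ≡ K j i) where

      B-sym : ∀ X Y → B X Y ≡ B Y X
      B-sym X Y = begin
        sum (λ i → X i * sum (λ j → K i j * Y j))
          ≡⟨ sum-cong-≗ {n} (λ i → *-distribˡ-sum (X i) (λ j → K i j * Y j)) ⟩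
        sum (λ i → sum (λ j → X i * (K i j * Y j)))
          ≡⟨ ∑-comm (λ i j → X i * (K i j * Y j)) ⟩
        sum (λ j → sum (λ i → X i * (K i j * Y j)))
          ≡⟨ sum-cong-≗ {n} (λ j → sum-cong-≗ {n} (λ i →
               trans (cong (λ k → X i * (k * Y j)) (K-sym i j)) (swap (X i) (K j i) (Y j)))) ⟩
        sum (λ j → sum (λ i → Y j * (K j i * X i)))
          ≡⟨ sum-cong-≗ {n} (λ j → *-distribˡ-sum (Y j) (λ i → K j i * X i)) ⟨
        sum (λ j → Y j * sum (λ i → K j i * X i)) ∎
        where
        open ≡-Reasoning
        swap : ∀ x k y → x * (k * y) ≡ y * (k * x)
        swap = solve-∀

      B-quadratic : ∀ s t X Y → let Z = λ i → s * X i + t * Y i in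
        B Z Z ≡ s * s * B X X + + 2 * (s * t) * B X Y + t * t * B Y Y
      B-quadratic s t X Y = begin
        B Z Z
          ≡⟨ B-linearˡ s t X Y Z ⟩
        s * B X Z + t * B Y Z
          ≡⟨ cong₂ (λ a b → s * a + t * b) (B-linearʳ s t X Y X) (B-linearʳ s t X Y Y) ⟩
        s * (s * B X X + t * B X Y) + t * (s * B Y X + t * B Y Y)
          ≡⟨ cong (λ b → s * (s * B X X + t * B X Y) + t * (s * b + t * B Y Y)) (B-sym Y X) ⟩
        s * (s * B X X + t * B X Y) + t * (s * B X Y + t * B Y Y)
          ≡⟨ expand s t (B X X) (B X Y) (B Y Y) ⟩
        s * s * B X X + + 2 * (s * t) * B X Y + t * t * B Y Y ∎
        where
        open ≡-Reasoning
        Z = λ i → s * X i + t * Y i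
        expand : ∀ s t a b c → s * (s * a + t * b) + t * (s * b + t * c) ≡ s * s * a + + 2 * (s * t) * b + t * t * c
        expand = solve-∀

  pair? : ∀ {A : Set} {R : A → A → Set} → (∀ x y → Dec (R x y)) → ∀ xs →
    AllPairs (λ x y → ¬ R x y) xs ⊎ ∃ λ x → ∃ λ y → x ∈ xs × y ∈ xs × R x y
  pair? R? [] = inj₁ []
  pair? {R = R} R? (x ∷ xs) with any? (R? x) xs
  ... | yes p = let y , y∈ , r = find p in inj₂ (x , y , here refl , there y∈ , r)
  ... | no ¬p with pair? R? xs
  ...   | inj₁ none = inj₁ (¬Any⇒All¬ xs ¬p ∷ none)
  ...   | inj₂ (y , z , y∈ , z∈ , r) = inj₂ (y , z , there y∈ , there z∈ , r)

  by-cases : ∀ {n} (u v : Fin n) (P : Fin n → Set) →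
    P u → P v → (∀ i → u ≢ i → v ≢ i → P i) → ∀ i → P i
  by-cases u v P Pu Pv P-off i with u ≟ i | v ≟ i
  ... | yes refl | _        = Pu
  ... | no _     | yes refl = Pv
  ... | no u≢i   | no v≢i   = P-off i u≢i v≢i

  -- Pipage rounding

  -- A fractional vertex set is an integer vector X with a common denominator M.
  module _ {n : ℕ} where

    Whole : (Fin n → ℤ) → ℤ → Fin n → Set
    Whole X M i = X i ≡ 0ℤ ⊎ X i ≡ M

    whole? : ∀ X M i → Dec (Whole X M i)
    whole? X M i = (X i ℤ.≟ 0ℤ) ⊎-dec (X i ℤ.≟ M)

    -- `L` contains all fractional vertices but may contain whole ones too, so whole vertices need
    -- not be removed at the start. Its length measures the progress of the rounding.
    record State (P : Fin n → Set) (X : Fin n → ℤ) (M : ℤ) (L : List (Fin n)) : Set where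
      field
        0<M      : 0ℤ < M
        0≤X      : ∀ i → 0ℤ ≤ X i
        X≤M      : ∀ i → X i ≤ M
        support  : ∀ i → ¬ P i → X i ≡ 0ℤ
        L⊆P      : All P L
        unique   : Unique L
        complete : ∀ i → ¬ Whole X M i → i ∈ L

  module Pipage {n} (K : Matrix n) (K-sym : ∀ i j → K i j ≡ K j i) (w : Fin n → ℤ) (α : ℤ) where
    open Form K

    -- Homogenised: this is M² times the value of the quadratic function at the fractional point X /
    -- M.
    Φ : (Fin n → ℤ) → ℤ → ℤ
    Φ X M = B X X - α * M * sum X

    weight : (Fin n → ℤ) → ℤ
    weight X = sum (λ i → w i * X i)

    -- Instead of dividing, a move multiplies the common denominator by `s`; unmoved coordinates and
    -- the weight therefore scale by `s`, and Φ by its square.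
    record Move (X : Fin n → ℤ) (M : ℤ) (u v : Fin n) : Set where
      field
        X′      : Fin n → ℤ
        s       : ℤ
        0<s     : 0ℤ < s
        0≤X′    : ∀ i → 0ℤ ≤ X′ i
        X′≤     : ∀ i → X′ i ≤ s * M
        fixed   : ∀ i → u ≢ i → v ≢ i → X′ i ≡ s * X i
        settled : Whole X′ (s * M) u ⊎ Whole X′ (s * M) v
        weight≡ : weight X′ ≡ s * weight X
        Φ≤      : s * s * Φ X M ≤ Φ X′ (s * M)

    curvature : Fin n → Fin n → ℤ
    curvature u v = w v * w v * K u u - + 2 * (w u * w v) * K u v + w u * w u * K v v

    -- The exchange between `u` and `v` that leaves the weight unchanged.
    direction : Fin n → Fin n → Fin n → ℤ
    direction u v i = w v * δ u i + (- w u) * δ v i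

    slope : (Fin n → ℤ) → ℤ → Fin n → Fin n → ℤ
    slope X M u v = + 2 * B X (direction u v) - α * M * sum (direction u v)

    module _ {u v : Fin n} (u≢v : u ≢ v) where

      direction-u : direction u v u ≡ w v
      direction-u = trans
        (cong₂ (λ a b → w v * a + (- w u) * b) (δ-diag u) (δ-off (λ e → u≢v (sym e)))) (simp (w u) (w v))
        where
        simp : ∀ a b → b * 1ℤ + (- a) * 0ℤ ≡ b
        simp = solve-∀

      direction-v : direction u v v ≡ - w u
      direction-v = trans
        (cong₂ (λ a b → w v * a + (- w u) * b) (δ-off u≢v) (δ-diag v)) (simp (w u) (w v))
        where
        simp : ∀ a b → b * 0ℤ + (- a) * 1ℤ ≡ - a
        simp = solve-∀

    direction-off : ∀ {u v i} → u ≢ i → v ≢ i → direction u v i ≡ 0ℤ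
    direction-off {u} {v} u≢i v≢i = trans
      (cong₂ (λ a b → w v * a + (- w u) * b) (δ-off u≢i) (δ-off v≢i)) (simp (w u) (w v))
      where
      simp : ∀ a b → b * 0ℤ + (- a) * 0ℤ ≡ 0ℤ
      simp = solve-∀

    B-direction : ∀ u v → B (direction u v) (direction u v) ≡ curvature u v
    B-direction u v = trans (B-quadratic K-sym (w v) (- w u) (δ u) (δ v))
      (trans (cong₂ (λ a b → w v * w v * a + + 2 * (w v * - w u) * b + - w u * - w u * B (δ v) (δ v))
                    (trans (B-δˡ u (δ u)) (∙-δ u u)) (trans (B-δˡ u (δ v)) (∙-δ v u)))
      (trans (cong (λ c → w v * w v * K u u + + 2 * (w v * - w u) * K u v + - w u * - w u * c)
                   (trans (B-δˡ v (δ v)) (∙-δ v v)))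
        (simp (w u) (w v) (K u u) (K u v) (K v v))))
      where
      simp : ∀ a b x y z → b * b * x + + 2 * (b * - a) * y + - a * - a * z
                         ≡ b * b * x - + 2 * (a * b) * y + a * a * z
      simp = solve-∀

    weight-direction : ∀ u v → weight (direction u v) ≡ 0ℤ
    weight-direction u v = begin
      sum (λ i → w i * (w v * δ u i + (- w u) * δ v i))
        ≡⟨ sum-cong-≗ {n} (λ i → expand (w i) (w u) (w v) (δ u i) (δ v i)) ⟩
      sum (λ i → w v * (δ u i * w i) + (- w u) * (δ v i * w i))
        ≡⟨ sum-linear (w v) (- w u) (λ i → δ u i * w i) (λ i → δ v i * w i) ⟩
      w v * sum (λ i → δ u i * w i) + (- w u) * sum (λ i → δ v i * w i)
        ≡⟨ cong₂ (λ a b → w v * a + (- w u) * b) (sum-δ u w) (sum-δ v w) ⟩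
      w v * w u + (- w u) * w v
        ≡⟨ cancel (w u) (w v) ⟩
      0ℤ ∎
      where
      open ≡-Reasoning
      expand : ∀ x a b d e → x * (b * d + (- a) * e) ≡ b * (d * x) + (- a) * (e * x)
      expand = solve-∀
      cancel : ∀ a b → b * a + (- a) * b ≡ 0ℤ
      cancel = solve-∀

    -- Along the direction the weight is constant and Φ is convex, so in the
    -- direction of nonnegative slope Φ does not decrease; go until u or v is whole.
    move⁺ : ∀ X M u v → u ≢ v → 0ℤ < w u → 0ℤ < w v → 0ℤ ≤ curvature u v → 0ℤ ≤ slope X M u v →
      (∀ i → 0ℤ ≤ X i) → (∀ i → X i ≤ M) → Move X M u v
    move⁺ X M u v u≢v 0<wu 0<wv 0≤curv 0≤slope 0≤X X≤M = record
      { X′      = X′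
      ; s       = s
      ; 0<s     = 0<* 0<wu 0<wv
      ; 0≤X′    = 0≤X′
      ; X′≤     = X′≤
      ; fixed   = fixed
      ; settled = settled
      ; weight≡ = weight≡
      ; Φ≤      = by-diff (s * t * slope X M u v + t * t * curvature u v)
                    (0≤s ⊗ 0≤t ⊗ 0≤slope ⊕ 0≤t ⊗ 0≤t ⊗ 0≤curv) Φ≡
      }
      where
      Y = direction u v
      s = w u * w v
      -- At `t₁` the coordinate of `u` becomes full, at `t₂` that of `v` becomes empty; the smaller
      -- of the two keeps both in range.
      t₁ = w u * (M - X u)
      t₂ = w v * X v
      t = t₁ ⊓ t₂
      X′ : Fin n → ℤ
      X′ i = s * X i + t * Y i
      0≤wu = <⇒≤ 0<wu
      0≤wv = <⇒≤ 0<wv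
      0≤s = 0≤wu ⊗ 0≤wv
      0≤t : 0ℤ ≤ t
      0≤t = ⊓-glb (0≤wu ⊗ 0≤- (X≤M u)) (0≤wv ⊗ 0≤X v)
      X′u : X′ u ≡ s * X u + t * w v
      X′u = cong (λ y → s * X u + t * y) (direction-u u≢v)
      X′v : X′ v ≡ s * X v + t * - w u
      X′v = cong (λ y → s * X v + t * y) (direction-v u≢v)
      simp : ∀ a b → a + b * 0ℤ ≡ a
      simp = solve-∀
      fixed : ∀ i → u ≢ i → v ≢ i → X′ i ≡ s * X i
      fixed i u≢i v≢i = trans (cong (λ y → s * X i + t * y) (direction-off u≢i v≢i)) (simp (s * X i) t)
      up : ∀ a b m x t → a * b * m ≡ (a * b * x + t * b) + b * (a * (m - x) - t)
      up = solve-∀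
      down : ∀ a b y t → a * b * y + t * - a ≡ a * (b * y - t)
      down = solve-∀
      below : ∀ a b m y t → a * b * m ≡ (a * b * y + t * - a) + (a * b * (m - y) + t * a)
      below = solve-∀
      0≤X′ : ∀ i → 0ℤ ≤ X′ i
      0≤X′ = by-cases u v (λ i → 0ℤ ≤ X′ i)
        (subst (0ℤ ≤_) (sym X′u) (0≤s ⊗ 0≤X u ⊕ 0≤t ⊗ 0≤wv))
        (subst (0ℤ ≤_) (sym (trans X′v (down (w u) (w v) (X v) t))) (0≤wu ⊗ 0≤- (i⊓j≤j t₁ t₂)))
        (λ i u≢i v≢i → subst (0ℤ ≤_) (sym (fixed i u≢i v≢i)) (0≤s ⊗ 0≤X i))
      X′≤ : ∀ i → X′ i ≤ s * M
      X′≤ = by-cases u v (λ i → X′ i ≤ s * M)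
        (subst (_≤ s * M) (sym X′u)
          (by-diff (w v * (t₁ - t)) (0≤wv ⊗ 0≤- (i⊓j≤i t₁ t₂)) (up (w u) (w v) M (X u) t)))
        (subst (_≤ s * M) (sym X′v)
          (by-diff (s * (M - X v) + t * w u) (0≤s ⊗ 0≤- (X≤M v) ⊕ 0≤t ⊗ 0≤wu) (below (w u) (w v) M (X v) t)))
        (λ i u≢i v≢i → subst (_≤ s * M) (sym (fixed i u≢i v≢i))
          (*-monoˡ-≤-nonNeg s {{nonNegative 0≤s}} (X≤M i)))
      settled : Whole X′ (s * M) u ⊎ Whole X′ (s * M) v
      settled with ⊓-sel t₁ t₂
      ... | inj₁ t≡t₁ = inj₁ (inj₂ (trans X′u (trans (cong (λ t → s * X u + t * w v) t≡t₁) (full (w u) (w v) M (X u)))))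
        where
        full : ∀ a b m x → a * b * x + a * (m - x) * b ≡ a * b * m
        full = solve-∀
      ... | inj₂ t≡t₂ = inj₂ (inj₁ (trans X′v (trans (cong (λ t → s * X v + t * - w u) t≡t₂) (empty (w u) (w v) (X v)))))
        where
        empty : ∀ a b y → a * b * y + b * y * - a ≡ 0ℤ
        empty = solve-∀
      weight≡ : weight X′ ≡ s * weight X
      weight≡ = begin
        sum (λ i → w i * (s * X i + t * Y i))
          ≡⟨ sum-cong-≗ {n} (λ i → expand (w i) s t (X i) (Y i)) ⟩
        sum (λ i → s * (w i * X i) + t * (w i * Y i))
          ≡⟨ sum-linear s t (λ i → w i * X i) (λ i → w i * Y i) ⟩
        s * weight X + t * weight Y
          ≡⟨ cong (λ y → s * weight X + t * y) (weight-direction u v) ⟩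
        s * weight X + t * 0ℤ
          ≡⟨ simp (s * weight X) t ⟩
        s * weight X ∎
        where
        open ≡-Reasoning
        expand : ∀ x s t a b → x * (s * a + t * b) ≡ s * (x * a) + t * (x * b)
        expand = solve-∀
      Φ≡ : Φ X′ (s * M) ≡ s * s * Φ X M + (s * t * slope X M u v + t * t * curvature u v)
      Φ≡ = begin
        B X′ X′ - α * (s * M) * sum X′
          ≡⟨ cong₂ (λ a b → a - α * (s * M) * b) (B-quadratic K-sym s t X Y) (sum-linear s t X Y) ⟩
        s * s * B X X + + 2 * (s * t) * B X Y + t * t * B Y Y - α * (s * M) * (s * sum X + t * sum Y)
          ≡⟨ collect s t α M (B X X) (B X Y) (B Y Y) (sum X) (sum Y) ⟩
        s * s * Φ X M + (s * t * slope X M u v + t * t * B Y Y)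
          ≡⟨ cong (λ c → s * s * Φ X M + (s * t * slope X M u v + t * t * c)) (B-direction u v) ⟩
        s * s * Φ X M + (s * t * slope X M u v + t * t * curvature u v) ∎
        where
        open ≡-Reasoning
        collect : ∀ s t α M a b c x y →
          s * s * a + + 2 * (s * t) * b + t * t * c - α * (s * M) * (s * x + t * y)
          ≡ s * s * (a - α * M * x) + (s * t * (+ 2 * b - α * M * y) + t * t * c)
        collect = solve-∀

    slope-swap : ∀ X M u v → slope X M v u ≡ - slope X M u v
    slope-swap X M u v = begin
      + 2 * B X (direction v u) - α * M * sum (direction v u)
        ≡⟨ cong₂ (λ a b → + 2 * a - α * M * b) (B-linearʳ (w u) (- w v) (δ v) (δ u) X) (sum-linear (w u) (- w v) (δ v) (δ u)) ⟩
      + 2 * (w u * B X (δ v) + - w v * B X (δ u)) - α * M * (w u * sum (δ v) + - w v * sum (δ u))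
        ≡⟨ negate (w u) (w v) (α * M) (B X (δ u)) (B X (δ v)) (sum (δ u)) (sum (δ v)) ⟩
      - (+ 2 * (w v * B X (δ u) + - w u * B X (δ v)) - α * M * (w v * sum (δ u) + - w u * sum (δ v)))
        ≡⟨ cong₂ (λ a b → - (+ 2 * a - α * M * b)) (B-linearʳ (w v) (- w u) (δ u) (δ v) X) (sum-linear (w v) (- w u) (δ u) (δ v)) ⟨
      - slope X M u v ∎
      where
      open ≡-Reasoning
      negate : ∀ a b m x y p q → + 2 * (a * y + - b * x) - m * (a * q + - b * p)
                               ≡ - (+ 2 * (b * x + - a * y) - m * (b * p + - a * q))
      negate = solve-∀

    curvature-swap : ∀ u v → curvature v u ≡ curvature u v
    curvature-swap u v = trans (cong (λ k → w u * w u * K v v - + 2 * (w v * w u) * k + w v * w v * K u u) (K-sym v u))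
      (swap (w u) (w v) (K u u) (K u v) (K v v))
      where
      swap : ∀ a b x y z → a * a * z - + 2 * (b * a) * y + b * b * x ≡ b * b * x - + 2 * (a * b) * y + a * a * z
      swap = solve-∀

    -- Exchanging `u` and `v` reverses the direction and negates the slope, so `move⁺` applies in
    -- one of the two orders.
    move : ∀ X M u v → u ≢ v → 0ℤ < w u → 0ℤ < w v → 0ℤ ≤ curvature u v →
      (∀ i → 0ℤ ≤ X i) → (∀ i → X i ≤ M) → Move X M u v
    move X M u v u≢v 0<wu 0<wv 0≤curv 0≤X X≤M with ≤-total 0ℤ (slope X M u v)
    ... | inj₁ 0≤slope = move⁺ X M u v u≢v 0<wu 0<wv 0≤curv 0≤slope 0≤X X≤M
    ... | inj₂ slope≤0 = record
      { X′ = Move.X′ m ; s = Move.s m ; 0<s = Move.0<s m ; 0≤X′ = Move.0≤X′ m ; X′≤ = Move.X′≤ m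
      ; weight≡ = Move.weight≡ m ; Φ≤ = Move.Φ≤ m
      ; fixed   = λ i u≢i v≢i → Move.fixed m i v≢i u≢i
      ; settled = Sum.swap (Move.settled m)
      }
      where
      m = move⁺ X M v u (λ e → u≢v (sym e)) 0<wv 0<wu (subst (0ℤ ≤_) (sym (curvature-swap u v)) 0≤curv)
            (subst (0ℤ ≤_) (sym (slope-swap X M u v)) (neg-mono-≤ slope≤0)) 0≤X X≤M

    -- The last two fields compare the points X / M and X′ / M′ with denominators cleared: equal
    -- weight, and no loss in Φ.
    record Rounding (P : Fin n → Set) (R : Fin n → Fin n → Set) (X : Fin n → ℤ) (M : ℤ) : Set where
      field
        X′      : Fin n → ℤ
        M′      : ℤ
        L′      : List (Fin n)
        state   : State P X′ M′ L′
        stuck   : AllPairs (λ u v → ¬ R u v) L′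
        weight≡ : weight X′ * M ≡ weight X * M′
        Φ≤      : Φ X M * (M′ * M′) ≤ Φ X′ M′ * (M * M)

    module _ (P : Fin n → Set) (0<w : ∀ i → P i → 0ℤ < w i)
             (R : Fin n → Fin n → Set) (R? : ∀ u v → Dec (R u v)) (R⇒≢ : ∀ {u v} → R u v → u ≢ v)
             (R⇒convex : ∀ {u v} → P u → P v → R u v → 0ℤ ≤ curvature u v) where

      advance : ∀ {X M L u v} → State P X M L → u ∈ L → v ∈ L → (m : Move X M u v) →
        let L′ = filter (λ i → ¬? (whole? (Move.X′ m) (Move.s m * M) i)) L in
        State P (Move.X′ m) (Move.s m * M) L′ × length L′ ℕ.< length L
      advance {X} {M} {L} {u} {v} st u∈ v∈ m = record
        { 0<M      = 0<* 0<s 0<M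
        ; 0≤X      = 0≤X′
        ; X≤M      = X′≤
        ; support  = support′
        ; L⊆P      = filter⁺ f? L⊆P
        ; unique   = Unique.filter⁺ f? unique
        ; complete = complete′
        } , filter-notAll f? L (shrink settled)
        where
        open State st
        open Move m
        f? = λ i → ¬? (whole? X′ (s * M) i)
        shrink : Whole X′ (s * M) u ⊎ Whole X′ (s * M) v → Any (λ i → ¬ ¬ Whole X′ (s * M) i) L
        shrink (inj₁ wu) = lose u∈ (λ ¬wu → ¬wu wu)
        shrink (inj₂ wv) = lose v∈ (λ ¬wv → ¬wv wv)
        support′ : ∀ i → ¬ P i → X′ i ≡ 0ℤ
        support′ i ¬Pi = trans
          (fixed i (λ { refl → ¬Pi (All.lookup L⊆P u∈) }) (λ { refl → ¬Pi (All.lookup L⊆P v∈) }))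
          (trans (cong (s *_) (support i ¬Pi)) (*-zeroʳ s))
        whole′ : ∀ i → u ≢ i → v ≢ i → Whole X M i → Whole X′ (s * M) i
        whole′ i u≢i v≢i (inj₁ X≡0) = inj₁ (trans (fixed i u≢i v≢i) (trans (cong (s *_) X≡0) (*-zeroʳ s)))
        whole′ i u≢i v≢i (inj₂ X≡M) = inj₂ (trans (fixed i u≢i v≢i) (cong (s *_) X≡M))
        inL : ∀ i → ¬ Whole X′ (s * M) i → i ∈ L
        inL = by-cases u v (λ i → ¬ Whole X′ (s * M) i → i ∈ L) (λ _ → u∈) (λ _ → v∈)
          (λ i u≢i v≢i ¬w → complete i (λ w → ¬w (whole′ i u≢i v≢i w)))
        complete′ : ∀ i → ¬ Whole X′ (s * M) i → i ∈ filter f? L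
        complete′ i ¬w = ∈-filter⁺ f? (inL i ¬w) ¬w

      -- Every move settles one of its two vertices and so shortens the list. `R` selects pairs with
      -- nonnegative curvature, and the process stops when no such pair is left.
      round : ∀ fuel X M L → length L ℕ.≤ fuel → State P X M L → Rounding P R X M
      round fuel X M L L≤fuel st with pair? R? L
      ... | inj₁ none = record
        { X′ = X ; M′ = M ; L′ = L ; state = st ; stuck = none ; weight≡ = refl ; Φ≤ = ≤-refl }
      round zero X M [] L≤fuel st | inj₂ (_ , _ , () , _)
      round (suc fuel) X M L L≤fuel st | inj₂ (u , v , u∈ , v∈ , Ruv) = record
        { X′ = X′ ; M′ = M′ ; L′ = L′ ; state = state ; stuck = stuck
        ; weight≡ = weight-chain
        ; Φ≤ = cancel-pos (s * s) (0<* m.0<s m.0<s) Φ-chain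
        }
        where
        Pu = All.lookup (State.L⊆P st) u∈
        Pv = All.lookup (State.L⊆P st) v∈
        m = move X M u v (R⇒≢ Ruv) (0<w u Pu) (0<w v Pv) (R⇒convex Pu Pv Ruv) (State.0≤X st) (State.X≤M st)
        module m = Move m
        s = m.s
        next = advance st u∈ v∈ m
        open Rounding (round fuel m.X′ (s * M) _ (ℕ.≤-pred (ℕ.≤-trans (proj₂ next) L≤fuel)) (proj₁ next))
        weight-chain : weight X′ * M ≡ weight X * M′
        weight-chain = *-cancelˡ-≡ s _ _ {{≢-nonZero (λ s≡0 → <-irrefl (sym s≡0) m.0<s)}} (begin
          s * (weight X′ * M)  ≡⟨ shuffle s (weight X′) M ⟩
          weight X′ * (s * M)  ≡⟨ weight≡ ⟩
          weight m.X′ * M′     ≡⟨ cong (_* M′) m.weight≡ ⟩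
          s * weight X * M′    ≡⟨ *-assoc s (weight X) M′ ⟩
          s * (weight X * M′) ∎)
          where
          open ≡-Reasoning
          shuffle : ∀ s a m → s * (a * m) ≡ a * (s * m)
          shuffle = solve-∀
        Φ-chain : s * s * (Φ X M * (M′ * M′)) ≤ s * s * (Φ X′ M′ * (M * M))
        Φ-chain = begin
          s * s * (Φ X M * (M′ * M′))
            ≡⟨ *-assoc (s * s) (Φ X M) (M′ * M′) ⟨
          s * s * Φ X M * (M′ * M′)
            ≤⟨ *-monoʳ-≤-nonNeg (M′ * M′) {{nonNegative (0≤sq M′)}} m.Φ≤ ⟩
          Φ m.X′ (s * M) * (M′ * M′)
            ≤⟨ Φ≤ ⟩
          Φ X′ M′ * (s * M * (s * M))
            ≡⟨ shuffle s (Φ X′ M′) M ⟩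
          s * s * (Φ X′ M′ * (M * M)) ∎
          where
          open ≤-Reasoning
          shuffle : ∀ s a m → a * (s * m * (s * m)) ≡ s * s * (a * (m * m))
          shuffle = solve-∀

  -- Sums over lists and over all vertices

  sumOn : ∀ {n} → (Fin n → ℤ) → List (Fin n) → ℤ
  sumOn f []      = 0ℤ
  sumOn f (x ∷ l) = f x + sumOn f l

  sumOn-mono : ∀ {n} {f g : Fin n → ℤ} l → (∀ {i} → i ∈ l → f i ≤ g i) → sumOn f l ≤ sumOn g l
  sumOn-mono []      f≤g = ≤-refl
  sumOn-mono (x ∷ l) f≤g = +-mono-≤ (f≤g (here refl)) (sumOn-mono l (λ i∈ → f≤g (there i∈)))

  sumOn-const : ∀ {n} c (l : List (Fin n)) → sumOn (λ _ → c) l ≡ + length l * c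
  sumOn-const c []      = refl
  sumOn-const c (x ∷ l) = trans (cong (λ s → c + s) (sumOn-const c l)) (sym (suc-* (+ length l) c))

  mask : ∀ {n} → Fin n → (Fin n → ℤ) → Fin n → ℤ
  mask x f i = (1ℤ - δ x i) * f i

  mask-off : ∀ {n} {x i : Fin n} (f : Fin n → ℤ) → x ≢ i → mask x f i ≡ f i
  mask-off {i = i} f x≢i = trans (cong (λ d → (1ℤ - d) * f i) (δ-off x≢i)) (*-identityˡ (f i))

  module _ {n} (f : Fin n → ℤ) (0≤f : ∀ i → 0ℤ ≤ f i) where

    0≤mask : ∀ x i → 0ℤ ≤ mask x f i
    0≤mask x i with x ≟ i
    ... | yes _ = 0≤+ 0 ⊗ 0≤f i
    ... | no _  = 0≤+ 1 ⊗ 0≤f i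

    mask≤ : ∀ x i → mask x f i ≤ f i
    mask≤ x i with x ≟ i
    ... | yes _ = subst (_≤ f i) (sym (*-zeroˡ (f i))) (0≤f i)
    ... | no _  = ≤-reflexive (*-identityˡ (f i))

  -- Once the head is split off and masked, the function is supported on the tail. Repetitions in
  -- `l` only increase the right side.
  sum≤sumOn : ∀ {n} (f : Fin n → ℤ) → (∀ i → 0ℤ ≤ f i) → ∀ l →
    (∀ i → i ∉ l → f i ≡ 0ℤ) → sum f ≤ sumOn f l
  sum≤sumOn {n} f 0≤f [] supp = ≤-reflexive (trans (sum-cong-≗ {n} (λ i → supp i λ ())) (sum-0 n))
  sum≤sumOn f 0≤f (x ∷ l) supp = begin
    sum f                        ≡⟨ sum-split x f ⟩
    f x + sum (mask x f)         ≤⟨ +-monoʳ-≤ (f x) (sum≤sumOn (mask x f) (0≤mask f 0≤f x) l supp′) ⟩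
    f x + sumOn (mask x f) l     ≤⟨ +-monoʳ-≤ (f x) (sumOn-mono l (λ {i} _ → mask≤ f 0≤f x i)) ⟩
    f x + sumOn f l              ∎
    where
    open ≤-Reasoning
    supp′ : ∀ i → i ∉ l → mask x f i ≡ 0ℤ
    supp′ i i∉l with x ≟ i
    ... | yes refl = *-zeroˡ (f i)
    ... | no x≢i   = trans (*-identityˡ (f i)) (supp i (λ { (here e) → x≢i (sym e) ; (there i∈) → i∉l i∈ }))

  sumOn≤sum : ∀ {n} (f : Fin n → ℤ) → (∀ i → 0ℤ ≤ f i) → ∀ {l} → Unique l → sumOn f l ≤ sum f
  sumOn≤sum f 0≤f []  = 0≤sum 0≤f
  sumOn≤sum f 0≤f {x ∷ l} (x∉ ∷ ul) = begin
    f x + sumOn f l          ≤⟨ +-monoʳ-≤ (f x) (sumOn-mono l (λ i∈ → ≤-reflexive (sym (mask-off f (All.lookup x∉ i∈))))) ⟩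
    f x + sumOn (mask x f) l ≤⟨ +-monoʳ-≤ (f x) (sumOn≤sum (mask x f) (0≤mask f 0≤f x) ul) ⟩
    f x + sum (mask x f)     ≡⟨ sum-split x f ⟨
    sum f                    ∎
    where open ≤-Reasoning

  -- Vertex sets, degrees and dense cores

  module OnGraph {n} (adj : Fin n → Fin n → Bool)
    (adj-sym : ∀ x y → adj x y ≡ adj y x) (adj-irref : ∀ x → adj x x ≡ false) where

    A : Matrix n
    A i j = ⟦ adj i j ⟧

    A-sym : ∀ i j → A i j ≡ A j i
    A-sym i j = cong ⟦_⟧ (adj-sym i j)

    open Form A public

    VSet : Set
    VSet = Fin n → Bool

    χ : VSet → Fin n → ℤ
    χ W i = ⟦ W i ⟧

    size : VSet → ℤ
    size W = sum (χ W)

    deg : VSet → Fin n → ℤ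
    deg W i = χ W ∙ i

    -- Q W is twice the number of edges inside W.
    Q : VSet → ℤ
    Q W = B (χ W) (χ W)

    _⊆_ : VSet → VSet → Set
    S ⊆ W = ∀ i → S i ≡ true → W i ≡ true

    _∖_ : VSet → VSet → VSet
    (W ∖ S) i = W i ∧ not (S i)

    ∖⊆ : ∀ W S → (W ∖ S) ⊆ W
    ∖⊆ W S i e with W i
    ... | true = refl

    ∖-disjoint : ∀ W S i → S i ≡ true → (W ∖ S) i ≡ true → ⊥
    ∖-disjoint W S i s e with W i | S i
    ∖-disjoint W S i s () | true | true
    ∖-disjoint W S i s () | false | _

    single : Fin n → VSet
    single u i = does (u ≟ i)

    0≤χ : ∀ W i → 0ℤ ≤ χ W i
    0≤χ W i = 0≤⟦ W i ⟧

    0≤size : ∀ W → 0ℤ ≤ size W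
    0≤size W = 0≤sum (0≤χ W)

    0≤A : ∀ i j → 0ℤ ≤ A i j
    0≤A i j = 0≤⟦ adj i j ⟧

    0≤deg : ∀ W i → 0ℤ ≤ deg W i
    0≤deg W i = 0≤sum (λ j → 0≤A i j ⊗ 0≤χ W j)

    A-diag : ∀ i → A i i ≡ 0ℤ
    A-diag i = cong ⟦_⟧ (adj-irref i)

    χ-∖ : ∀ W S → S ⊆ W → ∀ i → χ (W ∖ S) i ≡ 1ℤ * χ W i + (- 1ℤ) * χ S i
    χ-∖ W S S⊆W i with W i in Wi | S i in Si
    ... | true  | true  = refl
    ... | true  | false = refl
    ... | false | false = refl
    ... | false | true with () ← trans (sym Wi) (S⊆W i Si)

    size-∖ : ∀ W S → S ⊆ W → size (W ∖ S) ≡ size W - size S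
    size-∖ W S S⊆W = trans (sum-cong-≗ {n} (χ-∖ W S S⊆W))
      (trans (sum-linear 1ℤ (- 1ℤ) (χ W) (χ S)) (simp (size W) (size S)))
      where
      simp : ∀ a b → 1ℤ * a + (- 1ℤ) * b ≡ a - b
      simp = solve-∀

    deg-∖ : ∀ W S → S ⊆ W → ∀ i → deg (W ∖ S) i ≡ deg W i - deg S i
    deg-∖ W S S⊆W i = trans (sum-cong-≗ {n} (λ j → cong (A i j *_) (χ-∖ W S S⊆W j)))
      (trans (∙-linear 1ℤ (- 1ℤ) (χ W) (χ S) i) (simp (deg W i) (deg S i)))
      where
      simp : ∀ a b → 1ℤ * a + (- 1ℤ) * b ≡ a - b
      simp = solve-∀

    Q-∖ : ∀ W S → S ⊆ W → Q (W ∖ S) ≡ Q W - + 2 * B (χ S) (χ W) + Q S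
    Q-∖ W S S⊆W = begin
      B (χ (W ∖ S)) (χ (W ∖ S))
        ≡⟨ B-cong (χ-∖ W S S⊆W) (χ-∖ W S S⊆W) ⟩
      _ ≡⟨ B-quadratic A-sym 1ℤ (- 1ℤ) (χ W) (χ S) ⟩
      1ℤ * 1ℤ * Q W + + 2 * (1ℤ * - 1ℤ) * B (χ W) (χ S) + - 1ℤ * - 1ℤ * Q S
        ≡⟨ cong (λ b → 1ℤ * 1ℤ * Q W + + 2 * (1ℤ * - 1ℤ) * b + - 1ℤ * - 1ℤ * Q S) (B-sym A-sym (χ W) (χ S)) ⟩
      1ℤ * 1ℤ * Q W + + 2 * (1ℤ * - 1ℤ) * B (χ S) (χ W) + - 1ℤ * - 1ℤ * Q S
        ≡⟨ simp (Q W) (B (χ S) (χ W)) (Q S) ⟩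
      Q W - + 2 * B (χ S) (χ W) + Q S ∎
      where
      open ≡-Reasoning
      simp : ∀ a b c → 1ℤ * 1ℤ * a + + 2 * (1ℤ * - 1ℤ) * b + - 1ℤ * - 1ℤ * c ≡ a - + 2 * b + c
      simp = solve-∀

    single⊆ : ∀ {W u} → W u ≡ true → single u ⊆ W
    single⊆ {u = u} Wu i e with u ≟ i
    ... | yes refl = Wu

    size-single : ∀ u → size (single u) ≡ 1ℤ
    size-single u = trans (sum-cong-≗ {n} (λ i → sym (*-identityʳ (δ u i)))) (sum-δ u (λ _ → 1ℤ))

    Q-single : ∀ u → Q (single u) ≡ 0ℤ
    Q-single u = trans (B-δˡ u (δ u)) (trans (∙-δ u u) (A-diag u))

    size-mono : ∀ {S W} → S ⊆ W → size S ≤ size W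
    size-mono {S} {W} S⊆W = sum-mono λ i → le i
      where
      le : ∀ i → χ S i ≤ χ W i
      le i with S i in Si
      ... | false = 0≤χ W i
      ... | true  = ≤-reflexive (cong ⟦_⟧ (sym (S⊆W i Si)))

    deg<size : ∀ {W u} → W u ≡ true → deg W u ≤ size W - 1ℤ
    deg<size {W} {u} Wu = begin
      sum (λ j → A u j * χ W j)                   ≤⟨ sum-mono le ⟩
      sum (λ j → 1ℤ * χ W j + (- 1ℤ) * δ u j)     ≡⟨ sum-linear 1ℤ (- 1ℤ) (χ W) (δ u) ⟩
      1ℤ * size W + (- 1ℤ) * sum (δ u)            ≡⟨ cong (λ s → 1ℤ * size W + (- 1ℤ) * s) (size-single u) ⟩
      1ℤ * size W + (- 1ℤ) * 1ℤ                   ≡⟨ simp (size W) ⟩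
      size W - 1ℤ                                 ∎
      where
      open ≤-Reasoning
      simp : ∀ a → 1ℤ * a + (- 1ℤ) * 1ℤ ≡ a - 1ℤ
      simp = solve-∀
      le : ∀ j → A u j * χ W j ≤ 1ℤ * χ W j + (- 1ℤ) * δ u j
      le j with u ≟ j
      ... | yes refl rewrite Wu | adj-irref u = ≤-refl
      ... | no _ with adj u j | W j
      ...   | true  | true  = ≤-refl
      ...   | true  | false = ≤-refl
      ...   | false | true  = 0≤+ 1
      ...   | false | false = ≤-refl

    Q≤ : ∀ W → Q W ≤ size W * (size W - 1ℤ)
    Q≤ W = begin
      sum (λ i → χ W i * deg W i)             ≤⟨ sum-mono le ⟩
      sum (λ i → χ W i * (size W - 1ℤ))       ≡⟨ *-distribʳ-sum (size W - 1ℤ) (χ W) ⟨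
      size W * (size W - 1ℤ)                  ∎
      where
      open ≤-Reasoning
      le : ∀ i → χ W i * deg W i ≤ χ W i * (size W - 1ℤ)
      le i with W i in Wi
      ... | true  = *-monoˡ-≤-nonNeg 1ℤ (deg<size {W} Wi)
      ... | false = ≤-reflexive (trans (*-zeroˡ (deg W i)) (sym (*-zeroˡ (size W - 1ℤ))))

    sum-1 : ∀ m → sum {m} (λ _ → 1ℤ) ≡ + m
    sum-1 zero    = refl
    sum-1 (suc m) = cong (λ z → 1ℤ + z) (sum-1 m)

    size≤n : ∀ S → size S ≤ + n
    size≤n S = subst (size S ≤_) (sum-1 n) (sum-mono (λ i → ⟦ S i ⟧≤1))

    deg≤size : ∀ W i → deg W i ≤ size W
    deg≤size W i = sum-mono le
      where
      le : ∀ j → A i j * χ W j ≤ χ W j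
      le j with adj i j
      ... | true  = ≤-reflexive (*-identityˡ (χ W j))
      ... | false = subst (_≤ χ W j) (sym (*-zeroˡ (χ W j))) (0≤χ W j)

    inhabited : ∀ {S} → 1ℤ ≤ size S → ∃ λ u → S u ≡ true
    inhabited {S} 1≤ with Fin.any? (λ u → S u Bool.≟ true)
    ... | yes p = p
    ... | no ¬p = ⊥-elim (<⇒≱ (1+≤⇒< (≤-refl {1ℤ})) (subst (1ℤ ≤_) (trans (sum-cong-≗ {n} zero-off) (sum-0 n)) 1≤))
      where
      zero-off : ∀ i → χ S i ≡ 0ℤ
      zero-off i with S i in Si
      ... | true  = ⊥-elim (¬p (i , Si))
      ... | false = refl

    -- Deleting `u` lowers `Q W` by `2 deg W u` and `size W` by one. A vertex that violates the
    -- bound can thus be deleted without losing `C * size W ≤ D * Q W`.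
    Core : ℤ → ℤ → VSet → Set
    Core C D W = ∀ u → W u ≡ true → C < + 2 * D * deg W u

    core : ∀ {C D} → 0ℤ < C → 0ℤ ≤ D → ∀ fuel W → size W ≤ + fuel → 1ℤ ≤ size W → C * size W ≤ D * Q W →
      ∃ λ W′ → W′ ⊆ W × 1ℤ ≤ size W′ × C * size W′ ≤ D * Q W′ × Core C D W′
    core {C} {D} 0<C 0≤D fuel W ≤fuel 1≤ dense
      with Fin.any? (λ u → (W u Bool.≟ true) ×-dec (+ 2 * D * deg W u ≤? C))
    ... | no none = W , (λ _ e → e) , 1≤ , dense , λ u Wu → ≰⇒> (λ le → none (u , Wu , le))
    core {C} {D} 0<C 0≤D zero W ≤fuel 1≤ dense | yes _ with +≤+ () ← ≤-trans 1≤ ≤fuel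
    core {C} {D} 0<C 0≤D (suc fuel) W ≤fuel 1≤ dense | yes (u , Wu , low) =
      let W″ , sub , rest = core 0<C 0≤D fuel W′ size′≤ 1≤′ dense′
      in W″ , (λ i e → ∖⊆ W (single u) i (sub i e)) , rest
      where
      W′ = W ∖ single u
      sizeEq : size W′ ≡ size W - 1ℤ
      sizeEq = trans (size-∖ W (single u) (single⊆ {W} Wu)) (cong (λ s → size W - s) (size-single u))
      QEq : Q W′ ≡ Q W - + 2 * deg W u
      QEq = trans (Q-∖ W (single u) (single⊆ {W} Wu))
        (trans (cong₂ (λ b q → Q W - + 2 * b + q) (B-δˡ u (χ W)) (Q-single u)) (+-identityʳ _))
      size′≤ : size W′ ≤ + fuel
      size′≤ = subst (_≤ + fuel) (sym sizeEq) (+-monoˡ-≤ (- 1ℤ) ≤fuel)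
      dense′ : C * size W′ ≤ D * Q W′
      dense′ = subst₂ (λ s q → C * s ≤ D * q) (sym sizeEq) (sym QEq)
        (by-diff ((D * Q W - C * size W) + (C - + 2 * D * deg W u)) (0≤- dense ⊕ 0≤- low) (simp C D (size W) (Q W) (deg W u)))
        where
        simp : ∀ c d s q x → d * (q - + 2 * x) ≡ c * (s - 1ℤ) + ((d * q - c * s) + (c - + 2 * d * x))
        simp = solve-∀
      -- The deletions cannot exhaust the set: a single vertex has `Q` = 0 and is not dense, as `C`
      -- is positive.
      1≤′ : 1ℤ ≤ size W′
      1≤′ with 1ℤ ≤? size W′
      ... | yes p = p
      ... | no ¬p = ⊥-elim (<⇒≱ 0<C C≤0)
        where
        size′≤0 : size W - 1ℤ ≤ 0ℤ
        size′≤0 = subst (_≤ 0ℤ) sizeEq (<1+⇒≤ {j = 0ℤ} (≰⇒> ¬p))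
        size≡1 : size W ≡ 1ℤ
        size≡1 = ≤-antisym (by-diff (0ℤ - (size W - 1ℤ)) (0≤- size′≤0) (simp (size W))) 1≤
          where
          simp : ∀ a → 1ℤ ≡ a + (0ℤ - (a - 1ℤ))
          simp = solve-∀
        C≤0 : C ≤ 0ℤ
        C≤0 = begin
          C              ≡⟨ *-identityʳ C ⟨
          C * 1ℤ         ≡⟨ cong (C *_) size≡1 ⟨
          C * size W     ≤⟨ dense ⟩
          D * Q W        ≤⟨ *-monoˡ-≤-nonNeg D {{nonNegative 0≤D}} (subst (λ s → Q W ≤ s * (s - 1ℤ)) size≡1 (Q≤ W)) ⟩
          D * 0ℤ         ≡⟨ *-zeroʳ D ⟩
          0ℤ             ∎
          where open ≤-Reasoning

  -- Splitting a vertex set into two dense sets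

  δ-sym : ∀ {n} (i j : Fin n) → δ i j ≡ δ j i
  δ-sym i j with i ≟ j | j ≟ i
  ... | yes _ | yes _ = refl
  ... | no _  | no _  = refl
  ... | yes e | no ≢  = ⊥-elim (≢ (sym e))
  ... | no ≢  | yes e = ⊥-elim (≢ (sym e))

  -- The last fractional vertex, with fraction x / M, has surplus s on the first
  -- side and t on the second; h and g - t are what the two sides have without it.
  place-last : ∀ {M x h g s t β R V U ws ef eg} →
    0ℤ < M → 0ℤ ≤ x → x ≤ M → 0ℤ < s + t → s + t < ws → 0ℤ ≤ β → 0ℤ < R → 0ℤ < V →
    0ℤ < ef → 0ℤ < eg →
    ef * M ≤ + 4 * (R * R) * (M * h + x * s) → eg * M ≤ + 4 * (R * R) * (M * g - x * t) →
    + 4 * (R * R) * (U * U) * ws ≤ V * V * (ef + + 4 * (R * R) * β) →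
    + 4 * (R * R) * ((V - U) * (V - U)) * ws ≤ V * V * (eg + + 4 * (R * R) * β) →
    (- β < h × 0ℤ < g × (0ℤ < h ⊎ 0ℤ < s)) ⊎ (0ℤ < h + s × - β < g - t × (0ℤ < g - t ⊎ 0ℤ < t))
  place-last {M} {x} {h} {g} {s} {t} {β} {R} {V} {U} {ws} {ef} {eg}
    0<M 0≤x x≤M 0<w w<ws 0≤β 0<R 0<V 0<ef 0<eg F≥ G≥ c₁ c₂ = result
    where
    F = M * h + x * s
    G = M * g - x * t
    0≤M = <⇒≤ 0<M
    0≤M-x = 0≤- x≤M
    0<4R² : 0ℤ < + 4 * (R * R)
    0<4R² = 0<* {+ 4} (+<+ (ℕ.s≤s ℕ.z≤n)) (0<* 0<R 0<R)
    0<F : 0ℤ < F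
    0<F = pos-cancel (<⇒≤ 0<4R²) (<-≤-trans (0<* 0<ef 0<M) F≥)
    0<G : 0ℤ < G
    0<G = pos-cancel (<⇒≤ 0<4R²) (<-≤-trans (0<* 0<eg 0<M) G≥)
    -β<pos : ∀ {i} → 0ℤ < i → - β < i
    -β<pos 0<i = ≤-<-trans (neg-mono-≤ 0≤β) 0<i
    to-T-h : ∀ m x h s → (m * h + x * s) + x * (0ℤ - s) ≡ m * h
    to-T-h = solve-∀
    to-T-g : ∀ m x g t → (m * g - x * t) + x * t ≡ m * g
    to-T-g = solve-∀
    to-S-h : ∀ m x h s → (m * h + x * s) + (m - x) * s ≡ m * (h + s)
    to-S-h = solve-∀
    to-S-g : ∀ m x g t → (m * g - x * t) + (m - x) * (0ℤ - t) ≡ m * (g - t)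
    to-S-g = solve-∀
    other : ∀ {p q} → p ≤ 0ℤ → 0ℤ < p + q → 0ℤ ≤ q
    other {p} {q} p≤0 0<p+q = subst (0ℤ ≤_) (simp p q) (<⇒≤ 0<p+q ⊕ 0≤- p≤0)
      where
      simp : ∀ p q → (p + q) + (0ℤ - p) ≡ q
      simp = solve-∀
    impossible : 0ℤ < s → 0ℤ < t → ¬ (- β < h) → ¬ (- β < g - t) → ⊥
    impossible 0<s 0<t h≯ g≯ = <⇒≱ (0<* 0<V²x (i<j⇒0<j-i w<ws)) final
      where
      h≤ : h ≤ - β
      h≤ = ≮⇒≥ h≯
      g≤ : g - t ≤ - β
      g≤ = ≮⇒≥ g≯
      0<xs : 0ℤ < s * x
      0<xs = subst (0ℤ <_) (simp M x h s β) (0<+ 0<F (0≤M ⊗ 0≤- h≤ ⊕ 0≤M ⊗ 0≤β))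
        where
        simp : ∀ m x h s β → (m * h + x * s) + (m * (- β - h) + m * β) ≡ s * x
        simp = solve-∀
      0<x = pos-cancel (<⇒≤ 0<s) 0<xs
      0<M-x : 0ℤ < M - x
      0<M-x = pos-cancel (<⇒≤ 0<t) (subst (0ℤ <_) (simp M x g t β) (0<+ 0<G (0≤M ⊗ 0≤- g≤ ⊕ 0≤M ⊗ 0≤β)))
        where
        simp : ∀ m x g t β → (m * g - x * t) + (m * (- β - (g - t)) + m * β) ≡ t * (m - x)
        simp = solve-∀
      0<V²x : 0ℤ < V * V * (x * (M - x))
      0<V²x = 0<* (0<* 0<V 0<V) (0<* 0<x 0<M-x)
      -- With q = U / V and ξ = x / M this reads q² ws ≤ ξ s; correspondingly `lower₂` reads (1 -
      -- q)² ws ≤ (1 - ξ) t.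
      lower₁ : U * U * ws * M ≤ V * V * (x * s)
      lower₁ = cancel-pos (+ 4 * (R * R)) 0<4R² (by-diff
        (V * V * (+ 4 * (R * R) * F - ef * M) + + 4 * (R * R) * (V * V) * (M * (- β - h))
          + (V * V * (ef + + 4 * (R * R) * β) - + 4 * (R * R) * (U * U) * ws) * M)
        (0≤sq V ⊗ 0≤- F≥ ⊕ <⇒≤ 0<4R² ⊗ 0≤sq V ⊗ (0≤M ⊗ 0≤- h≤) ⊕ 0≤- c₁ ⊗ 0≤M)
        (simp M x h s β (+ 4 * (R * R)) V U ws ef))
        where
        simp : ∀ M x h s β R V U ws ef → R * (V * V * (x * s)) ≡ R * (U * U * ws * M) +
          (V * V * (R * (M * h + x * s) - ef * M) + R * (V * V) * (M * (- β - h))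
            + (V * V * (ef + R * β) - R * (U * U) * ws) * M)
        simp = solve-∀
      lower₂ : (V - U) * (V - U) * ws * M ≤ V * V * ((M - x) * t)
      lower₂ = cancel-pos (+ 4 * (R * R)) 0<4R² (by-diff
        (V * V * (+ 4 * (R * R) * G - eg * M) + + 4 * (R * R) * (V * V) * (M * (- β - (g - t)))
          + (V * V * (eg + + 4 * (R * R) * β) - + 4 * (R * R) * ((V - U) * (V - U)) * ws) * M)
        (0≤sq V ⊗ 0≤- G≥ ⊕ <⇒≤ 0<4R² ⊗ 0≤sq V ⊗ (0≤M ⊗ 0≤- g≤) ⊕ 0≤- c₂ ⊗ 0≤M)
        (simp M x g t β (+ 4 * (R * R)) V ((V - U) * (V - U)) ws eg))
        where
        simp : ∀ M x g t β R V U ws ef → R * (V * V * ((M - x) * t)) ≡ R * (U * ws * M) +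
          (V * V * (R * (M * g - x * t) - ef * M) + R * (V * V) * (M * (- β - (g - t)))
            + (V * V * (ef + R * β) - R * U * ws) * M)
        simp = solve-∀
      0≤ws : 0ℤ ≤ ws
      0≤ws = <⇒≤ (<-trans 0<w w<ws)
      -- Adding the two bounds gives ws (q² / ξ + (1 - q)² / (1 - ξ)) ≤ s + t. The square of
      -- `U * M - V * x` is what q² / ξ + (1 - q)² / (1 - ξ) exceeds 1 by, up to a factor. Hence ws
      -- ≤ s + t, against the hypothesis.
      final : V * V * (x * (M - x)) * (ws - (s + t)) ≤ 0ℤ
      final = by-diff
        ((M - x) * (V * V * (x * s) - U * U * ws * M)
          + x * (V * V * ((M - x) * t) - (V - U) * (V - U) * ws * M)
          + ws * ((U * M - V * x) * (U * M - V * x)))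
        (0≤M-x ⊗ 0≤- lower₁ ⊕ 0≤x ⊗ 0≤- lower₂ ⊕ 0≤ws ⊗ 0≤sq (U * M - V * x))
        (simp M x s t V U ws)
        where
        simp : ∀ M x s t V U ws → 0ℤ ≡ V * V * (x * (M - x)) * (ws - (s + t)) +
          ((M - x) * (V * V * (x * s) - U * U * ws * M)
          + x * (V * V * ((M - x) * t) - (V - U) * (V - U) * ws * M)
          + ws * ((U * M - V * x) * (U * M - V * x)))
        simp = solve-∀
    result : (- β < h × 0ℤ < g × (0ℤ < h ⊎ 0ℤ < s)) ⊎ (0ℤ < h + s × - β < g - t × (0ℤ < g - t ⊎ 0ℤ < t))
    -- A vertex that does not help one side goes to the other, where it does no harm because s + t
    -- is positive. Only if both surpluses are positive is the inequality needed.
    result with t ≤? 0ℤ | s ≤? 0ℤ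
    ... | yes t≤0 | _ = inj₂ (0<h+s , -β<pos 0<g-t , inj₁ 0<g-t)
      where
      0≤s = other t≤0 (subst (0ℤ <_) (+-comm s t) 0<w)
      0<h+s = pos-cancel 0≤M (subst (0ℤ <_) (to-S-h M x h s) (0<+ 0<F (0≤M-x ⊗ 0≤s)))
      0<g-t = pos-cancel 0≤M (subst (0ℤ <_) (to-S-g M x g t) (0<+ 0<G (0≤M-x ⊗ 0≤- t≤0)))
    ... | no _ | yes s≤0 = inj₁ (-β<pos 0<h , 0<g , inj₁ 0<h)
      where
      0≤t = other s≤0 0<w
      0<h = pos-cancel 0≤M (subst (0ℤ <_) (to-T-h M x h s) (0<+ 0<F (0≤x ⊗ 0≤- s≤0)))
      0<g = pos-cancel 0≤M (subst (0ℤ <_) (to-T-g M x g t) (0<+ 0<G (0≤x ⊗ 0≤t)))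
    ... | no t≰0 | no s≰0 with - β <? h | - β <? g - t
    ...   | yes h> | _ = inj₁ (h> , pos-cancel 0≤M (subst (0ℤ <_) (to-T-g M x g t) (0<+ 0<G (0≤x ⊗ <⇒≤ (≰⇒> t≰0)))) , inj₂ (≰⇒> s≰0))
    ...   | no _ | yes g> = inj₂ (pos-cancel 0≤M (subst (0ℤ <_) (to-S-h M x h s) (0<+ 0<F (0≤M-x ⊗ <⇒≤ (≰⇒> s≰0)))) , g> , inj₂ (≰⇒> t≰0))
    ...   | no h≯ | no g≯ = ⊥-elim (impossible (≰⇒> s≰0) (≰⇒> t≰0) h≯ g≯)

  module Splitting {n} (adj : Fin n → Fin n → Bool)
    (adj-sym : ∀ x y → adj x y ≡ adj y x) (adj-irref : ∀ x → adj x x ≡ false)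
    (D a b : ℤ) (0≤D : 0ℤ ≤ D) (W : Fin n → Bool) where

    open OnGraph adj adj-sym adj-irref

    -- The amount by which the first surplus gains on the second when `i` changes to the first side.
    w : Fin n → ℤ
    w i = + 2 * D * deg W i - (a + b)

    weight : (Fin n → ℤ) → ℤ
    weight X = sum (λ i → w i * X i)

    surplus : (Fin n → ℤ) → ℤ → ℤ
    surplus X M = D * B X X - a * M * sum X

    penalty : (Fin n → ℤ) → ℤ → ℤ
    penalty X M = sum (λ i → X i * (M - X i))

    -- An edge has negative curvature for `K₁` when both weights are positive. The diagonal `D` in
    -- `K₂` turns that curvature into `D * (w v - w u)²`. Since X² = M X - X (M - X), the
    -- coefficient `a + D` compensates for the diagonal up to the penalty, which vanishes on whole
    -- vectors.
    K₁ K₂ : Matrix n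
    K₁ i j = D * A i j
    K₂ i j = D * A i j + D * δ i j

    module P₁ = Pipage K₁ (λ i j → cong (D *_) (A-sym i j)) w a
    module P₂ = Pipage K₂ (λ i j → cong₂ (λ x y → D * x + D * y) (A-sym i j) (δ-sym i j)) w (a + D)

    Φ₁≡ : ∀ X M → P₁.Φ X M ≡ surplus X M
    Φ₁≡ X M = cong (_- a * M * sum X) (begin
      sum (λ i → X i * sum (λ j → D * A i j * X j))
        ≡⟨ sum-cong-≗ {n} (λ i → cong (X i *_) (sum-cong-≗ {n} (λ j → *-assoc D (A i j) (X j)))) ⟩
      sum (λ i → X i * sum (λ j → D * (A i j * X j)))
        ≡⟨ sum-cong-≗ {n} (λ i → cong (X i *_) (*-distribˡ-sum D (λ j → A i j * X j))) ⟨
      sum (λ i → X i * (D * (X ∙ i)))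
        ≡⟨ sum-cong-≗ {n} (λ i → swap (X i) D (X ∙ i)) ⟩
      sum (λ i → D * (X i * (X ∙ i)))
        ≡⟨ *-distribˡ-sum D (λ i → X i * (X ∙ i)) ⟨
      D * B X X ∎)
      where
      open ≡-Reasoning
      swap : ∀ x d y → x * (d * y) ≡ d * (x * y)
      swap = solve-∀

    Φ₂≡ : ∀ X M → P₂.Φ X M ≡ surplus X M - D * penalty X M
    Φ₂≡ X M = begin
      sum (λ i → X i * sum (λ j → (D * A i j + D * δ i j) * X j)) - (a + D) * M * sum X
        ≡⟨ cong (_- (a + D) * M * sum X) (begin
           sum (λ i → X i * sum (λ j → (D * A i j + D * δ i j) * X j))
             ≡⟨ sum-cong-≗ {n} (λ i → cong (X i *_) (inner i)) ⟩
           sum (λ i → X i * (D * (X ∙ i) + D * X i))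
             ≡⟨ sum-cong-≗ {n} (λ i → distr (X i) D (X ∙ i)) ⟩
           sum (λ i → D * (X i * (X ∙ i)) + D * (X i * X i))
             ≡⟨ sum-linear D D (λ i → X i * (X ∙ i)) (λ i → X i * X i) ⟩
           D * B X X + D * sum (λ i → X i * X i) ∎) ⟩
      D * B X X + D * sum (λ i → X i * X i) - (a + D) * M * sum X
        ≡⟨ collect D a M (B X X) (sum (λ i → X i * X i)) (sum X) ⟩
      surplus X M - D * (M * sum X + (- 1ℤ) * sum (λ i → X i * X i))
        ≡⟨ cong (λ p → surplus X M - D * p) (begin
           M * sum X + (- 1ℤ) * sum (λ i → X i * X i)
             ≡⟨ sum-linear M (- 1ℤ) X (λ i → X i * X i) ⟨
           sum (λ i → M * X i + (- 1ℤ) * (X i * X i))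
             ≡⟨ sum-cong-≗ {n} (λ i → pen M (X i)) ⟩
           penalty X M ∎) ⟩
      surplus X M - D * penalty X M ∎
      where
      open ≡-Reasoning
      inner : ∀ i → sum (λ j → (D * A i j + D * δ i j) * X j) ≡ D * (X ∙ i) + D * X i
      inner i = begin
        sum (λ j → (D * A i j + D * δ i j) * X j)
          ≡⟨ sum-cong-≗ {n} (λ j → expand D (A i j) (δ i j) (X j)) ⟩
        sum (λ j → D * (A i j * X j) + D * (δ i j * X j))
          ≡⟨ sum-linear D D (λ j → A i j * X j) (λ j → δ i j * X j) ⟩
        D * (X ∙ i) + D * sum (λ j → δ i j * X j)
          ≡⟨ cong (λ x → D * (X ∙ i) + D * x) (sum-δ i X) ⟩
        D * (X ∙ i) + D * X i ∎
        where
        expand : ∀ d x y z → (d * x + d * y) * z ≡ d * (x * z) + d * (y * z)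
        expand = solve-∀
      distr : ∀ x d y → x * (d * y + d * x) ≡ d * (x * y) + d * (x * x)
      distr = solve-∀
      collect : ∀ d a m q s t → d * q + d * s - (a + d) * m * t ≡ (d * q - a * m * t) - d * (m * t + (- 1ℤ) * s)
      collect = solve-∀
      pen : ∀ m x → m * x + (- 1ℤ) * (x * x) ≡ x * (m - x)
      pen = solve-∀

    InW : Fin n → Set
    InW i = W i ≡ true

    Nonadjacent Distinct : Fin n → Fin n → Set
    Nonadjacent u v = u ≢ v × adj u v ≡ false
    Distinct u v = u ≢ v

    nonadjacent? : ∀ u v → Dec (Nonadjacent u v)
    nonadjacent? u v = ¬? (u ≟ v) ×-dec (adj u v Bool.≟ false)

    distinct? : ∀ u v → Dec (Distinct u v)
    distinct? u v = ¬? (u ≟ v)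

    convex₁ : ∀ {u v} → InW u → InW v → Nonadjacent u v → 0ℤ ≤ P₁.curvature u v
    convex₁ {u} {v} _ _ (_ , e) rewrite adj-irref u | adj-irref v | e =
      ≤-reflexive (sym (zeros D (w u) (w v)))
      where
      zeros : ∀ d x y → y * y * (d * 0ℤ) - + 2 * (x * y) * (d * 0ℤ) + x * x * (d * 0ℤ) ≡ 0ℤ
      zeros = solve-∀

    convex₂ : ∀ {u v} → InW u → InW v → Distinct u v → 0ℤ ≤ P₂.curvature u v
    convex₂ {u} {v} _ _ u≢v rewrite A-diag u | A-diag v | δ-diag u | δ-diag v | δ-off u≢v with adj u v
    ... | true  = subst (0ℤ ≤_) (square D (w u) (w v)) (0≤D ⊗ 0≤sq (w v - w u))
      where
      square : ∀ d x y → d * ((y - x) * (y - x))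
        ≡ y * y * (d * 0ℤ + d * 1ℤ) - + 2 * (x * y) * (d * 1ℤ + d * 0ℤ) + x * x * (d * 0ℤ + d * 1ℤ)
      square = solve-∀
    ... | false = subst (0ℤ ≤_) (squares D (w u) (w v)) (0≤D ⊗ (0≤sq (w v) ⊕ 0≤sq (w u)))
      where
      squares : ∀ d x y → d * (y * y + x * x)
        ≡ y * y * (d * 0ℤ + d * 1ℤ) - + 2 * (x * y) * (d * 0ℤ + d * 0ℤ) + x * x * (d * 0ℤ + d * 1ℤ)
      squares = solve-∀

    0≤penalty : ∀ {X M L} → State InW X M L → 0ℤ ≤ penalty X M
    0≤penalty st = 0≤sum (λ i → 0≤X i ⊗ 0≤- (X≤M i))
      where open State st

    penalty≤ : ∀ {X M L} → State InW X M L → + 4 * penalty X M ≤ + length L * (M * M)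
    penalty≤ {X} {M} {L} st = begin
      + 4 * penalty X M
        ≡⟨ *-distribˡ-sum (+ 4) (λ i → X i * (M - X i)) ⟩
      sum (λ i → + 4 * (X i * (M - X i)))
        ≤⟨ sum≤sumOn _ (λ i → 0≤+ 4 ⊗ (0≤X i ⊗ 0≤- (X≤M i))) L outside ⟩
      sumOn (λ i → + 4 * (X i * (M - X i))) L
        ≤⟨ sumOn-mono L (λ {i} _ → by-diff ((M - + 2 * X i) * (M - + 2 * X i)) (0≤sq (M - + 2 * X i)) (amgm M (X i))) ⟩
      sumOn (λ _ → M * M) L
        ≡⟨ sumOn-const (M * M) L ⟩
      + length L * (M * M) ∎
      where
      open State st
      open ≤-Reasoning
      amgm : ∀ m x → m * m ≡ + 4 * (x * (m - x)) + (m - + 2 * x) * (m - + 2 * x)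
      amgm = solve-∀
      whole-zero : ∀ i → Whole X M i → + 4 * (X i * (M - X i)) ≡ 0ℤ
      whole-zero i (inj₁ X≡0) = trans (cong (λ x → + 4 * (x * (M - x))) X≡0) refl
      whole-zero i (inj₂ X≡M) = trans (cong (λ x → + 4 * (x * (M - x))) X≡M) (simp M)
        where
        simp : ∀ m → + 4 * (m * (m - m)) ≡ 0ℤ
        simp = solve-∀
      outside : ∀ i → i ∉ L → + 4 * (X i * (M - X i)) ≡ 0ℤ
      outside i i∉L with whole? X M i
      ... | yes wh = whole-zero i wh
      ... | no ¬wh = ⊥-elim (i∉L (complete i ¬wh))

    Clique : List (Fin n) → Set
    Clique L = Unique L × All InW L × AllPairs (λ u v → adj u v ≡ true) L

    -- P / R is the fraction from which the rounding starts.
    record Rounded (P R y : ℤ) : Set where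
      field
        X       : Fin n → ℤ
        M       : ℤ
        u       : Fin n
        Wu      : InW u
        0<M     : 0ℤ < M
        0≤X     : ∀ i → 0ℤ ≤ X i
        X≤M     : ∀ i → X i ≤ M
        support : ∀ i → ¬ InW i → X i ≡ 0ℤ
        whole   : ∀ i → u ≢ i → Whole X M i
        weight≡ : weight X * R ≡ weight (λ i → P * χ W i) * M
        bound   : (+ 4 * surplus (λ i → P * χ W i) R - D * y * (R * R)) * (M * M)
                  ≤ + 4 * (R * R) * surplus X M

    members : List (Fin n)
    members = filter (λ i → W i Bool.≟ true) (allFin n)

    initial : ∀ {P R} → 0ℤ < R → 0ℤ ≤ P → P ≤ R → State InW (λ i → P * χ W i) R members
    initial {P} {R} 0<R 0≤P P≤R = record
      { 0<M      = 0<R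
      ; 0≤X      = λ i → 0≤P ⊗ 0≤χ W i
      ; X≤M      = X≤R
      ; support  = supp
      ; L⊆P      = all-filter _ (allFin n)
      ; unique   = Unique.filter⁺ _ (Unique.allFin⁺ n)
      ; complete = compl
      }
      where
      X≤R : ∀ i → P * χ W i ≤ R
      X≤R i with W i
      ... | true  = ≤-trans (≤-reflexive (*-identityʳ P)) P≤R
      ... | false = ≤-trans (≤-reflexive (*-zeroʳ P)) (<⇒≤ 0<R)
      supp : ∀ i → ¬ InW i → P * χ W i ≡ 0ℤ
      supp i ¬Wi with W i
      ... | true  = ⊥-elim (¬Wi refl)
      ... | false = *-zeroʳ P
      compl : ∀ i → ¬ Whole (λ i → P * χ W i) R i → i ∈ members
      compl i ¬w with W i Bool.≟ true
      ... | yes Wi = ∈-filter⁺ (λ i → W i Bool.≟ true) (∈-allFin i) Wi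
      ... | no ¬Wi = ⊥-elim (¬w (inj₁ (supp i ¬Wi)))

    -- Passing to the second form costs `D` times the penalty, at most `D / 4` for each vertex that
    -- is still fractional; this is the term with `y` in `bound`. The penalty that remains at the
    -- end is nonnegative and is dropped.
    rounded : ∀ {P R} y → 0ℤ < R → 0ℤ ≤ P → P ≤ R → ∃ InW → (∀ i → InW i → 0ℤ < w i) →
      (∃ λ L → Clique L × suc y ℕ.≤ length L) ⊎ Rounded P R (+ y)
    rounded {P} {R} y 0<R 0≤P P≤R (u₀ , Wu₀) 0<w = result
      where
      X₀ = λ i → P * χ W i
      ρ₁ = P₁.round InW 0<w Nonadjacent nonadjacent? proj₁ convex₁ (length members) X₀ R members ℕ.≤-refl (initial 0<R 0≤P P≤R)
      module ρ₁ = P₁.Rounding ρ₁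
      X₁ = ρ₁.X′
      M₁ = ρ₁.M′
      ρ₂ = P₂.round InW 0<w Distinct distinct? (λ e → e) convex₂ (length ρ₁.L′) X₁ M₁ ρ₁.L′ ℕ.≤-refl ρ₁.state
      module ρ₂ = P₂.Rounding ρ₂
      X₂ = ρ₂.X′
      M₂ = ρ₂.M′
      0<M₁ = State.0<M ρ₁.state
      0<M₂ = State.0<M ρ₂.state
      clique : Clique ρ₁.L′
      clique = State.unique ρ₁.state , State.L⊆P ρ₁.state ,
        AllPairs.zipWith adjacent (State.unique ρ₁.state , ρ₁.stuck)
        where
        adjacent : ∀ {u v} → u ≢ v × ¬ Nonadjacent u v → adj u v ≡ true
        adjacent {u} {v} (u≢v , ¬na) with adj u v
        ... | true  = refl
        ... | false = ⊥-elim (¬na (u≢v , refl))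
      last-fractional : ∀ L → AllPairs (λ u v → ¬ u ≢ v) L → Unique L → All InW L →
        ∃ λ u → InW u × (∀ {i} → i ∈ L → i ≡ u)
      -- If no fractional vertex remains, any vertex of `W` may play the last one.
      last-fractional [] _ _ _ = u₀ , Wu₀ , λ ()
      last-fractional (u ∷ []) _ _ (Wu ∷ _) = u , Wu , λ { (here e) → e }
      last-fractional (u ∷ v ∷ L) ((¬≢ ∷ _) ∷ _) ((u≢v ∷ _) ∷ _) _ = ⊥-elim (¬≢ u≢v)
      lf = last-fractional ρ₂.L′ ρ₂.stuck (State.unique ρ₂.state) (State.L⊆P ρ₂.state)
      whole₂ : ∀ i → proj₁ lf ≢ i → Whole X₂ M₂ i
      whole₂ i u≢i = decidable-stable (whole? X₂ M₂ i)
        (λ ¬wh → u≢i (sym (proj₂ (proj₂ lf) (State.complete ρ₂.state i ¬wh))))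
      weight-total : weight X₂ * R ≡ weight X₀ * M₂
      weight-total = *-cancelˡ-≡ M₁ _ _ {{≢-nonZero (λ e → <-irrefl (sym e) 0<M₁)}} (begin
        M₁ * (weight X₂ * R)   ≡⟨ swap₁ M₁ (weight X₂) R ⟩
        weight X₂ * M₁ * R     ≡⟨ cong (_* R) ρ₂.weight≡ ⟩
        weight X₁ * M₂ * R     ≡⟨ swap₂ (weight X₁) M₂ R ⟩
        weight X₁ * R * M₂     ≡⟨ cong (_* M₂) ρ₁.weight≡ ⟩
        weight X₀ * M₁ * M₂    ≡⟨ swap₃ (weight X₀) M₁ M₂ ⟩
        M₁ * (weight X₀ * M₂)  ∎)
        where
        open ≡-Reasoning
        swap₁ : ∀ m x r → m * (x * r) ≡ x * m * r
        swap₁ = solve-∀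
        swap₂ : ∀ x m r → x * m * r ≡ x * r * m
        swap₂ = solve-∀
        swap₃ : ∀ x m k → x * m * k ≡ m * (x * k)
        swap₃ = solve-∀
      bound : length ρ₁.L′ ℕ.≤ y →
        (+ 4 * surplus X₀ R - D * + y * (R * R)) * (M₂ * M₂) ≤ + 4 * (R * R) * surplus X₂ M₂
      bound L≤y = cancel-pos (M₁ * M₁) (0<* 0<M₁ 0<M₁) (by-diff
        (+ 4 * (M₂ * M₂) * (f₁ * (R * R) - f₀ * (M₁ * M₁))
          + + 4 * (R * R) * ((f₂ - D * q₂) * (M₁ * M₁) - (f₁ - D * q₁) * (M₂ * M₂))
          + D * (R * R) * (M₂ * M₂) * (+ y * (M₁ * M₁) - + 4 * q₁)
          + + 4 * (R * R) * (M₁ * M₁) * (D * q₂))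
        (0≤+ 4 ⊗ 0≤sq M₂ ⊗ 0≤- step₁ ⊕ 0≤+ 4 ⊗ 0≤sq R ⊗ 0≤- step₂
          ⊕ 0≤D ⊗ 0≤sq R ⊗ 0≤sq M₂ ⊗ 0≤- pen
          ⊕ 0≤+ 4 ⊗ 0≤sq R ⊗ 0≤sq M₁ ⊗ (0≤D ⊗ 0≤penalty ρ₂.state))
        (algebra R M₁ M₂ f₀ f₁ f₂ q₁ q₂ D (+ y)))
        where
        f₀ = surplus X₀ R
        f₁ = surplus X₁ M₁
        f₂ = surplus X₂ M₂
        q₁ = penalty X₁ M₁
        q₂ = penalty X₂ M₂
        step₁ : f₀ * (M₁ * M₁) ≤ f₁ * (R * R)
        step₁ = subst₂ (λ x z → x * (M₁ * M₁) ≤ z * (R * R)) (Φ₁≡ X₀ R) (Φ₁≡ X₁ M₁) ρ₁.Φ≤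
        step₂ : (f₁ - D * q₁) * (M₂ * M₂) ≤ (f₂ - D * q₂) * (M₁ * M₁)
        step₂ = subst₂ (λ x z → x * (M₂ * M₂) ≤ z * (M₁ * M₁)) (Φ₂≡ X₁ M₁) (Φ₂≡ X₂ M₂) ρ₂.Φ≤
        pen : + 4 * q₁ ≤ + y * (M₁ * M₁)
        pen = ≤-trans (penalty≤ ρ₁.state) (*-monoʳ-≤-nonNeg (M₁ * M₁) {{nonNegative (0≤sq M₁)}} (+≤+ L≤y))
        algebra : ∀ R M₁ M₂ f₀ f₁ f₂ q₁ q₂ D y →
          M₁ * M₁ * (+ 4 * (R * R) * f₂)
          ≡ M₁ * M₁ * ((+ 4 * f₀ - D * y * (R * R)) * (M₂ * M₂))
          + (+ 4 * (M₂ * M₂) * (f₁ * (R * R) - f₀ * (M₁ * M₁))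
          + + 4 * (R * R) * ((f₂ - D * q₂) * (M₁ * M₁) - (f₁ - D * q₁) * (M₂ * M₂))
          + D * (R * R) * (M₂ * M₂) * (y * (M₁ * M₁) - + 4 * q₁)
          + + 4 * (R * R) * (M₁ * M₁) * (D * q₂))
        algebra = solve-∀
      result : (∃ λ L → Clique L × suc y ℕ.≤ length L) ⊎ Rounded P R (+ y)
      result with suc y ℕ.≤? length ρ₁.L′
      ... | yes long = inj₁ (ρ₁.L′ , clique , long)
      ... | no short = inj₂ record
        { X = X₂ ; M = M₂ ; u = proj₁ lf ; Wu = proj₁ (proj₂ lf)
        ; 0<M = 0<M₂ ; 0≤X = State.0≤X ρ₂.state ; X≤M = State.X≤M ρ₂.state
        ; support = State.support ρ₂.state
        ; whole = whole₂ ; weight≡ = weight-total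
        ; bound = bound (ℕ.≤-pred (ℕ.≰⇒> short))
        }

    excess : ℤ → VSet → ℤ
    excess c S = D * Q S - c * size S

    excess>0⇒1≤size : ∀ {c} S → 0ℤ < excess c S → 1ℤ ≤ size S
    excess>0⇒1≤size {c} S pos with 1ℤ ≤? size S
    ... | yes p = p
    ... | no ¬p = ⊥-elim (<⇒≱ pos (begin
      D * Q S - c * size S   ≡⟨ cong (λ s → D * Q S - c * s) size≡0 ⟩
      D * Q S - c * 0ℤ       ≡⟨ simp (D * Q S) c ⟩
      D * Q S                ≤⟨ *-monoˡ-≤-nonNeg D {{nonNegative 0≤D}} (subst (λ s → Q S ≤ s * (s - 1ℤ)) size≡0 (Q≤ S)) ⟩
      D * 0ℤ                 ≡⟨ *-zeroʳ D ⟩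
      0ℤ                     ∎))
      where
      open ≤-Reasoning
      size≡0 : size S ≡ 0ℤ
      size≡0 = ≤-antisym (<1+⇒≤ {j = 0ℤ} (≰⇒> ¬p)) (0≤size S)
      simp : ∀ x c → x - c * 0ℤ ≡ x
      simp = solve-∀

    weight-χ : ∀ S → weight (χ S) ≡ + 2 * D * B (χ S) (χ W) - (a + b) * size S
    weight-χ S = begin
      sum (λ i → (+ 2 * D * deg W i - (a + b)) * χ S i)
        ≡⟨ sum-cong-≗ {n} (λ i → expand D (a + b) (deg W i) (χ S i)) ⟩
      sum (λ i → + 2 * D * (χ S i * deg W i) + (- (a + b)) * χ S i)
        ≡⟨ sum-linear (+ 2 * D) (- (a + b)) (λ i → χ S i * deg W i) (χ S) ⟩
      + 2 * D * B (χ S) (χ W) + (- (a + b)) * size S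
        ≡⟨ simp (+ 2 * D * B (χ S) (χ W)) (a + b) (size S) ⟩
      + 2 * D * B (χ S) (χ W) - (a + b) * size S ∎
      where
      open ≡-Reasoning
      expand : ∀ d c x y → (+ 2 * d * x - c) * y ≡ + 2 * d * (y * x) + (- c) * y
      expand = solve-∀
      simp : ∀ x c y → x + (- c) * y ≡ x - c * y
      simp = solve-∀

    -- The reason for the choice of `w`: the two quadratic terms cancel, so the difference of the
    -- excesses of the two sides is linear in `S`.
    excess-complement : ∀ S → S ⊆ W → excess b (W ∖ S) ≡ excess a S - weight (χ S) + excess b W
    excess-complement S S⊆W = begin
      D * Q (W ∖ S) - b * size (W ∖ S)
        ≡⟨ cong₂ (λ q s → D * q - b * s) (Q-∖ W S S⊆W) (size-∖ W S S⊆W) ⟩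
      D * (Q W - + 2 * B (χ S) (χ W) + Q S) - b * (size W - size S)
        ≡⟨ simp D a b (Q W) (B (χ S) (χ W)) (Q S) (size W) (size S) ⟩
      excess a S - (+ 2 * D * B (χ S) (χ W) - (a + b) * size S) + excess b W
        ≡⟨ cong (λ ω → excess a S - ω + excess b W) (weight-χ S) ⟨
      excess a S - weight (χ S) + excess b W ∎
      where
      open ≡-Reasoning
      simp : ∀ d a b q x s n m → d * (q - + 2 * x + s) - b * (n - m)
        ≡ (d * s - a * m) - (+ 2 * d * x - (a + b) * m) + (d * q - b * n)
      simp = solve-∀

    surplus-initial : ∀ P R → surplus (λ i → P * χ W i) R ≡ D * (P * P) * Q W - a * R * (P * size W)
    surplus-initial P R = begin
      D * B (λ i → P * χ W i) (λ i → P * χ W i) - a * R * sum (λ i → P * χ W i)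
        ≡⟨ cong₂ (λ q s → D * q - a * R * s)
             (trans (B-cong pad pad) (B-quadratic A-sym P 0ℤ (χ W) (χ W))) (sym (*-distribˡ-sum P (χ W))) ⟩
      D * (P * P * Q W + + 2 * (P * 0ℤ) * Q W + 0ℤ * 0ℤ * Q W) - a * R * (P * size W)
        ≡⟨ cong (_- a * R * (P * size W)) (simp D P (Q W)) ⟩
      D * (P * P) * Q W - a * R * (P * size W) ∎
      where
      open ≡-Reasoning
      pad : ∀ i → P * χ W i ≡ P * χ W i + 0ℤ * χ W i
      pad i = sym (trans (cong (λ z → P * χ W i + z) (*-zeroˡ (χ W i))) (+-identityʳ _))
      simp : ∀ d p q → d * (p * p * q + + 2 * (p * 0ℤ) * q + 0ℤ * 0ℤ * q) ≡ d * (p * p) * q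
      simp = solve-∀

    weight-initial : ∀ P → weight (λ i → P * χ W i) ≡ P * (+ 2 * D * Q W - (a + b) * size W)
    weight-initial P = trans (sum-cong-≗ {n} (λ i → swap (w i) P (χ W i)))
      (trans (sym (*-distribˡ-sum P (λ i → w i * χ W i))) (cong (P *_) (weight-χ W)))
      where
      swap : ∀ x p y → x * (p * y) ≡ p * (x * y)
      swap = solve-∀

    -- `β` is the granularity of the excess: exceeding `- β` will imply being nonnegative.
    record Split (β : ℤ) : Set where
      field
        S T      : VSet
        S⊆W      : S ⊆ W
        T⊆W      : T ⊆ W
        disjoint : ∀ i → S i ≡ true → T i ≡ true → ⊥
        1≤S      : 1ℤ ≤ size S
        1≤T      : 1ℤ ≤ size T
        dense-S  : - β < excess a S
        dense-T  : - β < excess b T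

    module FromRounded {P R y : ℤ} (rd : Rounded P R y) where
      open Rounded rd

      x = X u

      -- `u` is kept out of `S₀` even if its coordinate is full, so that X is `M` on `S₀` plus a
      -- term at `u` for every value of `x`.
      S₀ S₁ : VSet
      S₀ i = does (X i ℤ.≟ M) ∧ not (does (u ≟ i))
      S₁ i = does (u ≟ i) ∨ S₀ i

      X≡ : ∀ i → X i ≡ M * χ S₀ i + x * δ u i
      X≡ i with u ≟ i
      ... | yes refl with does (X i ℤ.≟ M)
      ...   | true  = sym (simp M (X i))
        where
        simp : ∀ m x → m * 0ℤ + x * 1ℤ ≡ x
        simp = solve-∀
      ...   | false = sym (simp M (X i))
        where
        simp : ∀ m x → m * 0ℤ + x * 1ℤ ≡ x
        simp = solve-∀
      X≡ i | no u≢i with X i ℤ.≟ M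
      ...   | yes X≡M = trans X≡M (sym (simp M x))
        where
        simp : ∀ m x → m * 1ℤ + x * 0ℤ ≡ m
        simp = solve-∀
      ...   | no X≢M with whole i u≢i
      ...     | inj₁ X≡0 = trans X≡0 (sym (simp M x))
        where
        simp : ∀ m x → m * 0ℤ + x * 0ℤ ≡ 0ℤ
        simp = solve-∀
      ...     | inj₂ X≡M = ⊥-elim (X≢M X≡M)

      S₀⊆W : S₀ ⊆ W
      S₀⊆W i e with W i Bool.≟ true | X i ℤ.≟ M
      ... | yes Wi | _ = Wi
      ... | no ¬Wi | yes X≡M = ⊥-elim (<-irrefl (trans (sym (support i ¬Wi)) X≡M) 0<M)
      S₀⊆W i () | no _ | no _

      S₀u : S₀ u ≡ false
      S₀u with does (X u ℤ.≟ M) | u ≟ u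
      ... | true  | yes _ = refl
      ... | false | yes _ = refl
      ... | _     | no ≢  = ⊥-elim (≢ refl)

      S₁⊆W : S₁ ⊆ W
      S₁⊆W i e = [ (λ e → single⊆ {W} Wu i e) , S₀⊆W i ]′ (∨-true (does (u ≟ i)) e)
        where
        ∨-true : ∀ p {q} → p ∨ q ≡ true → p ≡ true ⊎ q ≡ true
        ∨-true true  e = inj₁ refl
        ∨-true false e = inj₂ e

      χ-S₁ : ∀ i → χ S₁ i ≡ 1ℤ * χ S₀ i + 1ℤ * δ u i
      χ-S₁ i with u ≟ i | does (X i ℤ.≟ M)
      ... | yes _ | true  = refl
      ... | yes _ | false = refl
      ... | no _  | true  = refl
      ... | no _  | false = refl

      -- `s` is what `u` adds to the first side, and `t` = 2 D deg (W ∖ S₀) u - b is what the second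
      -- side loses without it.
      h = excess a S₀
      s = + 2 * D * deg S₀ u - a
      g = excess b (W ∖ S₀)
      t = w u - s
      ω = weight (χ S₀)

      B-mix : ∀ α β → let Z = λ i → α * χ S₀ i + β * δ u i in
        B Z Z ≡ α * α * Q S₀ + + 2 * (α * β) * deg S₀ u
      B-mix α β = trans (B-quadratic A-sym α β (χ S₀) (δ u))
        (trans (cong₂ (λ p q → α * α * Q S₀ + + 2 * (α * β) * p + β * β * q)
          (trans (B-sym A-sym (χ S₀) (δ u)) (B-δˡ u (χ S₀))) (Q-single u)) (simp (α * α * Q S₀ + + 2 * (α * β) * deg S₀ u) (β * β)))
        where
        simp : ∀ p q → p + q * 0ℤ ≡ p
        simp = solve-∀

      sum-mix : ∀ α β → sum (λ i → α * χ S₀ i + β * δ u i) ≡ α * size S₀ + β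
      sum-mix α β = trans (sum-linear α β (χ S₀) (δ u))
        (cong (λ z → α * size S₀ + z) (trans (cong (β *_) (size-single u)) (*-identityʳ β)))

      weight-mix : ∀ α β → weight (λ i → α * χ S₀ i + β * δ u i) ≡ α * ω + β * w u
      weight-mix α β = begin
        sum (λ i → w i * (α * χ S₀ i + β * δ u i))
          ≡⟨ sum-cong-≗ {n} (λ i → expand (w i) α β (χ S₀ i) (δ u i)) ⟩
        sum (λ i → α * (w i * χ S₀ i) + β * (δ u i * w i))
          ≡⟨ sum-linear α β (λ i → w i * χ S₀ i) (λ i → δ u i * w i) ⟩
        α * ω + β * sum (λ i → δ u i * w i)
          ≡⟨ cong (λ z → α * ω + β * z) (sum-δ u w) ⟩
        α * ω + β * w u ∎
        where
        open ≡-Reasoning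
        expand : ∀ x p q y z → x * (p * y + q * z) ≡ p * (x * y) + q * (z * x)
        expand = solve-∀

      surplus≡ : surplus X M ≡ M * (M * h + x * s)
      surplus≡ = trans (cong₂ (λ q z → D * q - a * M * z)
          (trans (B-cong X≡ X≡) (B-mix M x)) (trans (sum-cong-≗ {n} X≡) (sum-mix M x)))
        (simp D a M x (Q S₀) (deg S₀ u) (size S₀))
        where
        simp : ∀ d a m x q y n → d * (m * m * q + + 2 * (m * x) * y) - a * m * (m * n + x)
          ≡ m * (m * (d * q - a * n) + x * (+ 2 * d * y - a))
        simp = solve-∀

      weight-X : weight X ≡ M * ω + x * w u
      weight-X = trans (sum-cong-≗ {n} (λ i → cong (w i *_) (X≡ i))) (weight-mix M x)

      excess-S₁ : excess a S₁ ≡ h + s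
      excess-S₁ = trans (cong₂ (λ q z → D * q - a * z)
          (trans (B-cong χ-S₁ χ-S₁) (B-mix 1ℤ 1ℤ)) (trans (sum-cong-≗ {n} χ-S₁) (sum-mix 1ℤ 1ℤ)))
        (simp D a (Q S₀) (deg S₀ u) (size S₀))
        where
        simp : ∀ d a q y n → d * (1ℤ * 1ℤ * q + + 2 * (1ℤ * 1ℤ) * y) - a * (1ℤ * n + 1ℤ)
          ≡ (d * q - a * n) + (+ 2 * d * y - a)
        simp = solve-∀

      excess-W∖S₁ : excess b (W ∖ S₁) ≡ g - t
      excess-W∖S₁ = begin
        excess b (W ∖ S₁)
          ≡⟨ excess-complement S₁ S₁⊆W ⟩
        excess a S₁ - weight (χ S₁) + excess b W
          ≡⟨ cong₂ (λ e z → e - z + excess b W) excess-S₁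
               (trans (sum-cong-≗ {n} (λ i → cong (w i *_) (χ-S₁ i))) (weight-mix 1ℤ 1ℤ)) ⟩
        h + s - (1ℤ * ω + 1ℤ * w u) + excess b W
          ≡⟨ simp h s ω (w u) (excess b W) ⟩
        (h - ω + excess b W) - (w u - s)
          ≡⟨ cong (_- t) (excess-complement S₀ S₀⊆W) ⟨
        g - t ∎
        where
        open ≡-Reasoning
        simp : ∀ h s o v e → h + s - (1ℤ * o + 1ℤ * v) + e ≡ (h - o + e) - (v - s)
        simp = solve-∀

      -- An excess above `- β` does not exclude the empty set. If `t` is positive, however, `u` has
      -- a neighbour outside `S₀`, which stays behind when `u` leaves.
      outside-nonempty : 0ℤ ≤ b → 0ℤ < t → 1ℤ ≤ size (W ∖ S₁)
      outside-nonempty 0≤b 0<t = begin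
        1ℤ                        ≤⟨ <⇒1+≤ 0<deg ⟩
        deg (W ∖ S₀) u            ≤⟨ deg<size {W ∖ S₀} W∖S₀u ⟩
        size (W ∖ S₀) - 1ℤ        ≡⟨ cong (_- 1ℤ) (size-∖ W S₀ S₀⊆W) ⟩
        size W - size S₀ - 1ℤ     ≡⟨ simp (size W) (size S₀) ⟩
        size W - (1ℤ * size S₀ + 1ℤ) ≡⟨ cong (λ z → size W - z) (trans (sum-cong-≗ {n} χ-S₁) (sum-mix 1ℤ 1ℤ)) ⟨
        size W - size S₁          ≡⟨ size-∖ W S₁ S₁⊆W ⟨
        size (W ∖ S₁)             ∎
        where
        open ≤-Reasoning
        simp : ∀ p q → p - q - 1ℤ ≡ p - (1ℤ * q + 1ℤ)
        simp = solve-∀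
        W∖S₀u : (W ∖ S₀) u ≡ true
        W∖S₀u rewrite Wu | S₀u = refl
        t≡ : ∀ d a b x y → (+ 2 * d * x - (a + b) - (+ 2 * d * y - a)) + b ≡ + 2 * d * (x - y)
        t≡ = solve-∀
        0<deg : 0ℤ < deg (W ∖ S₀) u
        0<deg = subst (0ℤ <_) (sym (deg-∖ W S₀ S₀⊆W u))
          (pos-cancel (0≤+ 2 ⊗ 0≤D) (subst (0ℤ <_) (t≡ D a b (deg W u) (deg S₀ u)) (0<+ 0<t 0≤b)))

      inside-nonempty : 0ℤ ≤ a → 0ℤ < s → 1ℤ ≤ size S₀
      inside-nonempty 0≤a 0<s = ≤-trans (<⇒1+≤ 0<deg) (deg≤size S₀ u)
        where
        simp : ∀ x a → x - a + a ≡ x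
        simp = solve-∀
        0<deg : 0ℤ < deg S₀ u
        0<deg = pos-cancel (0≤+ 2 ⊗ 0≤D) (subst (0ℤ <_) (simp (+ 2 * D * deg S₀ u) a) (0<+ 0<s 0≤a))

      finish : ∀ {β U V ef eg} → 0ℤ ≤ a → 0ℤ ≤ b → 0ℤ < R → 0ℤ < V → 0ℤ ≤ β → (∀ i → InW i → 0ℤ < w i) →
        let ws = + 2 * D * (size W - 1ℤ) - (a + b) + 1ℤ in
        0ℤ < ef → 0ℤ < eg →
        ef ≤ + 4 * (D * (P * P) * Q W - a * R * (P * size W)) - D * y * (R * R) →
        eg ≤ + 4 * (D * ((R - P) * (R - P)) * Q W - b * R * ((R - P) * size W)) - D * y * (R * R) →
        + 4 * (R * R) * (U * U) * ws ≤ V * V * (ef + + 4 * (R * R) * β) →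
        + 4 * (R * R) * ((V - U) * (V - U)) * ws ≤ V * V * (eg + + 4 * (R * R) * β) →
        Split β
      finish {β} {U} {V} {ef} {eg} 0≤a 0≤b 0<R 0<V 0≤β 0<w 0<ef 0<eg ef≤ eg≤ c₁ c₂ =
        choose (place-last {M} {x} {h} {g} {s} {t} 0<M (0≤X u) (X≤M u) 0<s+t s+t<ws 0≤β 0<R 0<V 0<ef 0<eg F≥ G≥ c₁ c₂)
        where
        ws = + 2 * D * (size W - 1ℤ) - (a + b) + 1ℤ
        s+t≡ : s + t ≡ w u
        s+t≡ = simp s (w u)
          where
          simp : ∀ s v → s + (v - s) ≡ v
          simp = solve-∀
        0<s+t : 0ℤ < s + t
        0<s+t = subst (0ℤ <_) (sym s+t≡) (0<w u Wu)
        -- `ws` is one more than the weight of a vertex adjacent to all others in `W`.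
        s+t<ws : s + t < ws
        s+t<ws = subst (_< ws) (sym s+t≡) (1+≤⇒< (by-diff (+ 2 * D * (size W - 1ℤ - deg W u))
          (0≤+ 2 ⊗ 0≤D ⊗ 0≤- (deg<size {W} Wu)) (simp D (size W) (deg W u) (a + b))))
          where
          simp : ∀ d n x c → + 2 * d * (n - 1ℤ) - c + 1ℤ ≡ (1ℤ + (+ 2 * d * x - c)) + + 2 * d * (n - 1ℤ - x)
          simp = solve-∀
        f₀ = D * (P * P) * Q W - a * R * (P * size W)
        bound′ : (+ 4 * f₀ - D * y * (R * R)) * (M * M) ≤ + 4 * (R * R) * (M * (M * h + x * s))
        bound′ = subst₂ (λ p q → (+ 4 * p - D * y * (R * R)) * (M * M) ≤ + 4 * (R * R) * q)
          (surplus-initial P R) surplus≡ bound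
        F≥ : ef * M ≤ + 4 * (R * R) * (M * h + x * s)
        F≥ = cancel-pos M 0<M (by-diff
          ((+ 4 * (R * R) * (M * (M * h + x * s)) - (+ 4 * f₀ - D * y * (R * R)) * (M * M))
            + (+ 4 * f₀ - D * y * (R * R) - ef) * (M * M))
          (0≤- bound′ ⊕ 0≤- ef≤ ⊗ 0≤sq M)
          (simp M (M * h + x * s) (+ 4 * (R * R)) (+ 4 * f₀ - D * y * (R * R)) ef))
          where
          simp : ∀ m f r c e → m * (r * f) ≡ m * (e * m) + ((r * (m * f) - c * (m * m)) + (c - e) * (m * m))
          simp = solve-∀
        weight≡′ : (M * ω + x * w u) * R ≡ P * (+ 2 * D * Q W - (a + b) * size W) * M
        weight≡′ = trans (cong (_* R) (sym weight-X)) (trans weight≡ (cong (_* M) (weight-initial P)))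
        g₀ = D * ((R - P) * (R - P)) * Q W - b * R * ((R - P) * size W)
        -- Rounding preserves the weight, hence the difference of the two surpluses, so the slack
        -- `e₁` in the bound for the first side occurs for the second side as well.
        e₁ = + 4 * (R * R) * (M * (M * h + x * s)) - (+ 4 * f₀ - D * y * (R * R)) * (M * M)
        G≥ : eg * M ≤ + 4 * (R * R) * (M * g - x * t)
        G≥ = cancel-pos M 0<M (by-diff
          (e₁ + (+ 4 * g₀ - D * y * (R * R) - eg) * (M * M))
          (0≤- bound′ ⊕ 0≤- eg≤ ⊗ 0≤sq M)
          (begin
            M * (+ 4 * (R * R) * (M * g - x * t))
              ≡⟨ cong (λ g → M * (+ 4 * (R * R) * (M * g - x * t))) (excess-complement S₀ S₀⊆W) ⟩
            M * (+ 4 * (R * R) * (M * (h - ω + excess b W) - x * (w u - s)))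
              ≡⟨ isolate M R x h s ω (w u) (excess b W) ⟩
            + 4 * (R * R) * (M * (M * h + x * s)) - + 4 * (R * M) * ((M * ω + x * w u) * R) + + 4 * (R * R) * (M * M) * excess b W
              ≡⟨ cong (λ z → + 4 * (R * R) * (M * (M * h + x * s)) - + 4 * (R * M) * z + + 4 * (R * R) * (M * M) * excess b W) weight≡′ ⟩
            + 4 * (R * R) * (M * (M * h + x * s)) - + 4 * (R * M) * (P * (+ 2 * D * Q W - (a + b) * size W) * M)
              + + 4 * (R * R) * (M * M) * excess b W
              ≡⟨ collect M R P (+ 4 * (R * R) * (M * (M * h + x * s))) D a b (Q W) (size W) y eg ⟩
            M * (eg * M) + (e₁ + (+ 4 * g₀ - D * y * (R * R) - eg) * (M * M)) ∎))
          where
          open ≡-Reasoning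
          isolate : ∀ M R x h s o v e → M * (+ 4 * (R * R) * (M * (h - o + e) - x * (v - s)))
            ≡ + 4 * (R * R) * (M * (M * h + x * s)) - + 4 * (R * M) * ((M * o + x * v) * R) + + 4 * (R * R) * (M * M) * e
          isolate = solve-∀
          collect : ∀ M R P F D a b q n y e →
            F - + 4 * (R * M) * (P * (+ 2 * D * q - (a + b) * n) * M) + + 4 * (R * R) * (M * M) * (D * q - b * n)
            ≡ M * (e * M) + ((F - (+ 4 * (D * (P * P) * q - a * R * (P * n)) - D * y * (R * R)) * (M * M))
              + (+ 4 * (D * ((R - P) * (R - P)) * q - b * R * ((R - P) * n)) - D * y * (R * R) - e) * (M * M))
          collect = solve-∀
        choose : (- β < h × 0ℤ < g × (0ℤ < h ⊎ 0ℤ < s)) ⊎ (0ℤ < h + s × - β < g - t × (0ℤ < g - t ⊎ 0ℤ < t)) → Split β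
        choose (inj₁ (h> , 0<g , ne)) = record
          { S = S₀ ; T = W ∖ S₀ ; S⊆W = S₀⊆W ; T⊆W = ∖⊆ W S₀ ; disjoint = ∖-disjoint W S₀
          ; 1≤S = nonempty ne ; 1≤T = excess>0⇒1≤size {b} (W ∖ S₀) 0<g
          ; dense-S = h> ; dense-T = ≤-<-trans (neg-mono-≤ 0≤β) 0<g }
          where
          nonempty : 0ℤ < h ⊎ 0ℤ < s → 1ℤ ≤ size S₀
          nonempty (inj₁ 0<h) = excess>0⇒1≤size {a} S₀ 0<h
          nonempty (inj₂ 0<s) = inside-nonempty 0≤a 0<s
        choose (inj₂ (0<h+s , g-t> , ne)) = record
          { S = S₁ ; T = W ∖ S₁ ; S⊆W = S₁⊆W ; T⊆W = ∖⊆ W S₁ ; disjoint = ∖-disjoint W S₁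
          ; 1≤S = excess>0⇒1≤size {a} S₁ 0<S₁ ; 1≤T = nonempty ne
          ; dense-S = ≤-<-trans (neg-mono-≤ 0≤β) 0<S₁ ; dense-T = subst (- β <_) (sym excess-W∖S₁) g-t> }
          where
          0<S₁ : 0ℤ < excess a S₁
          0<S₁ = subst (0ℤ <_) (sym excess-S₁) 0<h+s
          nonempty : 0ℤ < g - t ⊎ 0ℤ < t → 1ℤ ≤ size (W ∖ S₁)
          nonempty (inj₁ 0<g-t) = excess>0⇒1≤size {b} (W ∖ S₁) (subst (0ℤ <_) (sym excess-W∖S₁) 0<g-t)
          nonempty (inj₂ 0<t)   = outside-nonempty 0≤b 0<t

  -- Lists and finite searches

  unique-resp-↭ : ∀ {A : Set} {xs ys : List A} → xs ↭ ys → Unique xs → Unique ys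
  unique-resp-↭ {A} p = Permₛ.Unique-resp-↭ (setoid A) (↭⇒↭ₛ p)

  allPairs-prefix : ∀ {A : Set} {R : A → A → Set} xs {c ys} →
    AllPairs R (xs ++ c ∷ ys) → AllPairs R (xs ++ c ∷ [])
  allPairs-prefix []       (_ ∷ _) = [] ∷ []
  allPairs-prefix (x ∷ xs) (r ∷ p) = All-++⁺ (All-++⁻ˡ xs r) (All.head (All-++⁻ʳ xs r) ∷ []) ∷ allPairs-prefix xs p

  linked-reroute : ∀ {A : Set} {R : A → A → Set} xs {c ys z} →
    Linked R (xs ++ c ∷ ys) → R c z → Linked R (xs ++ c ∷ z ∷ [])
  linked-reroute []            _       cz = cz ∷ [-]
  linked-reroute (x ∷ [])      (r ∷ _) cz = r ∷ cz ∷ [-]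
  linked-reroute (x ∷ y ∷ xs)  (r ∷ p) cz = r ∷ linked-reroute (y ∷ xs) p cz

  ∈-take-prefix : ∀ {A : Set} {c : A} m xs {ys} → c ∈ xs → length xs ℕ.≤ m → c ∈ take m (xs ++ ys)
  ∈-take-prefix (suc m) (x ∷ xs) (here e)   _          = here e
  ∈-take-prefix (suc m) (x ∷ xs) (there c∈) (ℕ.s≤s le) = there (∈-take-prefix m xs c∈ le)

  ∀-or : ∀ {n} {E : Set} {P : Fin n → Set} → (∀ i → E ⊎ P i) → E ⊎ (∀ i → P i)
  ∀-or {zero}  f = inj₂ λ ()
  ∀-or {suc n} f with f zero | ∀-or (λ i → f (suc i))
  ... | inj₁ e | _      = inj₁ e
  ... | inj₂ _ | inj₁ e = inj₁ e
  ... | inj₂ p | inj₂ q = inj₂ λ { zero → p ; (suc i) → q i }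

  does-true : ∀ {P : Set} (P? : Dec P) → P → does P? ≡ true
  does-true (yes _) _ = refl
  does-true (no ¬p) p = ⊥-elim (¬p p)

  true-does : ∀ {P : Set} (P? : Dec P) → does P? ≡ true → P
  true-does (yes p) _ = p

  -- Long cycles

  module Cycles {n} (adj : Fin n → Fin n → Bool)
    (adj-sym : ∀ x y → adj x y ≡ adj y x) (adj-irref : ∀ x → adj x x ≡ false) (ρ : ℕ) where

    open OnGraph adj adj-sym adj-irref
    open DecMembership (_≟_ {n}) using (_∈?_)

    V : Set
    V = Fin n

    Adj : V → V → Set
    Adj u v = adj u v ≡ true

    Adj-sym : ∀ {u v} → Adj u v → Adj v u
    Adj-sym {u} {v} e = trans (adj-sym v u) e

    Adj⇒≢ : ∀ {u v} → Adj u v → u ≢ v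
    Adj⇒≢ {u} e refl with () ← trans (sym e) (adj-irref u)

    -- `ρ` stands for r - 1. The head is repeated at the end only to state adjacency; the list
    -- itself has no repetition.
    data IsCycle : List V → Set where
      cycle : ∀ {x l} → Linked Adj (x ∷ l ++ x ∷ []) → Unique (x ∷ l) → suc ρ ℕ.≤ length (x ∷ l) → IsCycle (x ∷ l)

    CycleIn : (V → Set) → Set
    CycleIn P = ∃ λ c → IsCycle c × All P c

    module Longest (W : VSet) where

      InW : V → Set
      InW i = W i ≡ true

      record Path (p : List V) : Set where
        constructor path
        field
          linked : Linked Adj p
          unique : Unique p
          inside : All InW p

      close : ∀ {x} l₁ {c l₂} → Path (x ∷ l₁ ++ c ∷ l₂) → Adj c x → suc ρ ℕ.≤ suc (suc (length l₁)) → CycleIn InW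
      close {x} l₁ {c} (path lk un ins) cx long = x ∷ l₁ ++ c ∷ [] ,
        cycle (subst (λ l → Linked Adj (x ∷ l)) (sym (++-assoc l₁ (c ∷ []) (x ∷ []))) (linked-reroute (x ∷ l₁) lk cx))
          (allPairs-prefix (x ∷ l₁) un)
          (ℕ.≤-trans long (ℕ.≤-reflexive (cong suc (sym (trans (length-++ l₁) (ℕ.+-comm (length l₁) 1)))))) ,
        All-++⁺ {xs = x ∷ l₁} (All-++⁻ˡ (x ∷ l₁) ins) (All.head (All-++⁻ʳ (x ∷ l₁) ins) ∷ [])

      -- A lexicographic improvement, first in the length and then in the degree of the head. Both
      -- are bounded by `n`.
      Better : V → List V → Set
      Better x l = ∃ λ x′ → ∃ λ l′ → Path (x′ ∷ l′) ×
        (length l ℕ.< length l′ ⊎ (length l ≡ length l′ × deg W x < deg W x′))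

      extend : ∀ {x l} (x₀ : V) l₀ c → Path (x ∷ l) → InW c → Adj x c → c ∉ x ∷ l → length l₀ ≡ length l → Better x₀ l₀
      extend {x} {l} x₀ l₀ c (path lk un ins) Wc xc c∉ e = c , x ∷ l ,
        path (Adj-sym xc ∷ lk) (All.tabulate (λ { y∈ refl → c∉ y∈ }) ∷ un) (Wc ∷ ins) ,
        inj₁ (ℕ.s≤s (ℕ.≤-reflexive e))

      -- The heads of the rotations: if `a` precedes a neighbour `b` of `x`, then reversing the path
      -- up to `a` and using the edge x b gives a path that starts in `a`.
      preds : V → V → List V → List V
      preds x a [] = []
      preds x a (b ∷ bs) with adj x b
      ... | true  = a ∷ preds x b bs
      ... | false = preds x b bs

      preds-∈ : ∀ x a rem {z} → z ∈ preds x a rem → z ∈ a ∷ rem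
      preds-∈ x a (b ∷ bs) z∈ with adj x b | z∈
      ... | true  | here e   = here e
      ... | true  | there z∈ = there (preds-∈ x b bs z∈)
      ... | false | z∈       = there (preds-∈ x b bs z∈)

      preds-unique : ∀ x a rem → Unique (a ∷ rem) → Unique (preds x a rem)
      preds-unique x a [] _ = []
      preds-unique x a (b ∷ bs) (a∉ ∷ un) with adj x b
      ... | true  = All.tabulate (λ z∈ → All.lookup a∉ (preds-∈ x b bs z∈)) ∷ preds-unique x b bs un
      ... | false = preds-unique x b bs un

      preds-length : ∀ x a rem → + length (preds x a rem) ≡ sumOn (A x) rem
      preds-length x a [] = refl
      preds-length x a (b ∷ bs) with adj x b
      ... | true  = cong (λ z → 1ℤ + z) (preds-length x b bs)
      ... | false = trans (preds-length x b bs) (sym (+-identityˡ _))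

      module Examine {x : V} {l : List V} (P : Path (x ∷ l)) where

        VL : List V
        VL = take ρ (x ∷ l)

        Exit : Set
        Exit = CycleIn InW ⊎ Better x l

        record Good (z : V) : Set where
          field
            z∈VL  : z ∈ VL
            nbrs  : ∀ c → InW c × Adj z c → c ∈ VL
            deg≤  : deg W z ≤ deg W x

        head-nbrs : Exit ⊎ (∀ c → InW c × Adj x c → c ∈ l)
        head-nbrs = ∀-or check
          where
          check : ∀ c → Exit ⊎ (InW c × Adj x c → c ∈ l)
          check c with W c Bool.≟ true | adj x c Bool.≟ true | c ∈? (x ∷ l)
          ... | no ¬Wc | _      | _ = inj₂ λ (Wc , _) → ⊥-elim (¬Wc Wc)
          ... | yes _  | no ¬xc | _ = inj₂ λ (_ , xc) → ⊥-elim (¬xc xc)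
          ... | yes _  | yes xc | yes (here refl) = ⊥-elim (Adj⇒≢ xc refl)
          ... | yes _  | yes _  | yes (there c∈)  = inj₂ λ _ → c∈
          ... | yes Wc | yes xc | no c∉ = inj₁ (inj₂ (extend x l c P Wc xc c∉ refl))

        -- Rotation: the path is (x ∷ pre) ++ b ∷ bs, a ∷ acc lists x ∷ pre backwards,
        -- and x is adjacent to b, so a ∷ acc ++ b ∷ bs is a path as well.
        good : ∀ a acc pre b bs → x ∷ l ≡ (x ∷ pre) ++ b ∷ bs →
          (∀ {c} → c ∈ a ∷ acc → c ∈ x ∷ pre) → length pre ≡ length acc →
          Path (a ∷ acc ++ b ∷ bs) → Adj x b → Exit ⊎ Good a
        -- The edge x b closes a cycle on `length pre + 2` vertices. If this is too short, then `b`,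
        -- and with it the whole rotated part, lies among the first `ρ` vertices.
        good a acc pre b bs split ⊆pre len Pᵣ xb with suc ρ ℕ.≤? suc (suc (length pre))
        ... | yes long = inj₁ (inj₁ (close pre (subst Path split P) (Adj-sym xb) long))
        ... | no short with deg W a ≤? deg W x
        ...   | no deg≰ = inj₁ (inj₂ (a , acc ++ b ∷ bs , Pᵣ , inj₂ (len-l , ≰⇒> deg≰)))
          where
          len-l : length l ≡ length (acc ++ b ∷ bs)
          len-l = trans (ℕ.suc-injective (cong length split))
            (trans (length-++ pre) (trans (cong (ℕ._+ length (b ∷ bs)) len) (sym (length-++ acc))))
        ...   | yes deg≤ with ∀-or check
          where
          len-l : length l ≡ length (acc ++ b ∷ bs)
          len-l = trans (ℕ.suc-injective (cong length split))
            (trans (length-++ pre) (trans (cong (ℕ._+ length (b ∷ bs)) len) (sym (length-++ acc))))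
          pre≤ρ : length (x ∷ pre) ℕ.≤ ρ
          pre≤ρ = ℕ.<⇒≤ (ℕ.≤-pred (ℕ.≰⇒> short))
          -- The rotation only permutes `x ∷ pre`, so `c` has the same position on both paths. A
          -- position beyond `ρ` would close a long cycle with `a`.
          far : ∀ c → c ∈ b ∷ bs → Adj a c → Exit ⊎ c ∈ VL
          far c c∈ ac with ∈-∃++ c∈
          ... | l₁ , l₂ , eq with suc ρ ℕ.≤? suc (suc (length (acc ++ l₁)))
          ...   | yes long = inj₁ (inj₁ (close (acc ++ l₁)
                    (subst (λ k → Path (a ∷ k)) (trans (cong (acc ++_) eq) (sym (++-assoc acc l₁ (c ∷ l₂)))) Pᵣ) (Adj-sym ac) long))
          ...   | no short′ = inj₂ (subst (λ k → c ∈ take ρ k) (sym split′)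
                    (∈-take-prefix ρ ((x ∷ pre) ++ l₁ ++ c ∷ []) (∈-++⁺ʳ (x ∷ pre) (∈-++⁺ʳ l₁ (here refl))) len≤))
            where
            split′ : x ∷ l ≡ ((x ∷ pre) ++ l₁ ++ c ∷ []) ++ l₂
            split′ = trans split (trans (cong ((x ∷ pre) ++_) (trans eq (sym (++-assoc l₁ (c ∷ []) l₂))))
              (sym (++-assoc (x ∷ pre) (l₁ ++ c ∷ []) l₂)))
            len≤ : length ((x ∷ pre) ++ l₁ ++ c ∷ []) ℕ.≤ ρ
            len≤ = ℕ.≤-trans (ℕ.≤-reflexive (cong suc
              (trans (length-++ pre) (trans (cong₂ ℕ._+_ len (trans (length-++ l₁) (ℕ.+-comm (length l₁) 1)))
              (trans (ℕ.+-suc (length acc) (length l₁)) (cong suc (sym (length-++ acc)))))))) (ℕ.≤-pred (ℕ.≰⇒> short′))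
          check : ∀ c → Exit ⊎ (InW c × Adj a c → c ∈ VL)
          check c with W c Bool.≟ true | adj a c Bool.≟ true | c ∈? (a ∷ acc ++ b ∷ bs)
          ... | no ¬Wc | _      | _ = inj₂ λ (Wc , _) → ⊥-elim (¬Wc Wc)
          ... | yes _  | no ¬ac | _ = inj₂ λ (_ , ac) → ⊥-elim (¬ac ac)
          ... | yes Wc | yes ac | no c∉ = inj₁ (inj₂ (extend x l c Pᵣ Wc ac c∉ len-l))
          ... | yes Wc | yes ac | yes c∈ with ∈-++⁻ (a ∷ acc) c∈
          ...   | inj₁ c∈acc = inj₂ λ _ → subst (λ k → c ∈ take ρ k) (sym split) (∈-take-prefix ρ (x ∷ pre) (⊆pre c∈acc) pre≤ρ)
          ...   | inj₂ c∈rem with far c c∈rem ac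
          ...     | inj₁ e = inj₁ e
          ...     | inj₂ c∈VL = inj₂ λ _ → c∈VL
        ...     | inj₁ exit = inj₁ exit
        ...     | inj₂ nbrs = inj₂ record
          { z∈VL = subst (λ k → a ∈ take ρ k) (sym split)
                     (∈-take-prefix ρ (x ∷ pre) (⊆pre (here refl)) (ℕ.<⇒≤ (ℕ.≤-pred (ℕ.≰⇒> short))))
          ; nbrs = nbrs ; deg≤ = deg≤ }

        -- The reversed prefix is accumulated while walking along the path. `reroute` and `perm` say
        -- that it may replace the prefix, so no separate facts about reversal are needed.
        all-good : ∀ a acc pre rem → x ∷ l ≡ (x ∷ pre) ++ rem →
          (∀ {c} → c ∈ a ∷ acc → c ∈ x ∷ pre) → length pre ≡ length acc →
          (∀ {ys} → Linked Adj (x ∷ ys) → Linked Adj (a ∷ acc ++ ys)) → Linked Adj (a ∷ rem) →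
          x ∷ l ↭ a ∷ acc ++ rem → Exit ⊎ All Good (preds x a rem)
        all-good a acc pre [] _ _ _ _ _ _ = inj₂ []
        all-good a acc pre (b ∷ bs) split ⊆pre len reroute (ab ∷ lk) perm
          with all-good b (a ∷ acc) (pre ++ b ∷ []) bs
                 (trans split (cong (x ∷_) (sym (++-assoc pre (b ∷ []) bs))))
                 (λ { (here refl) → there (∈-++⁺ʳ pre (here refl)) ; (there c∈) → ∈-++⁺ˡ (⊆pre c∈) })
                 (trans (length-++ pre) (trans (ℕ.+-comm (length pre) 1) (cong suc len)))
                 (λ lk → Adj-sym ab ∷ reroute lk) lk
                 (↭-trans perm (shift b (a ∷ acc) bs))
        ... | inj₁ exit = inj₁ exit
        ... | inj₂ rest with adj x b in xb
        ...   | false = inj₂ rest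
        ...   | true with good a acc pre b bs split ⊆pre len
                       (path (reroute (xb ∷ lk)) (unique-resp-↭ perm (Path.unique P)) (All-resp-↭ perm (Path.inside P))) xb
        ...     | inj₁ exit = inj₁ exit
        ...     | inj₂ g = inj₂ (g ∷ rest)

      record Stuck : Set where
        field
          {x}       : V
          {l}       : List V
          P         : Path (x ∷ l)
          head-nbrs : ∀ c → InW c × Adj x c → c ∈ l
          all-good  : All (Examine.Good P) (preds x x l)

      examine : ∀ {x l} → Path (x ∷ l) → (CycleIn InW ⊎ Better x l) ⊎ Stuck
      examine {x} {l} P with Examine.head-nbrs P
          | Examine.all-good P x [] [] l refl (λ c∈ → c∈) refl (λ lk → lk) (Path.linked P) ↭-refl
      ... | inj₁ exit | _         = inj₁ exit
      ... | inj₂ _    | inj₁ exit = inj₁ exit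
      ... | inj₂ hn   | inj₂ ag   = inj₂ record { P = P ; head-nbrs = hn ; all-good = ag }

      unique⇒length≤n : ∀ {p : List V} → Unique p → length p ℕ.≤ n
      unique⇒length≤n {p} un = drop‿+≤+ (begin
        + length p              ≡⟨ *-identityʳ (+ length p) ⟨
        + length p * 1ℤ         ≡⟨ sumOn-const 1ℤ p ⟨
        sumOn (λ _ → 1ℤ) p      ≤⟨ sumOn≤sum (λ _ → 1ℤ) (λ _ → 0≤+ 1) un ⟩
        sum {n} (λ _ → 1ℤ)      ≡⟨ sum-1 n ⟩
        + n                     ∎)
        where open ≤-Reasoning

      -- `f₁` bounds the number of lengthenings and `f₂` the number of degree increases between
      -- them; after a lengthening `f₂` restarts at `suc n`.
      search : ∀ f₁ f₂ {x l} → Path (x ∷ l) → n ℕ.< f₁ ℕ.+ length (x ∷ l) → + n < + f₂ + deg W x → CycleIn InW ⊎ Stuck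
      search f₁ f₂ P b₁ b₂ with examine P
      ... | inj₂ st = inj₂ st
      ... | inj₁ (inj₁ c) = inj₁ c
      search zero f₂ P b₁ b₂ | inj₁ (inj₂ _) = ⊥-elim (ℕ.<⇒≱ b₁ (unique⇒length≤n (Path.unique P)))
      search (suc f₁) f₂ P b₁ b₂ | inj₁ (inj₂ (x′ , l′ , P′ , inj₁ longer)) =
        search f₁ (suc n) P′ (ℕ.≤-trans (ℕ.≤-trans b₁ (ℕ.≤-reflexive (sym (ℕ.+-suc f₁ _)))) (ℕ.+-monoʳ-≤ f₁ (ℕ.s≤s longer)))
          (1+≤⇒< (by-diff (deg W x′) (0≤deg W x′) refl))
      search (suc f₁) zero {x} P b₁ b₂ | inj₁ (inj₂ (x′ , l′ , P′ , inj₂ _)) =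
        ⊥-elim (<⇒≱ (subst (+ n <_) (+-identityˡ (deg W x)) b₂) (≤-trans (deg≤size W x) (size≤n W)))
      search (suc f₁) (suc f₂) {x} P b₁ b₂ | inj₁ (inj₂ (x′ , l′ , P′ , inj₂ (same , deg<))) =
        search (suc f₁) f₂ P′ (subst (λ k → n ℕ.< suc f₁ ℕ.+ suc k) same b₁)
          (<-≤-trans b₂ (by-diff (deg W x′ - (1ℤ + deg W x)) (0≤- (<⇒1+≤ deg<)) (simp (+ f₂) (deg W x) (deg W x′))))
        where
        simp : ∀ f d e → f + e ≡ (1ℤ + f) + d + (e - (1ℤ + d))
        simp = solve-∀

      module Removal (st : Stuck) where
        open Stuck st
        open Examine P using (VL; Good)

        S : VSet
        S i = does (i ∈? preds x x l)

        L : VSet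
        L i = does (i ∈? VL)

        good-at : ∀ i → S i ≡ true → Good i
        good-at i Si = All.lookup all-good (true-does (i ∈? preds x x l) Si)

        S⊆W : S ⊆ W
        S⊆W i Si = All.lookup (Path.inside P) (preds-∈ x x l (true-does (i ∈? preds x x l) Si))

        size-L : size L ≤ + ρ
        size-L = begin
          size L                     ≤⟨ sum≤sumOn (χ L) (0≤χ L) VL outside ⟩
          sumOn (χ L) VL             ≤⟨ sumOn-mono VL (λ {i} _ → ⟦ L i ⟧≤1) ⟩
          sumOn (λ _ → 1ℤ) VL        ≡⟨ trans (sumOn-const 1ℤ VL) (*-identityʳ (+ length VL)) ⟩
          + length VL                ≤⟨ +≤+ (ℕ.≤-trans (ℕ.≤-reflexive (length-take ρ (x ∷ l))) (ℕ.m⊓n≤m ρ _)) ⟩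
          + ρ                        ∎
          where
          open ≤-Reasoning
          outside : ∀ i → i ∉ VL → χ L i ≡ 0ℤ
          outside i i∉ with i ∈? VL
          ... | yes i∈ = ⊥-elim (i∉ i∈)
          ... | no _   = refl

        -- No neighbour of `x` can extend the path, so all of them lie on it, and distinct
        -- neighbours have distinct predecessors.
        deg-x≤ : deg W x ≤ size S
        deg-x≤ = begin
          deg W x                              ≤⟨ sum≤sumOn (λ j → A x j * χ W j) (λ j → 0≤A x j ⊗ 0≤χ W j) l outside ⟩
          sumOn (λ j → A x j * χ W j) l        ≤⟨ sumOn-mono l (λ {j} _ → drop-χ j) ⟩
          sumOn (A x) l                        ≡⟨ preds-length x x l ⟨
          + length (preds x x l)               ≡⟨ trans (sym (*-identityʳ _)) (sym (sumOn-const 1ℤ (preds x x l))) ⟩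
          sumOn (λ _ → 1ℤ) (preds x x l)       ≤⟨ sumOn-mono (preds x x l) (λ {i} i∈ → ≤-reflexive (cong ⟦_⟧ (sym (does-true (i ∈? preds x x l) i∈)))) ⟩
          sumOn (χ S) (preds x x l)            ≤⟨ sumOn≤sum (χ S) (0≤χ S) (preds-unique x x l (Path.unique P)) ⟩
          size S                               ∎
          where
          open ≤-Reasoning
          outside : ∀ j → j ∉ l → A x j * χ W j ≡ 0ℤ
          outside j j∉ with adj x j in xj | W j in Wj
          ... | true  | true  = ⊥-elim (j∉ (head-nbrs j (Wj , xj)))
          ... | true  | false = refl
          ... | false | true  = refl
          ... | false | false = refl
          drop-χ : ∀ j → A x j * χ W j ≤ A x j
          drop-χ j with W j
          ... | true  = ≤-reflexive (*-identityʳ _)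
          ... | false = subst (_≤ A x j) (sym (*-zeroʳ (A x j))) (0≤A x j)

        -- The neighbours of `i` lie in `L`, and `S` is contained in `L`.
        outer-deg : ∀ i → S i ≡ true → deg (W ∖ S) i ≤ size L - size S
        outer-deg i Si = begin
          sum (λ j → A i j * χ (W ∖ S) j)               ≤⟨ sum-mono le ⟩
          sum (λ j → 1ℤ * χ L j + (- 1ℤ) * χ S j)       ≡⟨ sum-linear 1ℤ (- 1ℤ) (χ L) (χ S) ⟩
          1ℤ * size L + (- 1ℤ) * size S                 ≡⟨ simp (size L) (size S) ⟩
          size L - size S                               ∎
          where
          open ≤-Reasoning
          simp : ∀ a b → 1ℤ * a + (- 1ℤ) * b ≡ a - b
          simp = solve-∀
          nonneg : ∀ p → 0ℤ ≤ 1ℤ * ⟦ p ⟧ + (- 1ℤ) * 0ℤ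
          nonneg true  = 0≤+ 1
          nonneg false = 0≤+ 0
          le : ∀ j → A i j * χ (W ∖ S) j ≤ 1ℤ * χ L j + (- 1ℤ) * χ S j
          le j with S j in Sj
          ... | true rewrite does-true (j ∈? VL) (Good.z∈VL (good-at j Sj)) | Bool.∧-zeroʳ (W j) = ≤-reflexive (*-zeroʳ (A i j))
          ... | false with W j in Wj | adj i j in ij
          ...   | true  | true  rewrite does-true (j ∈? VL) (Good.nbrs (good-at i Si) j (Wj , ij)) = ≤-refl
          ...   | true  | false = nonneg (L j)
          ...   | false | true  = nonneg (L j)
          ...   | false | false = nonneg (L j)

        -- A vertex of `S` contributes its degree in `W` plus its degree into the rest. The first is
        -- at most |S|, the second at most |L| - |S|, and |L| ≤ ρ.
        Q-loss : Q W ≤ Q (W ∖ S) + + ρ * size S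
        Q-loss = by-diff (+ ρ * size S - (+ 2 * B (χ S) (χ W) - Q S)) (0≤- touching)
          (trans (cong (_+ + ρ * size S) (Q-∖ W S S⊆W)) (simp (Q W) (B (χ S) (χ W)) (Q S) (+ ρ * size S)))
          where
          simp : ∀ q b s r → q - + 2 * b + s + r ≡ q + (r - (+ 2 * b - s))
          simp = solve-∀
          at : ∀ i → + 2 * (χ S i * deg W i) + (- 1ℤ) * (χ S i * deg S i) ≤ + ρ * χ S i
          at i with S i in Si
          ... | false = ≤-reflexive (trans (zeros (deg W i) (deg S i)) (sym (*-zeroʳ (+ ρ))))
            where
            zeros : ∀ x y → + 2 * (0ℤ * x) + (- 1ℤ) * (0ℤ * y) ≡ 0ℤ
            zeros = solve-∀
          ... | true = by-diff
            ((deg W x - deg W i) + (size S - deg W x) + (size L - size S - deg (W ∖ S) i) + (+ ρ - size L))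
            (0≤- (Good.deg≤ (good-at i Si)) ⊕ 0≤- deg-x≤ ⊕ 0≤- (outer-deg i Si) ⊕ 0≤- size-L)
            (trans (arith (+ ρ) (deg W x) (deg W i) (deg S i) (size S) (size L))
              (cong (λ z → + 2 * (1ℤ * deg W i) + (- 1ℤ) * (1ℤ * deg S i)
                 + ((deg W x - deg W i) + (size S - deg W x) + (size L - size S - z) + (+ ρ - size L)))
                (sym (deg-∖ W S S⊆W i))))
            where
            arith : ∀ r dx di si s l → r * 1ℤ ≡ + 2 * (1ℤ * di) + (- 1ℤ) * (1ℤ * si)
              + ((dx - di) + (s - dx) + (l - s - (di - si)) + (r - l))
            arith = solve-∀
          touching : + 2 * B (χ S) (χ W) - Q S ≤ + ρ * size S
          touching = begin
            + 2 * B (χ S) (χ W) - Q S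
              ≡⟨ simp′ (B (χ S) (χ W)) (Q S) ⟩
            + 2 * B (χ S) (χ W) + (- 1ℤ) * Q S
              ≡⟨ sum-linear (+ 2) (- 1ℤ) (λ i → χ S i * deg W i) (λ i → χ S i * deg S i) ⟨
            sum (λ i → + 2 * (χ S i * deg W i) + (- 1ℤ) * (χ S i * deg S i))
              ≤⟨ sum-mono at ⟩
            sum (λ i → + ρ * χ S i)
              ≡⟨ *-distribˡ-sum (+ ρ) (χ S) ⟨
            + ρ * size S ∎
            where
            open ≤-Reasoning
            simp′ : ∀ b q → + 2 * b - q ≡ + 2 * b + (- 1ℤ) * q
            simp′ = solve-∀

        S≤ρ : size S ≤ + ρ
        S≤ρ = ≤-trans (size-mono {S} {L} (λ i Si → does-true (i ∈? VL) (Good.z∈VL (good-at i Si)))) size-L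

    erdős-gallai : 2 ℕ.≤ ρ → ∀ fuel W → size W ≤ + fuel → 1ℤ ≤ size W → + ρ * size W ≤ Q W →
      CycleIn (λ i → W i ≡ true)
    erdős-gallai 2≤ρ zero W ≤fuel 1≤ dense with +≤+ () ← ≤-trans 1≤ ≤fuel
    erdős-gallai 2≤ρ (suc fuel) W ≤fuel 1≤ dense
      -- All that is used of the core is that `x` has positive degree, so that `S` is nonempty and
      -- the induction advances.
      with core {+ ρ} {1ℤ} 0<ρ (0≤+ 1) (suc fuel) W ≤fuel 1≤ (≤-trans dense (≤-reflexive (sym (*-identityˡ (Q W)))))
      where 0<ρ = +<+ (ℕ.≤-trans (ℕ.s≤s ℕ.z≤n) 2≤ρ)
    ... | W′ , W′⊆W , 1≤′ , dense′ , highdeg with inhabited {W′} 1≤′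
    ...   | u , W′u with Longest.search W′ n (suc n) (Longest.path {W = W′} {u ∷ []} [-] ([] ∷ []) (W′u ∷ [])) (ℕ.≤-reflexive (ℕ.+-comm 1 n))
                           (1+≤⇒< (by-diff (deg W′ u) (0≤deg W′ u) refl))
    ...     | inj₁ (c , cyc , ins) = c , cyc , All.map (W′⊆W _) ins
    ...     | inj₂ st =
      let c , cyc , ins = erdős-gallai 2≤ρ fuel (W′ ∖ S) size≤ 1≤″ dense″
      in c , cyc , All.map (λ {i} e → W′⊆W i (∖⊆ W′ S i e)) ins
      where
      open Longest W′
      open Removal st
      open Stuck st using (x; P)
      0<deg-x : 0ℤ < deg W′ x
      0<deg-x = pos-cancel (0≤+ 2 ⊗ 0≤+ 1) (≤-<-trans (0≤+ ρ) (highdeg x (All.head (Path.inside P))))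
      1≤S : 1ℤ ≤ size S
      1≤S = ≤-trans (<⇒1+≤ 0<deg-x) deg-x≤
      sizeEq : size (W′ ∖ S) ≡ size W′ - size S
      sizeEq = size-∖ W′ S S⊆W
      size≤ : size (W′ ∖ S) ≤ + fuel
      size≤ = subst (_≤ + fuel) (sym sizeEq)
        (by-diff ((+ suc fuel - size W) + (size W - size W′) + (size S - 1ℤ))
          (0≤- ≤fuel ⊕ 0≤- (size-mono {W′} {W} W′⊆W) ⊕ 0≤- 1≤S) (simp (+ fuel) (size W) (size W′) (size S)))
        where
        simp : ∀ f w v s → f ≡ (v - s) + (((1ℤ + f) - w) + (w - v) + (s - 1ℤ))
        simp = solve-∀
      dense″ : + ρ * size (W′ ∖ S) ≤ Q (W′ ∖ S)
      dense″ = subst (λ z → + ρ * z ≤ Q (W′ ∖ S)) (sym sizeEq)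
        (by-diff ((1ℤ * Q W′ - + ρ * size W′) + (Q (W′ ∖ S) + + ρ * size S - Q W′)) (0≤- dense′ ⊕ 0≤- Q-loss)
          (simp (+ ρ) (size W′) (size S) (Q W′) (Q (W′ ∖ S))))
        where
        simp : ∀ r w s q q′ → q′ ≡ r * (w - s) + ((1ℤ * q - r * w) + (q′ + r * s - q))
        simp = solve-∀
      -- If nothing were left, then |W′| ≤ |S| ≤ ρ, and Q W′ ≤ |W′| (|W′| - 1) would be below ρ
      -- |W′|.
      1≤″ : 1ℤ ≤ size (W′ ∖ S)
      1≤″ with 1ℤ ≤? size (W′ ∖ S)
      ... | yes p = p
      ... | no ¬p = ⊥-elim (<⇒≱ (1+≤⇒< (≤-refl {1ℤ})) 1≤0)
        where
        W′≤S : size W′ ≤ size S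
        W′≤S = by-diff (0ℤ - (size W′ - size S)) (0≤- (subst (_≤ 0ℤ) sizeEq (<1+⇒≤ {j = 0ℤ} (≰⇒> ¬p)))) (simp (size W′) (size S))
          where
          simp : ∀ w s → s ≡ w + (0ℤ - (w - s))
          simp = solve-∀
        1≤0 : 1ℤ ≤ 0ℤ
        1≤0 = by-diff ((size W′ - 1ℤ) + (size W′ * (size W′ - 1ℤ) - Q W′) + (1ℤ * Q W′ - + ρ * size W′) + size W′ * (+ ρ - size W′))
          (0≤- 1≤′ ⊕ 0≤- (Q≤ W′) ⊕ 0≤- dense′ ⊕ 0≤size W′ ⊗ 0≤- (≤-trans W′≤S S≤ρ)) (simp (size W′) (Q W′) (+ ρ))
          where
          simp : ∀ w q r → 0ℤ ≡ 1ℤ + ((w - 1ℤ) + (w * (w - 1ℤ) - q) + (1ℤ * q - r * w) + w * (r - w))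
          simp = solve-∀

  -- Disjoint cycles and the halving step

  half : ∀ {n} → Matrix n → ℤ
  half {zero}  K = 0ℤ
  half {suc n} K = sum (λ j → K zero (suc j)) + half (λ i j → K (suc i) (suc j))

  sum-symmetric : ∀ {n} (K : Matrix n) → (∀ i j → K i j ≡ K j i) → (∀ i → K i i ≡ 0ℤ) →
    sum (λ i → sum (λ j → K i j)) ≡ + 2 * half K
  sum-symmetric {zero}  K _ _ = refl
  sum-symmetric {suc n} K K-sym K-diag = begin
    (K zero zero + r) + sum (λ i → K (suc i) zero + sum (λ j → K (suc i) (suc j)))
      ≡⟨ cong₂ (λ d z → (d + r) + z) (K-diag zero)
           (∑-distrib-+ (λ i → K (suc i) zero) (λ i → sum (λ j → K (suc i) (suc j)))) ⟩
    (0ℤ + r) + (sum (λ i → K (suc i) zero) + sum (λ i → sum (λ j → K (suc i) (suc j))))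
      ≡⟨ cong₂ (λ c z → (0ℤ + r) + (c + z)) (sum-cong-≗ {n} (λ i → K-sym (suc i) zero))
           (sum-symmetric (λ i j → K (suc i) (suc j)) (λ i j → K-sym (suc i) (suc j)) (λ i → K-diag (suc i))) ⟩
    (0ℤ + r) + (r + + 2 * half (λ i j → K (suc i) (suc j)))
      ≡⟨ simp r (half (λ i j → K (suc i) (suc j))) ⟩
    + 2 * half K ∎
    where
    open ≡-Reasoning
    r = sum (λ j → K zero (suc j))
    simp : ∀ r h → (0ℤ + r) + (r + + 2 * h) ≡ + 2 * (r + h)
    simp = solve-∀

  allPairs-across : ∀ {A : Set} {R : A → A → Set} xs {ys x y} → AllPairs R (xs ++ ys) → x ∈ xs → y ∈ ys → R x y
  allPairs-across (x ∷ xs) (r ∷ _) (here refl) y∈ = All.lookup r (∈-++⁺ʳ xs y∈)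
  allPairs-across (x ∷ xs) (_ ∷ p) (there x∈)  y∈ = allPairs-across xs p x∈ y∈

  linked-snoc : ∀ {A : Set} {R : A → A → Set} {z} y l → Linked R (y ∷ l) → All (λ v → R v z) (y ∷ l) → Linked R (y ∷ l ++ z ∷ [])
  linked-snoc y []       _        (yz ∷ _) = yz ∷ [-]
  linked-snoc y (y′ ∷ l) (r ∷ lk) (_ ∷ rs) = r ∷ linked-snoc y′ l lk rs

  module Systems {n} (adj : Fin n → Fin n → Bool)
    (adj-sym : ∀ x y → adj x y ≡ adj y x) (adj-irref : ∀ x → adj x x ≡ false) (ρ : ℕ) (2≤ρ : 2 ℕ.≤ ρ) where

    open OnGraph adj adj-sym adj-irref
    open Cycles adj adj-sym adj-irref ρ

    -- Disjointness is carried by the predicate: the cycles after `c` must avoid `c`. This is why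
    -- `System` is indexed by a predicate.
    data System : ℕ → (V → Set) → Set₁ where
      nil  : ∀ {P} → System 0 P
      cons : ∀ {k P} c → IsCycle c → All P c → System k (λ v → P v × v ∉ c) → System (suc k) P

    System-mono : ∀ {k P P′} → (∀ v → P v → P′ v) → System k P → System k P′
    System-mono P⊆ nil = nil
    System-mono P⊆ (cons c cyc ins rest) =
      cons c cyc (All.map (P⊆ _) ins) (System-mono (λ v (Pv , v∉) → P⊆ v Pv , v∉) rest)

    System-∪ : ∀ {k l P P₁ P₂} → System k P₁ → System l P₂ → (∀ v → P₁ v → P v) → (∀ v → P₂ v → P v) →
      (∀ v → P₁ v → P₂ v → ⊥) → System (k ℕ.+ l) P
    System-∪ nil s₂ _ ⊆₂ _ = System-mono ⊆₂ s₂
    System-∪ (cons c cyc ins rest) s₂ ⊆₁ ⊆₂ disj = cons c cyc (All.map (⊆₁ _) ins)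
      (System-∪ rest s₂ (λ v (P₁v , v∉) → ⊆₁ v P₁v , v∉)
        (λ v P₂v → ⊆₂ v P₂v , λ v∈ → disj v (All.lookup ins v∈) P₂v)
        (λ v (P₁v , _) → disj v P₁v))

    clique-cycle : ∀ c → AllPairs Adj c → Unique c → suc ρ ℕ.≤ length c → IsCycle c
    clique-cycle (x ∷ [])    _ _  long = ⊥-elim (ℕ.<⇒≱ 2≤ρ (ℕ.≤-trans (ℕ.≤-pred long) ℕ.z≤n))
    clique-cycle (x ∷ y ∷ l) ((xy ∷ xl) ∷ ap) un long =
      cycle (xy ∷ linked-snoc y l (AllPairs⇒Linked ap) (All.map Adj-sym (xy ∷ xl))) un long

    clique-system : ∀ k {P} L → AllPairs Adj L → Unique L → All P L → k ℕ.* suc ρ ℕ.≤ length L → System k P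
    clique-system zero    L _ _ _ _ = nil
    clique-system (suc k) {P} L ap un ins long = cons (take (suc ρ) L)
      (clique-cycle _ (AllPairs-take⁺ (suc ρ) ap) (AllPairs-take⁺ (suc ρ) un)
        (ℕ.≤-reflexive (sym (trans (length-take (suc ρ) L) (ℕ.m≤n⇒m⊓n≡m (ℕ.≤-trans (ℕ.m≤m+n (suc ρ) _) long))))))
      (All-take⁺ (suc ρ) ins)
      (clique-system k (drop (suc ρ) L) (AllPairs-drop⁺ (suc ρ) ap) (AllPairs-drop⁺ (suc ρ) un)
        (All.zip (All-drop⁺ (suc ρ) ins , All.tabulate (λ y∈ y∈′ →
          allPairs-across (take (suc ρ) L) (subst Unique (sym (take++drop≡id (suc ρ) L)) un) y∈′ y∈ refl)))
        (ℕ.≤-trans (ℕ.≤-reflexive (sym (ℕ.m+n∸m≡n (suc ρ) _)))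
          (ℕ.≤-trans (ℕ.∸-monoˡ-≤ (suc ρ) long) (ℕ.≤-reflexive (sym (length-drop (suc ρ) L))))))

    -- Needed for triangles, where it makes the excess a multiple of 6.
    Q-even : ∀ S → ∃ λ e → Q S ≡ + 2 * e
    Q-even S = half (λ i j → χ S i * (A i j * χ S j)) ,
      trans (sum-cong-≗ {n} (λ i → *-distribˡ-sum (χ S i) (λ j → A i j * χ S j)))
        (sum-symmetric _ (λ i j → trans (cong (λ k → χ S i * (k * χ S j)) (A-sym i j)) (swap (χ S i) (A j i) (χ S j)))
          (λ i → trans (cong (λ k → χ S i * (k * χ S i)) (A-diag i)) (zeros (χ S i))))
      where
      swap : ∀ x k y → x * (k * y) ≡ y * (k * x)
      swap = solve-∀
      zeros : ∀ x → x * (0ℤ * x) ≡ 0ℤ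
      zeros = solve-∀

    r : ℤ
    r = + suc ρ

    -- For k = 1 this is 3 (r - 1), three times the Erdős-Gallai bound. The threshold of a sum
    -- exceeds the sum of the thresholds by r + 3, and this gain pays for the rounding.
    threshold : ℕ → ℤ
    threshold k = + 4 * r * + k - r - + 3

    Dense : ℕ → VSet → Set
    Dense k W = 1ℤ ≤ size W × threshold k * size W ≤ + 3 * Q W

    record Halves (k₁ k₂ : ℕ) (W : VSet) : Set where
      field
        S T      : VSet
        S⊆W      : S ⊆ W
        T⊆W      : T ⊆ W
        disjoint : ∀ i → S i ≡ true → T i ≡ true → ⊥
        dense-S  : Dense k₁ S
        dense-T  : Dense k₂ T

    module Attempt (k₁ k₂ : ℕ) (1≤k₁ : 1 ℕ.≤ k₁) (1≤k₂ : 1 ℕ.≤ k₂) (W : VSet)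
      (dense : Dense (k₁ ℕ.+ k₂) W) (core-W : Core (threshold (k₁ ℕ.+ k₂)) (+ 3) W) where

      a b κ N : ℤ
      a = threshold k₁
      b = threshold k₂
      κ = + k₁ + + k₂
      N = size W

      0≤threshold : ∀ {k} → 1 ℕ.≤ k → 0ℤ ≤ threshold k
      0≤threshold {suc k} _ = subst (0ℤ ≤_) (simp (+ ρ) (+ k)) (0≤+ 3 ⊗ 0≤+ ρ ⊕ 0≤+ 4 ⊗ (0≤+ 1 ⊕ 0≤+ ρ) ⊗ 0≤+ k)
        where
        simp : ∀ ρ k → + 3 * ρ + + 4 * (1ℤ + ρ) * k ≡ + 4 * (1ℤ + ρ) * (1ℤ + k) - (1ℤ + ρ) - + 3
        simp = solve-∀

      threshold-+ : threshold (k₁ ℕ.+ k₂) ≡ a + b + (r + + 3)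
      threshold-+ = simp r (+ k₁) (+ k₂)
        where
        simp : ∀ r x y → + 4 * r * (x + y) - r - + 3 ≡ (+ 4 * r * x - r - + 3) + (+ 4 * r * y - r - + 3) + (r + + 3)
        simp = solve-∀

      module Sp = Splitting adj adj-sym adj-irref (+ 3) a b (0≤+ 3) W

      0<w : ∀ i → W i ≡ true → 0ℤ < Sp.w i
      0<w i Wi = i<j⇒0<j-i (≤-<-trans
        (by-diff (r + + 3) (0≤+ (suc ρ) ⊕ 0≤+ 3) threshold-+) (core-W i Wi))

      y : ℕ
      y = ℕ.pred ((k₁ ℕ.+ k₂) ℕ.* suc ρ)

      suc-y : suc y ≡ (k₁ ℕ.+ k₂) ℕ.* suc ρ
      suc-y = ℕ.suc-pred ((k₁ ℕ.+ k₂) ℕ.* suc ρ) {{ℕ.m*n≢0 (k₁ ℕ.+ k₂) (suc ρ) {{ℕ.>-nonZero (ℕ.≤-trans 1≤k₁ (ℕ.m≤m+n k₁ k₂))}}}}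

      y≡ : + y ≡ κ * r - 1ℤ
      y≡ = trans (simp (+ y)) (cong (_- 1ℤ) (trans (cong +_ suc-y) (pos-* (k₁ ℕ.+ k₂) (suc ρ))))
        where
        simp : ∀ y → y ≡ (1ℤ + y) - 1ℤ
        simp = solve-∀

      -- A strict upper bound for all weights, from degrees at most N - 1.
      ws : ℤ
      ws = + 6 * (N - 1ℤ) - (a + b) + 1ℤ

      0<ws : 0ℤ < ws
      0<ws with inhabited {W} (proj₁ dense)
      ... | u , Wu = <-≤-trans (0<w u Wu) (by-diff (+ 6 * (N - 1ℤ - deg W u) + 1ℤ)
        (0≤+ 6 ⊗ 0≤- (deg<size {W} Wu) ⊕ 0≤+ 1) (simp N (deg W u) (a + b)))
        where
        simp : ∀ n d c → + 6 * (n - 1ℤ) - c + 1ℤ ≡ + 6 * d - c + (+ 6 * (n - 1ℤ - d) + 1ℤ)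
        simp = solve-∀

      -- The parameters left to choose: the initial fraction P / R, the number q = U / V₀ used for
      -- the last vertex, the granularity `β`, and the surpluses `ef` and `eg` guaranteed after
      -- rounding, in units of 1 / (4 R²).
      attempt : ∀ {P R U V₀ β ef eg} → 0ℤ < R → 0ℤ ≤ P → P ≤ R → 0ℤ < V₀ → 0ℤ ≤ β → 0ℤ < ef → 0ℤ < eg →
        ef ≤ + 4 * (P * P * (threshold (k₁ ℕ.+ k₂) * N) - a * R * (P * N)) - + 3 * (κ * r - 1ℤ) * (R * R) →
        eg ≤ + 4 * ((R - P) * (R - P) * (threshold (k₁ ℕ.+ k₂) * N) - b * R * ((R - P) * N)) - + 3 * (κ * r - 1ℤ) * (R * R) →
        + 4 * (R * R) * (U * U) * ws ≤ V₀ * V₀ * (ef + + 4 * (R * R) * β) →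
        + 4 * (R * R) * ((V₀ - U) * (V₀ - U)) * ws ≤ V₀ * V₀ * (eg + + 4 * (R * R) * β) →
        (∀ {k} S → 1 ℕ.≤ k → - β < + 3 * Q S - threshold k * size S → threshold k * size S ≤ + 3 * Q S) →
        System (k₁ ℕ.+ k₂) (λ i → W i ≡ true) ⊎ Halves k₁ k₂ W
      attempt {P} {R} {U} {V₀} {β} {ef} {eg} 0<R 0≤P P≤R 0<V 0≤β 0<ef 0<eg ef≤ eg≤ c₁ c₂ granular =
        Sum.map from-clique from-rounded (Sp.rounded y 0<R 0≤P P≤R (inhabited {W} (proj₁ dense)) 0<w)
        where
        from-clique : (∃ λ L → Sp.Clique L × suc y ℕ.≤ length L) → System (k₁ ℕ.+ k₂) (λ i → W i ≡ true)
        from-clique (L , (un , ins , ap) , long) = clique-system (k₁ ℕ.+ k₂) L ap un ins (subst (ℕ._≤ length L) suc-y long)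
        raise : ∀ {e} c p d → e ≤ + 4 * (p * (threshold (k₁ ℕ.+ k₂) * N) - c) - + 3 * (κ * r - 1ℤ) * d → 0ℤ ≤ p →
          e ≤ + 4 * (+ 3 * p * Q W - c) - + 3 * + y * d
        raise c p d e≤ 0≤p = ≤-trans e≤ (by-diff (+ 4 * (p * (+ 3 * Q W - threshold (k₁ ℕ.+ k₂) * N)))
          (0≤+ 4 ⊗ (0≤p ⊗ 0≤- (proj₂ dense)))
          (trans (cong (λ z → + 4 * (+ 3 * p * Q W - c) - + 3 * z * d) y≡)
            (simp p (Q W) c (κ * r - 1ℤ) d (threshold (k₁ ℕ.+ k₂) * N))))
          where
          simp : ∀ p q c z d t → + 4 * (+ 3 * p * q - c) - + 3 * z * d
            ≡ (+ 4 * (p * t - c) - + 3 * z * d) + + 4 * (p * (+ 3 * q - t))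
          simp = solve-∀
        from-rounded : Sp.Rounded P R (+ y) → Halves k₁ k₂ W
        from-rounded rd = record
          { S = S ; T = T ; S⊆W = S⊆W ; T⊆W = T⊆W ; disjoint = disjoint
          ; dense-S = 1≤S , granular S 1≤k₁ dense-S ; dense-T = 1≤T , granular T 1≤k₂ dense-T }
          where
          open Sp.Split (Sp.FromRounded.finish rd {β} {U} {V₀} {ef} {eg} (0≤threshold 1≤k₁) (0≤threshold 1≤k₂) 0<R 0<V 0≤β 0<w 0<ef 0<eg
            (raise (a * R * (P * N)) (P * P) (R * R) ef≤ (0≤sq P))
            (raise (b * R * ((R - P) * N)) ((R - P) * (R - P)) (R * R) eg≤ (0≤sq (R - P))) c₁ c₂)

  -- Choice of the parameters for cycles of order at least four

  0<suc : ∀ m → 0ℤ < + suc m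
  0<suc m = +<+ (ℕ.s≤s ℕ.z≤n)

  0<≡ : ∀ {i} c d → 0ℤ < c → 0ℤ ≤ d → i ≡ c + d → 0ℤ < i
  0<≡ c d 0<c 0≤d refl = 0<+ 0<c 0≤d

  module Long {n} (adj : Fin n → Fin n → Bool)
    (adj-sym : ∀ x y → adj x y ≡ adj y x) (adj-irref : ∀ x → adj x x ≡ false) (ρ : ℕ) (3≤ρ : 3 ℕ.≤ ρ) where

    open OnGraph adj adj-sym adj-irref
    open Systems adj adj-sym adj-irref ρ (ℕ.≤-trans (ℕ.n≤1+n 2) 3≤ρ)

    -- In terms of `slack` instead of `r` the polynomials below have nonnegative coefficients.
    slack : ℤ
    slack = r - + 4

    0≤slack : 0ℤ ≤ slack
    0≤slack = 0≤- (+≤+ (ℕ.s≤s 3≤ρ))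

    granular : ∀ {k} S → 1 ℕ.≤ k → - 1ℤ < + 3 * Q S - threshold k * size S → threshold k * size S ≤ + 3 * Q S
    granular S _ lt = 0≤i-j⇒j≤i (<⇒1+≤ lt)

    -- The initial fraction is k₁ / k, for which the two sides have the same surplus E;
    -- accordingly q = 1/2.
    halve-even : ∀ m W → Dense (suc m ℕ.+ suc m) W → Core (threshold (suc m ℕ.+ suc m)) (+ 3) W →
      System (suc m ℕ.+ suc m) (λ i → W i ≡ true) ⊎ Halves (suc m) (suc m) W
    halve-even m W dense core-W =
      attempt {+ suc m} {κ} {1ℤ} {+ 2} {1ℤ} {E} {E} (0<suc _) (0≤+ (suc m)) (+≤+ (ℕ.m≤m+n (suc m) (suc m)))
        (0<suc 1) (0≤+ 1) 0<E 0<E (≤-reflexive (ef≡ N r μ)) (≤-reflexive (eg≡ N r μ))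
        (by-diff D 0≤D (c₁≡ N r μ)) (by-diff D 0≤D (c₂≡ N r μ)) granular
      where
      open Attempt (suc m) (suc m) (ℕ.s≤s ℕ.z≤n) (ℕ.s≤s ℕ.z≤n) W dense core-W
      μ = + m
      0≤c = 0≤+ (suc m)
      -- If 3 Q W is just the threshold times N, each side starts with surplus (r + 3) k₁ k₂ N. The
      -- subtracted term is the cost of rounding fewer than k r fractional vertices.
      E = + 4 * (r + + 3) * ((1ℤ + μ) * (1ℤ + μ)) * N - + 3 * (κ * r - 1ℤ) * (κ * κ)
      D = + 16 * ((1ℤ + μ) * (1ℤ + μ)) * (N * (1ℤ + slack) + + 2 * r * μ + + 6)
      0≤D : 0ℤ ≤ D
      0≤D = 0≤+ 16 ⊗ (0≤c ⊗ 0≤c) ⊗ (0≤size W ⊗ (0≤+ 1 ⊕ 0≤slack) ⊕ 0≤+ 2 ⊗ 0≤+ (suc ρ) ⊗ 0≤+ m ⊕ 0≤+ 6)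
      0<E : 0ℤ < E
      0<E = 0<≡ (κ * κ * ws) (+ 4 * ((1ℤ + μ) * (1ℤ + μ)) * (N * (1ℤ + slack) + + 2 * r * μ + + 2))
        (0<* (0<* {κ} {κ} (0<suc _) (0<suc _)) 0<ws)
        (0≤+ 4 ⊗ (0≤c ⊗ 0≤c) ⊗ (0≤size W ⊗ (0≤+ 1 ⊕ 0≤slack) ⊕ 0≤+ 2 ⊗ 0≤+ (suc ρ) ⊗ 0≤+ m ⊕ 0≤+ 2))
        (E≡ N r μ)
        where
        E≡ : ∀ N r μ → let κ = (1ℤ + μ) + (1ℤ + μ) ; a = + 4 * r * (1ℤ + μ) - r - + 3 in
          + 4 * (r + + 3) * ((1ℤ + μ) * (1ℤ + μ)) * N - + 3 * (κ * r - 1ℤ) * (κ * κ)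
          ≡ κ * κ * (+ 6 * (N - 1ℤ) - (a + a) + 1ℤ) + + 4 * ((1ℤ + μ) * (1ℤ + μ)) * (N * (1ℤ + (r - + 4)) + + 2 * r * μ + + 2)
        E≡ = solve-∀
      ef≡ : ∀ N r μ → let κ = (1ℤ + μ) + (1ℤ + μ) ; a = + 4 * r * (1ℤ + μ) - r - + 3 in
        + 4 * (r + + 3) * ((1ℤ + μ) * (1ℤ + μ)) * N - + 3 * (κ * r - 1ℤ) * (κ * κ)
        ≡ + 4 * ((1ℤ + μ) * (1ℤ + μ) * ((+ 4 * r * κ - r - + 3) * N) - a * κ * ((1ℤ + μ) * N)) - + 3 * (κ * r - 1ℤ) * (κ * κ)
      ef≡ = solve-∀
      eg≡ : ∀ N r μ → let κ = (1ℤ + μ) + (1ℤ + μ) ; a = + 4 * r * (1ℤ + μ) - r - + 3 in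
        + 4 * (r + + 3) * ((1ℤ + μ) * (1ℤ + μ)) * N - + 3 * (κ * r - 1ℤ) * (κ * κ)
        ≡ + 4 * ((κ - (1ℤ + μ)) * (κ - (1ℤ + μ)) * ((+ 4 * r * κ - r - + 3) * N) - a * κ * ((κ - (1ℤ + μ)) * N)) - + 3 * (κ * r - 1ℤ) * (κ * κ)
      eg≡ = solve-∀
      c₁≡ : ∀ N r μ → let κ = (1ℤ + μ) + (1ℤ + μ) ; a = + 4 * r * (1ℤ + μ) - r - + 3 in
        + 2 * + 2 * ((+ 4 * (r + + 3) * ((1ℤ + μ) * (1ℤ + μ)) * N - + 3 * (κ * r - 1ℤ) * (κ * κ)) + + 4 * (κ * κ) * 1ℤ)
        ≡ + 4 * (κ * κ) * (1ℤ * 1ℤ) * (+ 6 * (N - 1ℤ) - (a + a) + 1ℤ)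
          + + 16 * ((1ℤ + μ) * (1ℤ + μ)) * (N * (1ℤ + (r - + 4)) + + 2 * r * μ + + 6)
      c₁≡ = solve-∀
      c₂≡ : ∀ N r μ → let κ = (1ℤ + μ) + (1ℤ + μ) ; a = + 4 * r * (1ℤ + μ) - r - + 3 in
        + 2 * + 2 * ((+ 4 * (r + + 3) * ((1ℤ + μ) * (1ℤ + μ)) * N - + 3 * (κ * r - 1ℤ) * (κ * κ)) + + 4 * (κ * κ) * 1ℤ)
        ≡ + 4 * (κ * κ) * ((+ 2 - 1ℤ) * (+ 2 - 1ℤ)) * (+ 6 * (N - 1ℤ) - (a + a) + 1ℤ)
          + + 16 * ((1ℤ + μ) * (1ℤ + μ)) * (N * (1ℤ + (r - + 4)) + + 2 * r * μ + + 6)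
      c₂≡ = solve-∀

    -- The choices of the even case remain, but 4 k₁ k₂ is now k² - 1. The coefficient `p` of N
    -- stays nonnegative because r ≥ 4; the same polynomial at r = 3 has the value -6.
    halve-odd : ∀ m W → Dense (suc m ℕ.+ suc (suc m)) W → Core (threshold (suc m ℕ.+ suc (suc m))) (+ 3) W →
      System (suc m ℕ.+ suc (suc m)) (λ i → W i ≡ true) ⊎ Halves (suc m) (suc (suc m)) W
    halve-odd m W dense core-W =
      attempt {+ suc m} {κ} {1ℤ} {+ 2} {1ℤ} {E} {E} (0<suc _) (0≤+ (suc m)) (+≤+ (ℕ.m≤m+n (suc m) (suc (suc m))))
        (0<suc 1) (0≤+ 1) 0<E 0<E (≤-reflexive (ef≡ N r μ)) (≤-reflexive (eg≡ N r μ))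
        (by-diff D 0≤D (c₁≡ N r μ)) (by-diff D 0≤D (c₂≡ N r μ)) granular
      where
      open Attempt (suc m) (suc (suc m)) (ℕ.s≤s ℕ.z≤n) (ℕ.s≤s ℕ.z≤n) W dense core-W
      μ = + m
      0≤μ = 0≤+ m
      E = + 4 * (r + + 3) * ((1ℤ + μ) * (+ 2 + μ)) * N - + 3 * (κ * r - 1ℤ) * (κ * κ)
      p = + 2 + + 12 * μ + + 4 * μ * μ + + 8 * slack + slack * (+ 12 * μ + + 4 * μ * μ)
      0≤p : 0ℤ ≤ p
      0≤p = 0≤+ 2 ⊕ 0≤+ 12 ⊗ 0≤μ ⊕ 0≤+ 4 ⊗ 0≤μ ⊗ 0≤μ ⊕ 0≤+ 8 ⊗ 0≤slack ⊕ 0≤slack ⊗ (0≤+ 12 ⊗ 0≤μ ⊕ 0≤+ 4 ⊗ 0≤μ ⊗ 0≤μ)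
      D = + 4 * (N * p + κ * κ * (r * (1ℤ + + 2 * μ) + + 6))
      0≤κ² : 0ℤ ≤ κ * κ
      0≤κ² = 0≤sq κ
      0≤D : 0ℤ ≤ D
      0≤D = 0≤+ 4 ⊗ (0≤size W ⊗ 0≤p ⊕ 0≤κ² ⊗ (0≤+ (suc ρ) ⊗ (0≤+ 1 ⊕ 0≤+ 2 ⊗ 0≤μ) ⊕ 0≤+ 6))
      0<E : 0ℤ < E
      0<E = 0<≡ (κ * κ * ws) (N * p + κ * κ * (r * (1ℤ + + 2 * μ) + + 2))
        (0<* (0<* {κ} {κ} (0<suc _) (0<suc _)) 0<ws)
        (0≤size W ⊗ 0≤p ⊕ 0≤κ² ⊗ (0≤+ (suc ρ) ⊗ (0≤+ 1 ⊕ 0≤+ 2 ⊗ 0≤μ) ⊕ 0≤+ 2))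
        (E≡ N r μ)
        where
        E≡ : ∀ N r μ → let κ = (1ℤ + μ) + (+ 2 + μ) ; a = + 4 * r * (1ℤ + μ) - r - + 3 ; b = + 4 * r * (+ 2 + μ) - r - + 3 ; slack = r - + 4 in
          + 4 * (r + + 3) * ((1ℤ + μ) * (+ 2 + μ)) * N - + 3 * (κ * r - 1ℤ) * (κ * κ)
          ≡ κ * κ * (+ 6 * (N - 1ℤ) - (a + b) + 1ℤ)
            + (N * (+ 2 + + 12 * μ + + 4 * μ * μ + + 8 * slack + slack * (+ 12 * μ + + 4 * μ * μ)) + κ * κ * (r * (1ℤ + + 2 * μ) + + 2))
        E≡ = solve-∀
      ef≡ : ∀ N r μ → let κ = (1ℤ + μ) + (+ 2 + μ) ; a = + 4 * r * (1ℤ + μ) - r - + 3 in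
        + 4 * (r + + 3) * ((1ℤ + μ) * (+ 2 + μ)) * N - + 3 * (κ * r - 1ℤ) * (κ * κ)
        ≡ + 4 * ((1ℤ + μ) * (1ℤ + μ) * ((+ 4 * r * κ - r - + 3) * N) - a * κ * ((1ℤ + μ) * N)) - + 3 * (κ * r - 1ℤ) * (κ * κ)
      ef≡ = solve-∀
      eg≡ : ∀ N r μ → let κ = (1ℤ + μ) + (+ 2 + μ) ; b = + 4 * r * (+ 2 + μ) - r - + 3 in
        + 4 * (r + + 3) * ((1ℤ + μ) * (+ 2 + μ)) * N - + 3 * (κ * r - 1ℤ) * (κ * κ)
        ≡ + 4 * ((κ - (1ℤ + μ)) * (κ - (1ℤ + μ)) * ((+ 4 * r * κ - r - + 3) * N) - b * κ * ((κ - (1ℤ + μ)) * N)) - + 3 * (κ * r - 1ℤ) * (κ * κ)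
      eg≡ = solve-∀
      c₁≡ : ∀ N r μ → let κ = (1ℤ + μ) + (+ 2 + μ) ; a = + 4 * r * (1ℤ + μ) - r - + 3 ; b = + 4 * r * (+ 2 + μ) - r - + 3 ; slack = r - + 4 in
        + 2 * + 2 * ((+ 4 * (r + + 3) * ((1ℤ + μ) * (+ 2 + μ)) * N - + 3 * (κ * r - 1ℤ) * (κ * κ)) + + 4 * (κ * κ) * 1ℤ)
        ≡ + 4 * (κ * κ) * (1ℤ * 1ℤ) * (+ 6 * (N - 1ℤ) - (a + b) + 1ℤ)
          + + 4 * (N * (+ 2 + + 12 * μ + + 4 * μ * μ + + 8 * slack + slack * (+ 12 * μ + + 4 * μ * μ)) + κ * κ * (r * (1ℤ + + 2 * μ) + + 6))
      c₁≡ = solve-∀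
      c₂≡ : ∀ N r μ → let κ = (1ℤ + μ) + (+ 2 + μ) ; a = + 4 * r * (1ℤ + μ) - r - + 3 ; b = + 4 * r * (+ 2 + μ) - r - + 3 ; slack = r - + 4 in
        + 2 * + 2 * ((+ 4 * (r + + 3) * ((1ℤ + μ) * (+ 2 + μ)) * N - + 3 * (κ * r - 1ℤ) * (κ * κ)) + + 4 * (κ * κ) * 1ℤ)
        ≡ + 4 * (κ * κ) * ((+ 2 - 1ℤ) * (+ 2 - 1ℤ)) * (+ 6 * (N - 1ℤ) - (a + b) + 1ℤ)
          + + 4 * (N * (+ 2 + + 12 * μ + + 4 * μ * μ + + 8 * slack + slack * (+ 12 * μ + + 4 * μ * μ)) + κ * κ * (r * (1ℤ + + 2 * μ) + + 6))
      c₂≡ = solve-∀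

  -- Choice of the parameters for triangles

  module Triangles {n} (adj : Fin n → Fin n → Bool)
    (adj-sym : ∀ x y → adj x y ≡ adj y x) (adj-irref : ∀ x → adj x x ≡ false) where

    open OnGraph adj adj-sym adj-irref
    open Systems adj adj-sym adj-irref 2 ℕ.≤-refl

    -- Both Q S and the threshold are such that the excess is a multiple of 6.
    granular : ∀ {k} S → 1 ℕ.≤ k → - (+ 6) < + 3 * Q S - threshold k * size S → threshold k * size S ≤ + 3 * Q S
    granular {k} S _ lt with Q-even S
    ... | e , Q≡ = by-diff (+ 6 * z) (0≤+ 6 ⊗ <⇒1+≤ -1<z) (trans (cong (+ 3 *_) Q≡) (expand e (+ k) (size S)))
      where
      z = e - (+ 2 * + k - 1ℤ) * size S
      expand : ∀ e k s → + 3 * (+ 2 * e) ≡ (+ 4 * + 3 * k - + 3 - + 3) * s + + 6 * (e - (+ 2 * k - 1ℤ) * s)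
      expand = solve-∀
      factor : ∀ e k s → + 3 * (+ 2 * e) - (+ 4 * + 3 * k - + 3 - + 3) * s ≡ + 6 * (e - (+ 2 * k - 1ℤ) * s)
      factor = solve-∀
      -1<z : - 1ℤ < z
      -1<z = *-cancelˡ-<-nonNeg (+ 6) (subst (- (+ 6) <_) (trans (cong (λ q → + 3 * q - threshold k * size S) Q≡) (factor e (+ k) (size S))) lt)

    -- A dense set cannot be small, since Q is at most N (N - 1). This is what makes the surpluses
    -- after rounding positive.
    order-bound : ∀ {k} W → Dense k W → threshold k ≤ + 3 * (size W - 1ℤ)
    order-bound {k} W (1≤ , dense) = cancel-pos (size W) (1+≤⇒< 1≤) (begin
      size W * threshold k             ≡⟨ *-comm (size W) (threshold k) ⟩
      threshold k * size W             ≤⟨ dense ⟩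
      + 3 * Q W                        ≤⟨ *-monoˡ-≤-nonNeg (+ 3) (Q≤ W) ⟩
      + 3 * (size W * (size W - 1ℤ))   ≡⟨ swap (size W) ⟩
      size W * (+ 3 * (size W - 1ℤ))   ∎)
      where
      open ≤-Reasoning
      swap : ∀ s → + 3 * (s * (s - 1ℤ)) ≡ s * (+ 3 * (s - 1ℤ))
      swap = solve-∀

    -- The initial fraction and q are the share (2k₁ - 1) / (2k - 2) of the first
    -- threshold in the sum of the two thresholds.
    halve-even : ∀ m W → Dense (suc m ℕ.+ suc m) W → Core (threshold (suc m ℕ.+ suc m)) (+ 3) W →
      System (suc m ℕ.+ suc m) (λ i → W i ≡ true) ⊎ Halves (suc m) (suc m) W
    halve-even m W dense core-W =
      attempt {P} {P + P} {P} {P + P} {+ 6} {E} {E} 0<2P 0≤P (by-diff P 0≤P refl)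
        0<2P (0≤+ 6) 0<E 0<E (≤-reflexive (ef≡ N μ)) (≤-reflexive (eg≡ N μ))
        (by-diff D 0≤D (c₁≡ N μ)) (by-diff D 0≤D (c₂≡ N μ)) (λ {k} → granular {k})
      where
      open Attempt (suc m) (suc m) (ℕ.s≤s ℕ.z≤n) (ℕ.s≤s ℕ.z≤n) W dense core-W
      μ = + m
      P = 1ℤ + + 2 * μ
      0<P : 0ℤ < P
      0<P = 0<+ (0<suc 0) (0≤+ 2 ⊗ 0≤+ m)
      0≤P = <⇒≤ 0<P
      0<2P : 0ℤ < P + P
      0<2P = 0<+ 0<P 0≤P
      -- Both thresholds are 6 P, and each side starts with surplus 6 P² N. This cancels the N in q²
      -- ws, so `D` does not involve N.
      E = + 24 * (P * P) * N - + 3 * (κ * r - 1ℤ) * ((P + P) * (P + P))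
      D = (P + P) * (P + P) * (P * P) * (+ 24 * μ + + 104)
      0≤D : 0ℤ ≤ D
      0≤D = 0≤sq (P + P) ⊗ 0≤sq P ⊗ (0≤+ 24 ⊗ 0≤+ m ⊕ 0≤+ 104)
      0<E : 0ℤ < E
      0<E = pos-cancel (0≤+ 3) (subst (0ℤ <_) (sym (E≡ N μ))
        (0<* (0<* (0<suc 11) (0<* 0<P 0<P))
          (0<+ (0<suc 26) (0≤+ 2 ⊗ 0≤- (order-bound {suc m ℕ.+ suc m} W dense) ⊕ 0≤+ 30 ⊗ 0≤+ m))))
        where
        E≡ : ∀ N μ → let κ = (1ℤ + μ) + (1ℤ + μ) ; P = 1ℤ + + 2 * μ in
          + 3 * (+ 24 * (P * P) * N - + 3 * (κ * + 3 - 1ℤ) * ((P + P) * (P + P)))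
          ≡ + 12 * (P * P) * (+ 27 + (+ 2 * (+ 3 * (N - 1ℤ) - (+ 4 * + 3 * κ - + 3 - + 3)) + + 30 * μ))
        E≡ = solve-∀
      ef≡ : ∀ N μ → let κ = (1ℤ + μ) + (1ℤ + μ) ; P = 1ℤ + + 2 * μ ; a = + 4 * + 3 * (1ℤ + μ) - + 3 - + 3 ; R = P + P in
        + 24 * (P * P) * N - + 3 * (κ * + 3 - 1ℤ) * (R * R)
        ≡ + 4 * (P * P * ((+ 4 * + 3 * κ - + 3 - + 3) * N) - a * R * (P * N)) - + 3 * (κ * + 3 - 1ℤ) * (R * R)
      ef≡ = solve-∀
      eg≡ : ∀ N μ → let κ = (1ℤ + μ) + (1ℤ + μ) ; P = 1ℤ + + 2 * μ ; a = + 4 * + 3 * (1ℤ + μ) - + 3 - + 3 ; R = P + P in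
        + 24 * (P * P) * N - + 3 * (κ * + 3 - 1ℤ) * (R * R)
        ≡ + 4 * ((R - P) * (R - P) * ((+ 4 * + 3 * κ - + 3 - + 3) * N) - a * R * ((R - P) * N)) - + 3 * (κ * + 3 - 1ℤ) * (R * R)
      eg≡ = solve-∀
      c₁≡ : ∀ N μ → let κ = (1ℤ + μ) + (1ℤ + μ) ; P = 1ℤ + + 2 * μ ; a = + 4 * + 3 * (1ℤ + μ) - + 3 - + 3 ; R = P + P in
        R * R * ((+ 24 * (P * P) * N - + 3 * (κ * + 3 - 1ℤ) * (R * R)) + + 4 * (R * R) * + 6)
        ≡ + 4 * (R * R) * (P * P) * (+ 6 * (N - 1ℤ) - (a + a) + 1ℤ) + R * R * (P * P) * (+ 24 * μ + + 104)
      c₁≡ = solve-∀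
      c₂≡ : ∀ N μ → let κ = (1ℤ + μ) + (1ℤ + μ) ; P = 1ℤ + + 2 * μ ; a = + 4 * + 3 * (1ℤ + μ) - + 3 - + 3 ; R = P + P in
        R * R * ((+ 24 * (P * P) * N - + 3 * (κ * + 3 - 1ℤ) * (R * R)) + + 4 * (R * R) * + 6)
        ≡ + 4 * (R * R) * ((R - P) * (R - P)) * (+ 6 * (N - 1ℤ) - (a + a) + 1ℤ) + R * R * (P * P) * (+ 24 * μ + + 104)
      c₂≡ = solve-∀

    module Odd (m : ℕ) (W : VSet) (dense : Dense (suc m ℕ.+ suc (suc m)) W)
      (core-W : Core (threshold (suc m ℕ.+ suc (suc m))) (+ 3) W) where

      open Attempt (suc m) (suc (suc m)) (ℕ.s≤s ℕ.z≤n) (ℕ.s≤s ℕ.z≤n) W dense core-W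

      Result : Set₁
      Result = System (suc m ℕ.+ suc (suc m)) (λ i → W i ≡ true) ⊎ Halves (suc m) (suc (suc m)) W

      μ P R E : ℤ
      μ = + m
      P = 1ℤ + + 2 * μ
      R = + 4 * (1ℤ + μ)
      E = + 24 * (P * P) * N - + 3 * (κ * r - 1ℤ) * (R * R)

      -- The sides start with surpluses 6 P² N and 6 (R - P)² N, in the ratio q² : (1 - q)², so N
      -- cancels in both conditions on the last vertex. What can fail is positivity on the smaller
      -- side, which is therefore a hypothesis.
      proportional : 0ℤ < E → Result
      proportional 0<E = attempt {P} {R} {P} {R} {+ 6} {E} {E′} 0<R 0≤P (by-diff (+ 3 + + 2 * μ) (0≤+ 3 ⊕ 0≤+ 2 ⊗ 0≤μ) (R≡ μ))
        0<R (0≤+ 6) 0<E 0<E′ (≤-reflexive (ef≡ N μ)) (≤-reflexive (eg≡ N μ))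
        (by-diff (R * R * D₁) (0≤sq R ⊗ 0≤D₁) (c₁≡ N μ)) (by-diff (R * R * D₂) (0≤sq R ⊗ 0≤D₂) (c₂≡ N μ)) (λ {k} → granular {k})
        where
        0≤μ = 0≤+ m
        0≤P : 0ℤ ≤ P
        0≤P = 0≤+ 1 ⊕ 0≤+ 2 ⊗ 0≤μ
        0<R : 0ℤ < R
        0<R = 0<* (0<suc 3) (0<suc m)
        R≡ : ∀ μ → + 4 * (1ℤ + μ) ≡ 1ℤ + + 2 * μ + (+ 3 + + 2 * μ)
        R≡ = solve-∀
        E′ = + 24 * ((R - P) * (R - P)) * N - + 3 * (κ * r - 1ℤ) * (R * R)
        D₁ = + 116 + + 272 * μ + + 272 * μ * μ + + 96 * μ * μ * μ
        0≤D₁ : 0ℤ ≤ D₁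
        0≤D₁ = 0≤+ 116 ⊕ 0≤+ 272 ⊗ 0≤μ ⊕ 0≤+ 272 ⊗ 0≤μ ⊗ 0≤μ ⊕ 0≤+ 96 ⊗ 0≤μ ⊗ 0≤μ ⊗ 0≤μ
        c = 1ℤ + μ
        0≤c = 0≤+ (suc m)
        D₂ = + 96 * c * c * c + + 752 * c * c + + 176 * c + + 20
        0≤D₂ : 0ℤ ≤ D₂
        0≤D₂ = 0≤+ 96 ⊗ 0≤c ⊗ 0≤c ⊗ 0≤c ⊕ 0≤+ 752 ⊗ 0≤c ⊗ 0≤c ⊕ 0≤+ 176 ⊗ 0≤c ⊕ 0≤+ 20
        0<E′ : 0ℤ < E′
        0<E′ = pos-cancel (0≤+ 3) (0<≡ (+ 216)
          (+ 24 * ((R - P) * (R - P)) * (+ 3 * (N - 1ℤ) - threshold (suc m ℕ.+ suc (suc m)))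
            + (+ 1440 * c * c * c + + 2880 * c * c + + 1440 * c))
          (0<suc 215)
          (0≤+ 24 ⊗ 0≤sq (R - P) ⊗ 0≤- (order-bound {suc m ℕ.+ suc (suc m)} W dense)
            ⊕ (0≤+ 1440 ⊗ 0≤c ⊗ 0≤c ⊗ 0≤c ⊕ 0≤+ 2880 ⊗ 0≤c ⊗ 0≤c ⊕ 0≤+ 1440 ⊗ 0≤c))
          (E′≡ N μ))
          where
          E′≡ : ∀ N μ → let κ = (1ℤ + μ) + (+ 2 + μ) ; P = 1ℤ + + 2 * μ ; R = + 4 * (1ℤ + μ) ; c = 1ℤ + μ in
            + 3 * (+ 24 * ((R - P) * (R - P)) * N - + 3 * (κ * + 3 - 1ℤ) * (R * R))
            ≡ + 216 + (+ 24 * ((R - P) * (R - P)) * (+ 3 * (N - 1ℤ) - (+ 4 * + 3 * κ - + 3 - + 3))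
              + (+ 1440 * c * c * c + + 2880 * c * c + + 1440 * c))
          E′≡ = solve-∀
        ef≡ : ∀ N μ → let κ = (1ℤ + μ) + (+ 2 + μ) ; P = 1ℤ + + 2 * μ ; a = + 4 * + 3 * (1ℤ + μ) - + 3 - + 3 ; R = + 4 * (1ℤ + μ) in
          + 24 * (P * P) * N - + 3 * (κ * + 3 - 1ℤ) * (R * R)
          ≡ + 4 * (P * P * ((+ 4 * + 3 * κ - + 3 - + 3) * N) - a * R * (P * N)) - + 3 * (κ * + 3 - 1ℤ) * (R * R)
        ef≡ = solve-∀
        eg≡ : ∀ N μ → let κ = (1ℤ + μ) + (+ 2 + μ) ; P = 1ℤ + + 2 * μ ; b = + 4 * + 3 * (+ 2 + μ) - + 3 - + 3 ; R = + 4 * (1ℤ + μ) in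
          + 24 * ((R - P) * (R - P)) * N - + 3 * (κ * + 3 - 1ℤ) * (R * R)
          ≡ + 4 * ((R - P) * (R - P) * ((+ 4 * + 3 * κ - + 3 - + 3) * N) - b * R * ((R - P) * N)) - + 3 * (κ * + 3 - 1ℤ) * (R * R)
        eg≡ = solve-∀
        c₁≡ : ∀ N μ → let κ = (1ℤ + μ) + (+ 2 + μ) ; P = 1ℤ + + 2 * μ ; a = + 4 * + 3 * (1ℤ + μ) - + 3 - + 3 ; b = + 4 * + 3 * (+ 2 + μ) - + 3 - + 3 ; R = + 4 * (1ℤ + μ) in
          R * R * ((+ 24 * (P * P) * N - + 3 * (κ * + 3 - 1ℤ) * (R * R)) + + 4 * (R * R) * + 6)
          ≡ + 4 * (R * R) * (P * P) * (+ 6 * (N - 1ℤ) - (a + b) + 1ℤ)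
            + R * R * (+ 116 + + 272 * μ + + 272 * μ * μ + + 96 * μ * μ * μ)
        c₁≡ = solve-∀
        c₂≡ : ∀ N μ → let κ = (1ℤ + μ) + (+ 2 + μ) ; P = 1ℤ + + 2 * μ ; a = + 4 * + 3 * (1ℤ + μ) - + 3 - + 3 ; b = + 4 * + 3 * (+ 2 + μ) - + 3 - + 3 ; R = + 4 * (1ℤ + μ) ; c = 1ℤ + μ in
          R * R * ((+ 24 * ((R - P) * (R - P)) * N - + 3 * (κ * + 3 - 1ℤ) * (R * R)) + + 4 * (R * R) * + 6)
          ≡ + 4 * (R * R) * ((R - P) * (R - P)) * (+ 6 * (N - 1ℤ) - (a + b) + 1ℤ)
            + R * R * (+ 96 * c * c * c + + 752 * c * c + + 176 * c + + 20)
        c₂≡ = solve-∀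

    -- For three triangles in a small graph the proportional split is too
    -- coarse and one third of the vertices is taken instead.
    halve-odd : ∀ m W → Dense (suc m ℕ.+ suc (suc m)) W → Core (threshold (suc m ℕ.+ suc (suc m))) (+ 3) W →
      System (suc m ℕ.+ suc (suc m)) (λ i → W i ≡ true) ⊎ Halves (suc m) (suc (suc m)) W
    -- Here `E` is 24 N - 384, while density only yields N ≥ 11. With fraction 1/3 and q = 1/2 the
    -- conditions on the last vertex have slack 24 (43 - N) + 12, so 43 is the largest order they
    -- allow.
    halve-odd zero W dense core-W with size W ≤? + 43
    ... | no N≰43 = proportional (0<≡ (+ 672) (+ 24 * (N - + 44)) (0<suc 671) (0≤+ 24 ⊗ 0≤- (<⇒1+≤ (≰⇒> N≰43))) (E≡ N))
      where
      open Attempt 1 2 (ℕ.s≤s ℕ.z≤n) (ℕ.s≤s ℕ.z≤n) W dense core-W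
      open Odd zero W dense core-W
      E≡ : ∀ N → + 24 * (1ℤ * 1ℤ) * N - + 3 * (+ 3 * + 3 - 1ℤ) * (+ 4 * + 4) ≡ + 672 + + 24 * (N - + 44)
      E≡ = solve-∀
    ... | yes N≤43 = attempt {1ℤ} {+ 3} {1ℤ} {+ 2} {+ 6} {E₀} {E₀} (0<suc 2) (0≤+ 1) (+≤+ (ℕ.s≤s ℕ.z≤n))
        (0<suc 1) (0≤+ 6) 0<E₀ 0<E₀ (≤-reflexive (ef≡ N)) (≤-reflexive (eg≡ N))
        (by-diff (+ 24 * (+ 43 - N) + + 12) (0≤+ 24 ⊗ 0≤- N≤43 ⊕ 0≤+ 12) (c₁≡ N))
        (by-diff (+ 24 * (+ 43 - N) + + 12) (0≤+ 24 ⊗ 0≤- N≤43 ⊕ 0≤+ 12) (c₁≡ N)) (λ {k} → granular {k})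
      where
      open Attempt 1 2 (ℕ.s≤s ℕ.z≤n) (ℕ.s≤s ℕ.z≤n) W dense core-W
      E₀ = + 48 * N - + 216
      0<E₀ : 0ℤ < E₀
      0<E₀ = 0<≡ (+ 312) (+ 16 * (+ 3 * (N - 1ℤ) - + 30)) (0<suc 311) (0≤+ 16 ⊗ 0≤- (order-bound {3} W dense)) (E≡ N)
        where
        E≡ : ∀ N → + 48 * N - + 216 ≡ + 312 + + 16 * (+ 3 * (N - 1ℤ) - + 30)
        E≡ = solve-∀
      ef≡ : ∀ N → + 48 * N - + 216 ≡ + 4 * (1ℤ * (+ 30 * N) - + 18 * (1ℤ * N)) - + 216
      ef≡ = solve-∀
      eg≡ : ∀ N → + 48 * N - + 216 ≡ + 4 * (+ 4 * (+ 30 * N) - + 54 * (+ 2 * N)) - + 216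
      eg≡ = solve-∀
      c₁≡ : ∀ N → + 4 * ((+ 48 * N - + 216) + + 216) ≡ + 36 * (+ 6 * (N - 1ℤ) - + 24 + 1ℤ) + (+ 24 * (+ 43 - N) + + 12)
      c₁≡ = solve-∀
    -- From five triangles on, `order-bound` alone makes `E` positive.
    halve-odd (suc m) W dense core-W = proportional (pos-cancel (0≤+ 3) (0<≡ (+ 4248)
        (+ 24 * (P * P) * (+ 3 * (N - 1ℤ) - threshold (suc (suc m) ℕ.+ suc (suc (suc m))))
          + (+ 10080 * ν + + 6912 * ν * ν + + 1440 * ν * ν * ν))
        (0<suc 4247)
        (0≤+ 24 ⊗ 0≤sq P ⊗ 0≤- (order-bound {suc (suc m) ℕ.+ suc (suc (suc m))} W dense)
          ⊕ (0≤+ 10080 ⊗ 0≤ν ⊕ 0≤+ 6912 ⊗ 0≤ν ⊗ 0≤ν ⊕ 0≤+ 1440 ⊗ 0≤ν ⊗ 0≤ν ⊗ 0≤ν))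
        (E≡ N ν)))
      where
      open Attempt (suc (suc m)) (suc (suc (suc m))) (ℕ.s≤s ℕ.z≤n) (ℕ.s≤s ℕ.z≤n) W dense core-W
      open Odd (suc m) W dense core-W
      ν = + m
      0≤ν = 0≤+ m
      E≡ : ∀ N ν → let κ = (+ 2 + ν) + (+ 3 + ν) ; P = 1ℤ + + 2 * (1ℤ + ν) ; R = + 4 * (+ 2 + ν) in
        + 3 * (+ 24 * (P * P) * N - + 3 * (κ * + 3 - 1ℤ) * (R * R))
        ≡ + 4248 + (+ 24 * (P * P) * (+ 3 * (N - 1ℤ) - (+ 4 * + 3 * κ - + 3 - + 3))
          + (+ 10080 * ν + + 6912 * ν * ν + + 1440 * ν * ν * ν))
      E≡ = solve-∀

  -- Induction on the number of cycles

  data Halving : ℕ → Set where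
    one  : Halving 1
    even : ∀ m → Halving (suc m ℕ.+ suc m)
    odd  : ∀ m → Halving (suc m ℕ.+ suc (suc m))

  -- The parts are as equal as possible, since in `Long` the surplus is proportional to k₁ k₂.
  halving : ∀ k → Halving (suc k)
  halving zero = one
  halving (suc k) with suc k | halving k
  ... | _ | one    = even 0
  ... | _ | even m = subst Halving (ℕ.+-suc (suc m) (suc m)) (odd m)
  ... | _ | odd m  = even (suc m)

  module Packing {n} (adj : Fin n → Fin n → Bool)
    (adj-sym : ∀ x y → adj x y ≡ adj y x) (adj-irref : ∀ x → adj x x ≡ false) (ρ : ℕ) (2≤ρ : 2 ℕ.≤ ρ) where

    open OnGraph adj adj-sym adj-irref
    open Cycles adj adj-sym adj-irref ρ
    open Systems adj adj-sym adj-irref ρ 2≤ρ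

    Halver : ℕ → ℕ → Set₁
    Halver k₁ k₂ = ∀ W → Dense (k₁ ℕ.+ k₂) W → Core (threshold (k₁ ℕ.+ k₂)) (+ 3) W →
      System (k₁ ℕ.+ k₂) (λ i → W i ≡ true) ⊎ Halves k₁ k₂ W

    Packs : ℕ → Set₁
    Packs k = ∀ W → Dense k W → System k (λ i → W i ≡ true)

    packs-one : Packs 1
    packs-one W (1≤ , dense) =
      let c , cyc , ins = erdős-gallai 2≤ρ n W (size≤n W) 1≤ (cancel-pos (+ 3) (0<suc 2)
            (≤-trans (≤-reflexive (simp (+ ρ) (size W))) dense))
      in cons c cyc ins nil
      where
      simp : ∀ ρ s → + 3 * (ρ * s) ≡ (+ 4 * (1ℤ + ρ) * 1ℤ - (1ℤ + ρ) - + 3) * s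
      simp = solve-∀

    0<threshold : ∀ k → 0ℤ < threshold (suc k)
    0<threshold k = <-≤-trans (0<* (0<suc 2) (+<+ (ℕ.≤-trans (ℕ.s≤s ℕ.z≤n) 2≤ρ)))
      (by-diff (+ 4 * r * + k) (0≤+ 4 ⊗ 0≤+ (suc ρ) ⊗ 0≤+ k) (simp (+ ρ) (+ k)))
      where
      simp : ∀ ρ k → + 4 * (1ℤ + ρ) * (1ℤ + k) - (1ℤ + ρ) - + 3 ≡ + 3 * ρ + + 4 * (1ℤ + ρ) * k
      simp = solve-∀

    -- The core is taken before halving because the halving step requires positive vertex weights.
    packs-+ : ∀ k₁ k₂ → Halver (suc k₁) k₂ → Packs (suc k₁) → Packs k₂ → Packs (suc k₁ ℕ.+ k₂)
    packs-+ k₁ k₂ halve packs₁ packs₂ W (1≤ , dense)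
      with core (0<threshold (k₁ ℕ.+ k₂)) (0≤+ 3) n W (size≤n W) 1≤ dense
    ... | W′ , W′⊆W , 1≤′ , dense′ , core-W′ with halve W′ (1≤′ , dense′) core-W′
    ...   | inj₁ sys = System-mono W′⊆W sys
    ...   | inj₂ hs = System-∪ (packs₁ S dense-S) (packs₂ T dense-T)
      (λ i e → W′⊆W i (S⊆W i e)) (λ i e → W′⊆W i (T⊆W i e)) disjoint
      where open Halves hs

    packs : (∀ m → Halver (suc m) (suc m)) → (∀ m → Halver (suc m) (suc (suc m))) → ∀ k → 1 ℕ.≤ k → Packs k
    packs halve-even halve-odd = <-rec (λ k → 1 ℕ.≤ k → Packs k) λ where
        (suc k) rec _ → go (halving k) rec
      where
      go : ∀ {k} → Halving k → (∀ {j} → j ℕ.< k → 1 ℕ.≤ j → Packs j) → Packs k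
      go one      rec = packs-one
      go (even m) rec = packs-+ m (suc m) (halve-even m) IH IH
        where IH = rec (ℕ.m<m+n (suc m) (ℕ.s≤s ℕ.z≤n)) (ℕ.s≤s ℕ.z≤n)
      go (odd m)  rec = packs-+ m (suc (suc m)) (halve-odd m)
        (rec (ℕ.m<m+n (suc m) (ℕ.s≤s ℕ.z≤n)) (ℕ.s≤s ℕ.z≤n))
        (rec (ℕ.m<n+m (suc (suc m)) (ℕ.s≤s ℕ.z≤n)) (ℕ.s≤s ℕ.z≤n))

  packing : ∀ {n} (adj : Fin n → Fin n → Bool) (adj-sym : ∀ x y → adj x y ≡ adj y x) (adj-irref : ∀ x → adj x x ≡ false)
    (ρ : ℕ) (2≤ρ : 2 ℕ.≤ ρ) → ∀ k → 1 ℕ.≤ k → Packing.Packs adj adj-sym adj-irref ρ 2≤ρ k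
  packing adj adj-sym adj-irref (suc (suc zero)) (ℕ.s≤s (ℕ.s≤s ℕ.z≤n)) =
    packs halve-even halve-odd
    where
    open Packing adj adj-sym adj-irref 2 (ℕ.s≤s (ℕ.s≤s ℕ.z≤n))
    open Triangles adj adj-sym adj-irref
  packing adj adj-sym adj-irref (suc (suc (suc ρ))) (ℕ.s≤s (ℕ.s≤s ℕ.z≤n)) =
    packs halve-even halve-odd
    where
    open Packing adj adj-sym adj-irref (suc (suc (suc ρ))) (ℕ.s≤s (ℕ.s≤s ℕ.z≤n))
    open Long adj adj-sym adj-irref (suc (suc (suc ρ))) (ℕ.s≤s (ℕ.s≤s (ℕ.s≤s ℕ.z≤n)))

  -- Minors from branch sets

  ∨-introˡ : ∀ {p q} → p ≡ true → p ∨ q ≡ true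
  ∨-introˡ refl = refl

  ∨-introʳ : ∀ p {q} → q ≡ true → p ∨ q ≡ true
  ∨-introʳ true  _ = refl
  ∨-introʳ false e = e

  ∨-elim : ∀ p {q} → p ∨ q ≡ true → p ≡ true ⊎ q ≡ true
  ∨-elim true  _ = inj₁ refl
  ∨-elim false e = inj₂ e

  ∧-elim : ∀ p {q} → p ∧ q ≡ true → p ≡ true × q ≡ true
  ∧-elim true e = refl , e

  eqᶠ⇒≡ : ∀ {m} {x y : Fin m} → eqᶠ x y ≡ true → x ≡ y
  eqᶠ⇒≡ {x = x} {y} e with x ≟ y
  ... | yes x≡y = x≡y

  ≡⇒eqᶠ : ∀ {m} {x y : Fin m} → x ≡ y → eqᶠ x y ≡ true
  ≡⇒eqᶠ {x = x} refl = eqᶠ-refl x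

  ≢⇒eqᶠ : ∀ {m} {x y : Fin m} → x ≢ y → eqᶠ x y ≡ false
  ≢⇒eqᶠ {x = x} {y} x≢y with x ≟ y
  ... | yes x≡y = ⊥-elim (x≢y x≡y)
  ... | no _    = refl

  ≡true⇒T : ∀ {p} → p ≡ true → True p
  ≡true⇒T refl = _

  mkGraph-adj : ∀ {m} a {x y : Fin m} → x ≢ y → a x y ≡ true → adj (mkGraph m a) x y ≡ true
  mkGraph-adj a {x} {y} x≢y e rewrite ≢⇒eqᶠ x≢y | e = refl

  mkGraph-adj⁻ : ∀ {m} a {x y : Fin m} → adj (mkGraph m a) x y ≡ true → a x y ≡ true ⊎ a y x ≡ true
  mkGraph-adj⁻ a {x} {y} e = ∨-elim (a x y) (proj₂ (∧-elim (not (eqᶠ x y)) e))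

  graph-≢ : ∀ G {x y} → adj G x y ≡ true → x ≢ y
  graph-≢ G {x} e refl with () ← trans (sym e) (adj-irref G x)

  -- Spanning subgraphs

  spanning : ∀ (H G : Graph) (rep : Fin (n H) → Fin (n G)) (label : Fin (n G) → Fin (n H)) →
    (∀ x → rep (label x) ≡ x) → (∀ h → label (rep h) ≡ h) →
    (∀ h h′ → adj H h h′ ≡ true → adj G (rep h) (rep h′) ≡ true) →
    (extra : List (Fin (n G) × Fin (n G))) →
    (∀ x y → adj G x y ≡ true → adj H (label x) (label y) ≡ false → (x , y) ∈ extra) → H ≼ G
  spanning H G rep label rl lr edges [] none = done record
    { bij  = mk↔ₛ′ rep label rl lr
    ; pres = pres
    }
    where
    pres : ∀ h h′ → adj G (rep h) (rep h′) ≡ adj H h h′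
    pres h h′ with adj H h h′ in eH | adj G (rep h) (rep h′) in eG
    ... | true  | true  = refl
    ... | false | false = refl
    ... | true  | false with () ← trans (sym eG) (edges h h′ eH)
    ... | false | true
      with () ← none (rep h) (rep h′) eG (trans (cong₂ (adj H) (lr h) (lr h′)) eH)
  spanning H G rep label rl lr edges ((x , y) ∷ extra) covers
    with adj G x y Bool.≟ true | adj H (label x) (label y) Bool.≟ false
  ... | no ¬xy | _ = spanning H G rep label rl lr edges extra covers′
    where
    covers′ : ∀ u v → adj G u v ≡ true → adj H (label u) (label v) ≡ false → (u , v) ∈ extra
    covers′ u v uv ¬H with covers u v uv ¬H
    ... | here refl = ⊥-elim (¬xy uv)
    ... | there ∈extra = ∈extra
  ... | yes _ | no H-xy = spanning H G rep label rl lr edges extra covers′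
    where
    covers′ : ∀ u v → adj G u v ≡ true → adj H (label u) (label v) ≡ false → (u , v) ∈ extra
    covers′ u v uv ¬H with covers u v uv ¬H
    ... | here refl = ⊥-elim (H-xy ¬H)
    ... | there ∈extra = ∈extra
  ... | yes xy | yes ¬H-xy = step (del-edge G x y (≡true⇒T xy))
    (spanning H (deleteEdge G x y) rep label rl lr edges′ extra covers′)
    where
    removed : Fin (n G) → Fin (n G) → Bool
    removed u v = (eqᶠ u x ∧ eqᶠ v y) ∨ (eqᶠ u y ∧ eqᶠ v x)
    keep : Fin (n G) → Fin (n G) → Bool
    keep u v = adj G u v ∧ not (removed u v)
    removed⁻ : ∀ {u v} → removed u v ≡ true → (u ≡ x × v ≡ y) ⊎ (u ≡ y × v ≡ x)
    removed⁻ {u} {v} e with ∨-elim (eqᶠ u x ∧ eqᶠ v y) e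
    ... | inj₁ e′ = inj₁ (eqᶠ⇒≡ (proj₁ (∧-elim (eqᶠ u x) e′)) , eqᶠ⇒≡ (proj₂ (∧-elim (eqᶠ u x) e′)))
    ... | inj₂ e′ = inj₂ (eqᶠ⇒≡ (proj₁ (∧-elim (eqᶠ u y) e′)) , eqᶠ⇒≡ (proj₂ (∧-elim (eqᶠ u y) e′)))
    kept-not-removed : ∀ {u v} → keep u v ≡ true → removed u v ≡ false
    kept-not-removed {u} {v} e with removed u v | proj₂ (∧-elim (adj G u v) e)
    ... | false | _ = refl
    edges′ : ∀ h h′ → adj H h h′ ≡ true → adj (deleteEdge G x y) (rep h) (rep h′) ≡ true
    edges′ h h′ hh′ = mkGraph-adj keep (graph-≢ G (edges h h′ hh′)) kept
      where
      not-removed : removed (rep h) (rep h′) ≢ true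
      not-removed e with removed⁻ e
      ... | inj₁ (hx , h′y) with () ← trans (sym ¬H-xy) (trans (cong₂ (adj H) (trans (cong label (sym hx)) (lr h)) (trans (cong label (sym h′y)) (lr h′))) hh′)
      ... | inj₂ (hy , h′x) with () ← trans (sym ¬H-xy) (trans (cong₂ (adj H) (trans (cong label (sym h′x)) (lr h′)) (trans (cong label (sym hy)) (lr h)))
                                         (trans (adj-sym H h′ h) hh′))
      kept : keep (rep h) (rep h′) ≡ true
      kept with removed (rep h) (rep h′) in eq
      ... | true  = ⊥-elim (not-removed eq)
      ... | false rewrite edges h h′ hh′ = refl
    covers′ : ∀ u v → adj (deleteEdge G x y) u v ≡ true → adj H (label u) (label v) ≡ false → (u , v) ∈ extra
    covers′ u v uv ¬H with covers u v (in-G (mkGraph-adj⁻ keep uv)) ¬H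
      where
      in-G : keep u v ≡ true ⊎ keep v u ≡ true → adj G u v ≡ true
      in-G (inj₁ e) = proj₁ (∧-elim (adj G u v) e)
      in-G (inj₂ e) = trans (adj-sym G u v) (proj₁ (∧-elim (adj G v u) e))
    ... | there ∈extra = ∈extra
    ... | here refl with mkGraph-adj⁻ keep {u} {v} uv
    ...   | inj₁ e with () ← trans (sym (kept-not-removed e)) (∨-introˡ (cong₂ _∧_ (eqᶠ-refl u) (eqᶠ-refl v)))
    ...   | inj₂ e with () ← trans (sym (kept-not-removed e)) (∨-introʳ (eqᶠ v u ∧ eqᶠ u v) (cong₂ _∧_ (eqᶠ-refl v) (eqᶠ-refl u)))

  -- Branch-set models

  record Model (H : Graph) {m} (adjG : Fin m → Fin m → Bool) : Set where
    field
      branch     : Fin m → Maybe (Fin (n H))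
      rep        : Fin (n H) → Fin m
      branch-rep : ∀ h → branch (rep h) ≡ just h
      connected  : ∀ {x h} → branch x ≡ just h → Star (λ a b → adjG a b ≡ true × branch a ≡ branch b) x (rep h)
      edges      : ∀ h h′ → adj H h h′ ≡ true →
                   ∃ λ x → ∃ λ y → branch x ≡ just h × branch y ≡ just h′ × adjG x y ≡ true

  punchIn-surj : ∀ {m} (v : Fin (suc m)) {y} → y ≢ v → ∃ λ y′ → punchIn v y′ ≡ y
  punchIn-surj v y≢v = punchOut (λ e → y≢v (sym e)) , Fin.punchIn-punchOut _

  module _ {H : Graph} where

    delete-model : ∀ {m} (adjG : Fin (suc m) → Fin (suc m) → Bool) → (∀ x → adjG x x ≡ false) →
      (M : Model H adjG) (v : Fin (suc m)) → Model.branch M v ≡ nothing → Model H (adj (deleteVertex m adjG v))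
    delete-model {m} adjG irref M v v∉ = record
      { branch = λ x → branch (punchIn v x)
      ; rep = λ h → proj₁ (rep′ h)
      ; branch-rep = λ h → trans (cong branch (proj₂ (rep′ h))) (branch-rep h)
      ; connected = λ {x} {h} e → walk refl (proj₂ (rep′ h)) e (connected e)
      ; edges = edges′
      }
      where
      open Model M
      labelled : ∀ {x h} → branch x ≡ just h → x ≢ v
      labelled e refl with () ← trans (sym v∉) e
      rep′ : ∀ h → ∃ λ y → punchIn v y ≡ rep h
      rep′ h = punchIn-surj v (labelled (branch-rep h))
      a : Fin m → Fin m → Bool
      a x y = adjG (punchIn v x) (punchIn v y)
      adj⁺ : ∀ {x y} → a x y ≡ true → adj (deleteVertex m adjG v) x y ≡ true
      adj⁺ {x} {y} e = mkGraph-adj a (λ { refl → case-irref e }) e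
        where
        case-irref : ∀ {x} → a x x ≡ true → ⊥
        case-irref {x} e with () ← trans (sym e) (irref (punchIn v x))
      walk : ∀ {y z y′ z′ h} → punchIn v y′ ≡ y → punchIn v z′ ≡ z → branch y ≡ just h →
        Star (λ a b → adjG a b ≡ true × branch a ≡ branch b) y z →
        Star (λ a b → adj (deleteVertex m adjG v) a b ≡ true × branch (punchIn v a) ≡ branch (punchIn v b)) y′ z′
      walk {y′ = y′} {z′} ey ez by ε with Fin.punchIn-injective v y′ z′ (trans ey (sym ez))
      ... | refl = ε
      walk ey ez by (_◅_ {j = b} (yb , same) rest) with punchIn-surj v (labelled (trans (sym same) by))
      ... | b′ , eb = (adj⁺ (trans (cong₂ adjG ey eb) yb) , trans (cong branch ey) (trans same (cong branch (sym eb))))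
                      ◅ walk eb ez (trans (sym same) by) rest
      edges′ : ∀ h h′ → adj H h h′ ≡ true → ∃ λ x → ∃ λ y →
        branch (punchIn v x) ≡ just h × branch (punchIn v y) ≡ just h′ × adj (deleteVertex m adjG v) x y ≡ true
      edges′ h h′ hh′ with edges h h′ hh′
      ... | x , y , bx , by , xy with punchIn-surj v (labelled bx) | punchIn-surj v (labelled by)
      ...   | x′ , refl | y′ , refl = x′ , y′ , bx , by , adj⁺ xy

    -- As `u` and `v` lie in the same branch set, merging them shortens walks but joins no two
    -- branch sets. `v` disappears, so it must not be a representative.
    contract-model : ∀ {m} (adjG : Fin (suc m) → Fin (suc m) → Bool) →
      (∀ x y → adjG x y ≡ adjG y x) → (∀ x → adjG x x ≡ false) →
      (M : Model H adjG) (u v : Fin (suc m)) → u ≢ v → Model.branch M u ≡ Model.branch M v →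
      (∀ h → Model.rep M h ≢ v) → Model H (adj (contractEdge m adjG u v))
    contract-model {m} adjG adjG-sym irref M u v u≢v same rep≢v = record
      { branch = λ x → branch (punchIn v x)
      ; rep = λ h → proj₁ (rep′ h)
      ; branch-rep = λ h → trans (cong branch (proj₂ (rep′ h))) (branch-rep h)
      ; connected = λ {x} {h} e → subst (λ z → Star R′ z _) (π-punchIn x) (walk (proj₂ (rep′ h)) (connected e))
      ; edges = edges′
      }
      where
      open Model M
      G′ = contractEdge m adjG u v
      R′ : Fin m → Fin m → Set
      R′ a b = adj G′ a b ≡ true × branch (punchIn v a) ≡ branch (punchIn v b)
      rep′ : ∀ h → ∃ λ y → punchIn v y ≡ rep h
      rep′ h = punchIn-surj v (rep≢v h)
      u′ : Fin m
      u′ = proj₁ (punchIn-surj v u≢v)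
      pu : punchIn v u′ ≡ u
      pu = proj₂ (punchIn-surj v u≢v)
      π : Fin (suc m) → Fin m
      π y with y ≟ v
      ... | yes _  = u′
      ... | no y≢v = proj₁ (punchIn-surj v y≢v)
      -- π y is the vertex of the contracted graph that y is merged into.
      π-view : ∀ y → (y ≡ v × π y ≡ u′) ⊎ punchIn v (π y) ≡ y
      π-view y with y ≟ v
      ... | yes y≡v = inj₁ (y≡v , refl)
      ... | no y≢v  = inj₂ (proj₂ (punchIn-surj v y≢v))
      π-punchIn : ∀ x → π (punchIn v x) ≡ x
      π-punchIn x with π-view (punchIn v x)
      ... | inj₁ (e , _) = ⊥-elim (Fin.punchInᵢ≢i v x e)
      ... | inj₂ e       = Fin.punchIn-injective v _ _ e
      branch-π : ∀ y → branch (punchIn v (π y)) ≡ branch y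
      branch-π y with π-view y
      ... | inj₁ (refl , e) = trans (cong (λ z → branch (punchIn v z)) e) (trans (cong branch pu) same)
      ... | inj₂ e          = cong branch e
      a : Fin m → Fin m → Bool
      a x y = adjG (punchIn v x) (punchIn v y)
        ∨ (eqᶠ (punchIn v x) u ∧ adjG v (punchIn v y)) ∨ (eqᶠ (punchIn v y) u ∧ adjG (punchIn v x) v)
      π-adj : ∀ y z → adjG y z ≡ true → π y ≡ π z ⊎ adj G′ (π y) (π z) ≡ true
      π-adj y z yz = decide (π y ≟ π z)
        where
        related : π y ≢ π z → (y ≡ v × π y ≡ u′) ⊎ punchIn v (π y) ≡ y → (z ≡ v × π z ≡ u′) ⊎ punchIn v (π z) ≡ z →
          a (π y) (π z) ≡ true
        related πy≢πz (inj₁ (refl , ey)) (inj₁ (refl , ez)) = ⊥-elim (πy≢πz refl)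
        related _ (inj₁ (refl , ey)) (inj₂ ez) = ∨-introʳ (adjG (punchIn v (π y)) (punchIn v (π z)))
          (∨-introˡ (cong₂ _∧_ (≡⇒eqᶠ (trans (cong (punchIn v) ey) pu)) (trans (cong (adjG v) ez) yz)))
        related _ (inj₂ ey) (inj₁ (refl , ez)) = ∨-introʳ (adjG (punchIn v (π y)) (punchIn v (π z)))
          (∨-introʳ (eqᶠ (punchIn v (π y)) u ∧ adjG v (punchIn v (π z)))
            (cong₂ _∧_ (≡⇒eqᶠ (trans (cong (punchIn v) ez) pu)) (trans (cong (λ y → adjG y v) ey) yz)))
        related _ (inj₂ ey) (inj₂ ez) = ∨-introˡ (trans (cong₂ adjG ey ez) yz)
        decide : Dec (π y ≡ π z) → π y ≡ π z ⊎ adj G′ (π y) (π z) ≡ true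
        decide (yes e)    = inj₁ e
        decide (no πy≢πz) = inj₂ (mkGraph-adj a πy≢πz (related πy≢πz (π-view y) (π-view z)))
      walk : ∀ {y z z′} → punchIn v z′ ≡ z →
        Star (λ a b → adjG a b ≡ true × branch a ≡ branch b) y z → Star R′ (π y) z′
      walk {z′ = z′} refl ε = subst (λ p → Star R′ p z′) (sym (π-punchIn z′)) ε
      walk {y} {z′ = z′} ez (_◅_ {j = b} (yb , same-yb) rest) with π-adj y b yb
      ... | inj₁ e = subst (λ p → Star R′ p z′) (sym e) (walk ez rest)
      ... | inj₂ e = (e , trans (branch-π y) (trans same-yb (sym (branch-π b)))) ◅ walk ez rest
      edges′ : ∀ h h′ → adj H h h′ ≡ true → ∃ λ x → ∃ λ y →
        branch (punchIn v x) ≡ just h × branch (punchIn v y) ≡ just h′ × adj G′ x y ≡ true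
      edges′ h h′ hh′ with edges h h′ hh′
      ... | x , y , bx , by , xy with π-adj x y xy
      ...   | inj₂ e = π x , π y , trans (branch-π x) bx , trans (branch-π y) by , e
      ...   | inj₁ e = ⊥-elim (graph-≢ H hh′ (just-injective
                (trans (sym bx) (trans (sym (branch-π x)) (trans (cong (λ z → branch (punchIn v z)) e) (trans (branch-π y) by))))))

    -- Unlabelled vertices are deleted. After that, a vertex that is not its representative is
    -- contracted into the next vertex of its walk to the representative. When only representatives
    -- remain, deleting edges suffices.
    model⇒minor : ∀ m adjG s i → Model H {m} adjG → H ≼ record { n = m ; adj = adjG ; adj-sym = s ; adj-irref = i }
    model⇒minor m adjG s i M with Fin.any? (λ x → ≡-dec _≟_ (Model.branch M x) nothing)
    model⇒minor (suc m) adjG s i M | yes (v , v∉) = step (del-vertex m adjG s i v)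
      (model⇒minor m _ (adj-sym (deleteVertex m adjG v)) (adj-irref (deleteVertex m adjG v)) (delete-model adjG i M v v∉))
    model⇒minor m adjG s i M | no covered = settle (Fin.any? (λ x → ¬? (rep (label x) ≟ x)))
      where
      open Model M
      label-view : ∀ x → ∃ λ h → branch x ≡ just h
      label-view x with branch x in e
      ... | just h  = h , refl
      ... | nothing = ⊥-elim (covered (x , e))
      label : Fin m → Fin (n H)
      label x = proj₁ (label-view x)
      settle : Dec (∃ λ x → rep (label x) ≢ x) → H ≼ record { n = m ; adj = adjG ; adj-sym = s ; adj-irref = i }
      settle (no none) = spanning H _ rep label rl lr direct (cartesianProduct (allFin m) (allFin m))
        (λ x y _ _ → ∈-cartesianProduct⁺ (∈-allFin x) (∈-allFin y))
        where
        rl : ∀ x → rep (label x) ≡ x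
        rl x with rep (label x) ≟ x
        ... | yes e = e
        ... | no ≢  = ⊥-elim (none (x , ≢))
        lr : ∀ h → label (rep h) ≡ h
        lr h = just-injective (trans (sym (proj₂ (label-view (rep h)))) (branch-rep h))
        at : ∀ {x h} → branch x ≡ just h → x ≡ rep h
        at {x} {h} e = trans (sym (rl x)) (cong rep (just-injective (trans (sym (proj₂ (label-view x))) e)))
        direct : ∀ h h′ → adj H h h′ ≡ true → adjG (rep h) (rep h′) ≡ true
        direct h h′ hh′ with edges h h′ hh′
        ... | x , y , bx , by , xy = trans (cong₂ adjG (sym (at bx)) (sym (at by))) xy
      settle (yes (v , v≢)) = contract-first m adjG s i M v (label v) (proj₂ (label-view v)) v≢ (connected (proj₂ (label-view v)))
        where
        -- Stated again for all `m`, so that matching on it can expose the successor required by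
        -- `contract`.
        contract-first : ∀ m adjG s i (M : Model H {m} adjG) v h → Model.branch M v ≡ just h → Model.rep M h ≢ v →
          Star (λ a b → adjG a b ≡ true × Model.branch M a ≡ Model.branch M b) v (Model.rep M h) →
          H ≼ record { n = m ; adj = adjG ; adj-sym = s ; adj-irref = i }
        contract-first m adjG s i M v h bv v≢ ε = ⊥-elim (v≢ refl)
        contract-first (suc m) adjG s i M v h bv v≢ (_◅_ {j = u} (vu , same) _) =
          step (contract m adjG s i u v (≡true⇒T (trans (s u v) vu)))
            (model⇒minor m _ (adj-sym (contractEdge m adjG u v)) (adj-irref (contractEdge m adjG u v))
              (contract-model adjG s i M u v loop (sym same) rep≢v))
          where
          loop : u ≢ v
          loop e with () ← trans (sym (subst (λ z → adjG v z ≡ true) e vu)) (i v)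
          rep≢v : ∀ h′ → Model.rep M h′ ≢ v
          rep≢v h′ e = v≢ (trans (cong (Model.rep M) (just-injective
            (trans (sym bv) (trans (cong (Model.branch M) (sym e)) (Model.branch-rep M h′))))) e)

  -- Branch sets from disjoint long cycles

  at : ∀ {A : Set} (xs : List A) j → j ℕ.< length xs → A
  at xs j j< = lookup xs (fromℕ< j<)

  lookup-injective : ∀ {A : Set} {xs : List A} → Unique xs → ∀ i j → lookup xs i ≡ lookup xs j → i ≡ j
  lookup-injective {xs = x ∷ xs} un zero zero _ = refl
  lookup-injective {xs = x ∷ xs} (x∉ ∷ un) zero (suc j) e = ⊥-elim (All.lookup x∉ (∈-lookup {xs = xs} j) e)
  lookup-injective {xs = x ∷ xs} (x∉ ∷ un) (suc i) zero e = ⊥-elim (All.lookup x∉ (∈-lookup {xs = xs} i) (sym e))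
  lookup-injective {xs = x ∷ xs} (x∉ ∷ un) (suc i) (suc j) e = cong suc (lookup-injective un i j e)

  linked-at : ∀ {A : Set} {R : A → A → Set} xs {ys} → Linked R (xs ++ ys) → ∀ j (sj< : suc j ℕ.< length xs) (j< : j ℕ.< length xs) →
    R (at xs j j<) (at xs (suc j) sj<)
  linked-at (x ∷ y ∷ xs) (r ∷ lk) zero    (ℕ.s≤s (ℕ.s≤s _)) (ℕ.s≤s _) = r
  linked-at (x ∷ y ∷ xs) (r ∷ lk) (suc j) (ℕ.s≤s sj<) (ℕ.s≤s j<) = linked-at (y ∷ xs) lk j sj< j<
  linked-at (x ∷ []) _ j (ℕ.s≤s ()) _

  linked-last : ∀ {A : Set} {R : A → A → Set} y l {z} → Linked R (y ∷ l ++ z ∷ []) → ∀ j (j< : j ℕ.< suc (length l)) → j ≡ length l →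
    R (at (y ∷ l) j j<) z
  linked-last y []       (r ∷ _)  zero    (ℕ.s≤s _)  _ = r
  linked-last y (y′ ∷ l) (_ ∷ lk) (suc j) (ℕ.s≤s j<) e = linked-last y′ l lk j j< (ℕ.suc-injective e)

  module CycleModel {n} (adj′ : Fin n → Fin n → Bool)
    (adj-sym′ : ∀ x y → adj′ x y ≡ adj′ y x) (adj-irref′ : ∀ x → adj′ x x ≡ false) (ρ : ℕ) (2≤ρ : 2 ℕ.≤ ρ) where

    open Cycles adj′ adj-sym′ adj-irref′ ρ
    open Systems adj′ adj-sym′ adj-irref′ ρ 2≤ρ
    open DecMembership (_≟_ {n}) using (_∈?_)

    family : ∀ {k P} → System k P → Fin k → List V
    family (cons c _ _ _)    zero    = c
    family (cons _ _ _ rest) (suc i) = family rest i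

    family-cycle : ∀ {k P} (s : System k P) i → IsCycle (family s i)
    family-cycle (cons _ cyc _ _)  zero    = cyc
    family-cycle (cons _ _ _ rest) (suc i) = family-cycle rest i

    family-inside : ∀ {k P} (s : System k P) i {x} → x ∈ family s i → P x
    family-inside (cons _ _ ins _)  zero    x∈ = All.lookup ins x∈
    family-inside (cons _ _ _ rest) (suc i) x∈ = proj₁ (family-inside rest i x∈)

    family-disjoint : ∀ {k P} (s : System k P) i j {x} → x ∈ family s i → x ∈ family s j → i ≡ j
    family-disjoint (cons _ _ _ _)    zero    zero    _  _  = refl
    family-disjoint (cons _ _ _ rest) zero    (suc j) x∈ y∈ = ⊥-elim (proj₂ (family-inside rest j y∈) x∈)
    family-disjoint (cons _ _ _ rest) (suc i) zero    x∈ y∈ = ⊥-elim (proj₂ (family-inside rest i x∈) y∈)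
    family-disjoint (cons _ _ _ rest) (suc i) (suc j) x∈ y∈ = cong suc (family-disjoint rest i j x∈ y∈)

    -- The vertex in position j of a cycle represents position min(j, ρ) of a
    -- cycle of order ρ + 1.
    clamp : ℕ → Fin (suc ρ)
    clamp j = fromℕ< (ℕ.s≤s (ℕ.m⊓n≤n j ρ))

    clamp-cong : ∀ {i j} → i ℕ.⊓ ρ ≡ j ℕ.⊓ ρ → clamp i ≡ clamp j
    clamp-cong {i} {j} e = Fin.toℕ-injective (trans (Fin.toℕ-fromℕ< _) (trans e (sym (Fin.toℕ-fromℕ< _))))

    clamp-toℕ : ∀ a → clamp (toℕ a) ≡ a
    clamp-toℕ a = Fin.toℕ-injective (trans (Fin.toℕ-fromℕ< _) (ℕ.m≤n⇒m⊓n≡m (ℕ.≤-pred (Fin.toℕ<n a))))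

    module _ {k P} (s : System k P) where

      c : Fin k → List V
      c = family s

      long : ∀ i → suc ρ ℕ.≤ length (c i)
      long i with c i | family-cycle s i
      ... | _ | cycle _ _ le = le

      unique : ∀ i → Unique (c i)
      unique i with c i | family-cycle s i
      ... | _ | cycle _ un _ = un

      branch : V → Maybe (Fin (k ℕ.* suc ρ))
      branch v with Fin.any? (λ i → v ∈? c i)
      ... | yes (i , v∈) = just (combine i (clamp (toℕ (index v∈))))
      ... | no _         = nothing

      branch-at : ∀ i j (j< : j ℕ.< length (c i)) → branch (at (c i) j j<) ≡ just (combine i (clamp j))
      branch-at i j j< with Fin.any? (λ i′ → at (c i) j j< ∈? c i′)
      ... | no none = ⊥-elim (none (i , ∈-lookup {xs = c i} (fromℕ< j<)))
      ... | yes (i′ , v∈) with family-disjoint s i′ i v∈ (∈-lookup {xs = c i} (fromℕ< j<))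
      ...   | refl = cong (λ p → just (combine i (clamp p))) (trans
        (cong toℕ (lookup-injective (unique i) (index v∈) (fromℕ< j<) (sym (lookup-index v∈)))) (Fin.toℕ-fromℕ< j<))

      branch⁻ : ∀ {x h} → branch x ≡ just h → ∃ λ i → ∃ λ j → ∃ λ j< → x ≡ at (c i) j j< × h ≡ combine i (clamp j)
      branch⁻ {x} e with Fin.any? (λ i → x ∈? c i)
      ... | yes (i , x∈) = i , toℕ (index x∈) , Fin.toℕ<n (index x∈) ,
        trans (lookup-index x∈) (cong (lookup (c i)) (sym (Fin.fromℕ<-toℕ (index x∈) (Fin.toℕ<n (index x∈))))) , sym (just-injective e)
      branch⁻ () | no _

      position< : ∀ i (a : Fin (suc ρ)) → toℕ a ℕ.< length (c i)
      position< i a = ℕ.<-≤-trans (Fin.toℕ<n a) (long i)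

      rep-at : ∀ i (a : Fin (suc ρ)) → V
      rep-at i a = at (c i) (toℕ a) (position< i a)

      rep : Fin (k ℕ.* suc ρ) → V
      rep h = rep-at (proj₁ (remQuot {k} (suc ρ) h)) (proj₂ (remQuot {k} (suc ρ) h))

      rep-combine : ∀ i a → rep (combine i a) ≡ rep-at i a
      rep-combine i a = cong (λ p → rep-at (proj₁ p) (proj₂ p)) (Fin.remQuot-combine i a)

      branch-rep-at : ∀ i a → branch (rep-at i a) ≡ just (combine i a)
      branch-rep-at i a = trans (branch-at i (toℕ a) (position< i a)) (cong (λ p → just (combine i p)) (clamp-toℕ a))

      Step′ : V → V → Set
      Step′ x y = adj′ x y ≡ true × branch x ≡ branch y

      at-irrelevant : ∀ {xs : List V} {i j} (i< : i ℕ.< length xs) (j< : j ℕ.< length xs) → i ≡ j → at xs i i< ≡ at xs j j<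
      at-irrelevant i< j< refl = refl

      consecutive : ∀ i j (sj< : suc j ℕ.< length (c i)) (j< : j ℕ.< length (c i)) → Adj (at (c i) j j<) (at (c i) (suc j) sj<)
      consecutive i j with c i | family-cycle s i
      ... | x ∷ l | cycle lk _ _ = linked-at (x ∷ l) lk j

      closing : ∀ i j (j< : j ℕ.< length (c i)) (0< : 0 ℕ.< length (c i)) → suc j ≡ length (c i) → Adj (at (c i) j j<) (at (c i) 0 0<)
      closing i j with c i | family-cycle s i
      ... | x ∷ l | cycle lk _ _ = λ { j< (ℕ.s≤s _) e → linked-last x l lk j j< (ℕ.suc-injective e) }

      -- All positions from `ρ` on have the same image under `clamp`, so going back along the cycle
      -- to position `ρ` stays in one branch set.
      walk : ∀ i j (j< : j ℕ.< length (c i)) → Star Step′ (at (c i) j j<) (rep-at i (clamp j))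
      walk i j j< with j ℕ.≤? ρ
      ... | yes j≤ρ = subst (λ v → Star Step′ (at (c i) j j<) v)
        (at-irrelevant {c i} j< (position< i (clamp j)) (sym (trans (Fin.toℕ-fromℕ< _) (ℕ.m≤n⇒m⊓n≡m j≤ρ)))) ε
      walk i zero j< | no j≰ρ = ⊥-elim (j≰ρ ℕ.z≤n)
      walk i (suc j) j< | no j≰ρ = (Adj-sym (consecutive i j j< j<′) ,
          trans (branch-at i (suc j) j<) (trans (cong (λ p → just (combine i p)) clamp≡) (sym (branch-at i j j<′))))
        ◅ subst (λ a → Star Step′ (at (c i) j j<′) (rep-at i a)) (sym clamp≡) (walk i j j<′)
        where
        j<′ = ℕ.<-trans (ℕ.n<1+n j) j<
        ρ≤j : ρ ℕ.≤ j
        ρ≤j = ℕ.≤-pred (ℕ.≰⇒> j≰ρ)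
        clamp≡ : clamp (suc j) ≡ clamp j
        clamp≡ = clamp-cong (trans (ℕ.m≥n⇒m⊓n≡n (ℕ.m≤n⇒m≤1+n ρ≤j)) (sym (ℕ.m≥n⇒m⊓n≡n ρ≤j)))

      connected : ∀ {x h} → branch x ≡ just h → Star Step′ x (rep h)
      connected e with branch⁻ e
      ... | i , j , j< , refl , refl = subst (Star Step′ (at (c i) j j<)) (sym (rep-combine i (clamp j))) (walk i j j<)

      Joined : Fin (k ℕ.* suc ρ) → Fin (k ℕ.* suc ρ) → Set
      Joined h h′ = ∃ λ x → ∃ λ y → branch x ≡ just h × branch y ≡ just h′ × adj′ x y ≡ true

      Joined-sym : ∀ {h h′} → Joined h h′ → Joined h′ h
      Joined-sym (x , y , bx , by , xy) = y , x , by , bx , Adj-sym xy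

      joined-suc : ∀ i (a b : Fin (suc ρ)) → toℕ b ≡ suc (toℕ a) ℕ.% suc ρ → Joined (combine i a) (combine i b)
      joined-suc i a b b≡ with suc (toℕ a) ℕ.<? suc ρ
      ... | yes sa< = rep-at i a , rep-at i b , branch-rep-at i a , branch-rep-at i b ,
        subst (Adj (rep-at i a)) (at-irrelevant {c i} (ℕ.<-≤-trans sa< (long i)) (position< i b) (sym b≡sa))
          (consecutive i (toℕ a) (ℕ.<-≤-trans sa< (long i)) (position< i a))
        where
        b≡sa : toℕ b ≡ suc (toℕ a)
        b≡sa = trans b≡ (m<n⇒m%n≡m sa<)
      -- Position `ρ` is followed by position 0. The joining edge is the closing edge of the cycle,
      -- whose end `last` belongs to the branch set of position `ρ`.
      ... | no sa≮ = at (c i) last last< , rep-at i b ,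
        trans (branch-at i last last<) (cong (λ p → just (combine i p))
          (trans (clamp-cong (trans (ℕ.m≥n⇒m⊓n≡n ρ≤last) (sym (trans (cong (ℕ._⊓ ρ) a≡ρ) (ℕ.⊓-idem ρ))))) (clamp-toℕ a))) ,
        branch-rep-at i b ,
        subst (Adj (at (c i) last last<)) (at-irrelevant {c i} 0< (position< i b) (sym b≡0)) (closing i last last< 0< suc-last)
        where
        a≡ρ : toℕ a ≡ ρ
        a≡ρ = ℕ.≤-antisym (ℕ.≤-pred (Fin.toℕ<n a)) (ℕ.≤-pred (ℕ.≮⇒≥ sa≮))
        b≡0 : toℕ b ≡ 0
        b≡0 = trans b≡ (trans (cong (λ z → suc z ℕ.% suc ρ) a≡ρ) (n%n≡0 (suc ρ)))
        last = ℕ.pred (length (c i))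
        0< : 0 ℕ.< length (c i)
        0< = ℕ.≤-trans (ℕ.s≤s ℕ.z≤n) (long i)
        suc-last : suc last ≡ length (c i)
        suc-last = ℕ.suc-pred (length (c i)) {{ℕ.>-nonZero 0<}}
        last< : last ℕ.< length (c i)
        last< = ℕ.≤-reflexive suc-last
        ρ≤last : ρ ℕ.≤ last
        ρ≤last = ℕ.≤-pred (ℕ.≤-trans (long i) (ℕ.≤-reflexive (sym suc-last)))

      pos : Fin (k ℕ.* suc ρ) → Fin k × Fin (suc ρ)
      pos = remQuot {k} (suc ρ)

      aH : Fin (k ℕ.* suc ρ) → Fin (k ℕ.* suc ρ) → Bool
      aH x y = eqᶠ (proj₁ (pos x)) (proj₁ (pos y))
        ∧ ((toℕ (proj₂ (pos y)) ℕ.≡ᵇ (suc (toℕ (proj₂ (pos x))) ℕ.% suc ρ))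
          ∨ (toℕ (proj₂ (pos x)) ℕ.≡ᵇ (suc (toℕ (proj₂ (pos y))) ℕ.% suc ρ)))

      joined : ∀ h h′ → aH h h′ ≡ true → Joined h h′
      joined h h′ e with ∧-elim (eqᶠ (proj₁ (pos h)) (proj₁ (pos h′))) e
      ... | same , succ = subst₂ Joined (Fin.combine-remQuot {k} (suc ρ) h)
        (trans (cong (λ (i : Fin k) → combine i (proj₂ (pos h′))) (eqᶠ⇒≡ {k} {proj₁ (pos h)} {proj₁ (pos h′)} same)) (Fin.combine-remQuot {k} (suc ρ) h′))
        (go (∨-elim (toℕ (proj₂ (pos h′)) ℕ.≡ᵇ (suc (toℕ (proj₂ (pos h))) ℕ.% suc ρ)) succ))
        where
        i = proj₁ (pos h)
        a = proj₂ (pos h)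
        b = proj₂ (pos h′)
        go : (toℕ b ℕ.≡ᵇ (suc (toℕ a) ℕ.% suc ρ)) ≡ true ⊎ (toℕ a ℕ.≡ᵇ (suc (toℕ b) ℕ.% suc ρ)) ≡ true →
          Joined (combine i a) (combine i b)
        go (inj₁ e) = joined-suc i a b (ℕ.≡ᵇ⇒≡ _ _ (≡true⇒T e))
        go (inj₂ e) = Joined-sym (joined-suc i b a (ℕ.≡ᵇ⇒≡ _ _ (≡true⇒T e)))

      system-model : Model (disjointCycles k (suc ρ)) adj′
      system-model = record
        { branch = branch
        ; rep = rep
        ; branch-rep = λ h → trans (branch-rep-at _ _) (cong just (Fin.combine-remQuot {k} (suc ρ) h))
        ; connected = connected
        ; edges = λ h h′ e → edge h h′ (mkGraph-adj⁻ aH {h} {h′} e)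
        }
        where
        edge : ∀ h h′ → aH h h′ ≡ true ⊎ aH h′ h ≡ true → Joined h h′
        edge h h′ (inj₁ e) = joined h h′ e
        edge h h′ (inj₂ e) = Joined-sym (joined h′ h e)

  -- Counting edges

  sumPairs : ∀ {n} → Matrix n → List (Fin n × Fin n) → ℤ
  sumPairs K []             = 0ℤ
  sumPairs K ((x , y) ∷ ps) = K x y + sumPairs K ps

  sumPairs-++ : ∀ {n} (K : Matrix n) ps qs → sumPairs K (ps ++ qs) ≡ sumPairs K ps + sumPairs K qs
  sumPairs-++ K []             qs = sym (+-identityˡ _)
  sumPairs-++ K ((x , y) ∷ ps) qs = trans (cong (λ s → K x y + s) (sumPairs-++ K ps qs)) (sym (+-assoc (K x y) _ _))

  sumPairs-row : ∀ {n} (K : Matrix n) x ys → sumPairs K (map (λ y → (x , y)) ys) ≡ sumOn (K x) ys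
  sumPairs-row K x []       = refl
  sumPairs-row K x (y ∷ ys) = cong (λ s → K x y + s) (sumPairs-row K x ys)

  sumPairs-concatMap : ∀ {n} (K : Matrix n) ys xs →
    sumPairs K (concatMap (λ x → map (λ y → (x , y)) ys) xs) ≡ sumOn (λ x → sumOn (K x) ys) xs
  sumPairs-concatMap K ys []       = refl
  sumPairs-concatMap K ys (x ∷ xs) = trans (sumPairs-++ K (map (λ y → (x , y)) ys) _)
    (cong₂ _+_ (sumPairs-row K x ys) (sumPairs-concatMap K ys xs))

  sumOn-tabulate : ∀ {m n} (f : Fin n → ℤ) (g : Fin m → Fin n) → sumOn f (tabulate g) ≡ sum (λ i → f (g i))
  sumOn-tabulate {zero}  f g = refl
  sumOn-tabulate {suc m} f g = cong (λ s → f (g zero) + s) (sumOn-tabulate f (λ i → g (suc i)))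

  upper : ∀ {n} → Matrix n → Matrix n
  upper K x y = ⟦ does (toℕ x ℕ.<? toℕ y) ⟧ * K x y

  half-upper : ∀ {n} (K : Matrix n) → sum (λ i → sum (λ j → upper K i j)) ≡ half K
  half-upper {zero}  K = refl
  half-upper {suc n} K = cong₂ _+_
    (trans (+-identityˡ _) (sum-cong-≗ {n} (λ j → *-identityˡ (K zero (suc j)))))
    (trans (sum-cong-≗ {n} (λ i → +-identityˡ _)) (half-upper (λ i j → K (suc i) (suc j))))

  edgeCount-half : ∀ G → + edgeCount G ≡ half (λ x y → ⟦ adj G x y ⟧)
  edgeCount-half G = begin
    + edgeCount G
      ≡⟨ count (allPairs (n G)) ⟩
    sumPairs (upper K) (allPairs (n G))
      ≡⟨ sumPairs-concatMap (upper K) (allFin (n G)) (allFin (n G)) ⟩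
    sumOn (λ x → sumOn (upper K x) (allFin (n G))) (allFin (n G))
      ≡⟨ sumOn-tabulate (λ x → sumOn (upper K x) (allFin (n G))) (λ i → i) ⟩
    sum (λ x → sumOn (upper K x) (allFin (n G)))
      ≡⟨ sum-cong-≗ {n G} (λ x → sumOn-tabulate (upper K x) (λ i → i)) ⟩
    sum (λ x → sum (upper K x))
      ≡⟨ half-upper K ⟩
    half K ∎
    where
    open ≡-Reasoning
    K : Matrix (n G)
    K x y = ⟦ adj G x y ⟧
    count : ∀ ps → + length (filter (λ p → toℕ (proj₁ p) ℕ.<? toℕ (proj₂ p))
                     (filter (λ p → adj G (proj₁ p) (proj₂ p) Bool.≟ true) ps)) ≡ sumPairs (upper K) ps
    count [] = refl
    count ((x , y) ∷ ps) with adj G x y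
    ... | false = trans (count ps) (sym (trans (cong (λ z → z + sumPairs (upper K) ps) (*-zeroʳ ⟦ does (toℕ x ℕ.<? toℕ y) ⟧)) (+-identityˡ _)))
    ... | true with does (toℕ x ℕ.<? toℕ y)
    ...   | true  = cong (λ s → 1ℤ + s) (count ps)
    ...   | false = trans (count ps) (sym (+-identityˡ _))

  -- From average degree to the minor

  cycles-minor : (k r : ℕ) → 1 ℕ.≤ k → 3 ℕ.≤ r → (G : Graph) → 0 ℕ.< n G →
      2 ℕ.* (k ℕ.* r) ℕ.* n G ℕ.≤ 3 ℕ.* edgeCount G →
      disjointCycles k r ≼ G
  cycles-minor k (suc ρ) 1≤k (ℕ.s≤s 2≤ρ) G 0<n dense =
    model⇒minor (n G) (adj G) (adj-sym G) (adj-irref G)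
      (system-model (packing (adj G) (adj-sym G) (adj-irref G) ρ 2≤ρ k 1≤k all (1≤size-all , dense-all)))
    where
    open CycleModel (adj G) (adj-sym G) (adj-irref G) ρ 2≤ρ
    open OnGraph (adj G) (adj-sym G) (adj-irref G)
    open Systems (adj G) (adj-sym G) (adj-irref G) ρ 2≤ρ using (threshold)
    E = edgeCount G
    all : VSet
    all _ = true
    size-all : size all ≡ + n G
    size-all = sum-1 (n G)
    1≤size-all : 1ℤ ≤ size all
    1≤size-all = subst (1ℤ ≤_) (sym size-all) (+≤+ 0<n)
    Q-all : Q all ≡ + 2 * + E
    Q-all = trans (sum-cong-≗ {n G} (λ i → trans (*-identityˡ _) (sum-cong-≗ {n G} (λ j → *-identityʳ (A i j)))))
      (trans (sum-symmetric A A-sym A-diag) (cong (+ 2 *_) (sym (edgeCount-half G))))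
    dense-all : threshold k * size all ≤ + 3 * Q all
    dense-all = subst₂ (λ s q → threshold k * s ≤ + 3 * q) (sym size-all) (sym Q-all)
      -- The hypothesis says 6 E ≥ 4 k r n, which exceeds the threshold times n by (r + 3) n.
      (by-diff (+ 2 * (+ 3 * + E - + 2 * (+ k * + suc ρ) * + n G) + (+ suc ρ + + 3) * + n G)
        (0≤+ 2 ⊗ 0≤- dense-ℤ ⊕ (0≤+ (suc ρ) ⊕ 0≤+ 3) ⊗ 0≤+ (n G))
        (simp (+ suc ρ) (+ k) (+ n G) (+ E)))
      where
      simp : ∀ r k n e → + 3 * (+ 2 * e) ≡ (+ 4 * r * k - r - + 3) * n + (+ 2 * (+ 3 * e - + 2 * (k * r) * n) + (r + + 3) * n)
      simp = solve-∀
      dense-ℤ : + 2 * (+ k * + suc ρ) * + n G ≤ + 3 * + E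
      dense-ℤ = subst₂ _≤_
        (trans (pos-* (2 ℕ.* (k ℕ.* suc ρ)) (n G)) (cong (_* + n G) (trans (pos-* 2 (k ℕ.* suc ρ)) (cong (+ 2 *_) (pos-* k (suc ρ))))))
        (pos-* 3 E) (+≤+ dense)

open import Data.Nat using (ℕ; _*_; _≤_; _≥_; _<_)
open import Data.Nat.Properties using (≤-trans; m≤n+m)

theorem2 : (k r : ℕ) → 6 ≤ k → 3 ≤ r → (G : Graph) → 0 < n G →
    2 * (k * r) * n G ≤ 3 * edgeCount G →
    disjointCycles k r ≼ G
theorem2 k r 6≤k = DisjointCycles.cycles-minor k r (≤-trans (m≤n+m 1 5) 6≤k)
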